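{- For any $k \geq 0$, \textsc{1-Edge Contraction($\gamma_{t2}$)} is polynomial-time solvable on $(P_3+kP_2)$-free graphs.
   Context: All graphs are finite, simple and connected. A semitotal dominating set of $G$ is a set $D\subseteq V(G)$ such that every vertex outside $D$ has a neighbour in $D$ and every vertex of $D$ is at distance at most two from another vertex of $D$; $\gamma_{t2}(G)$ is its minimum size. $ct_{\gamma_{t2}}(G)$ is the smallest $k$ such that contracting some $k$ edges of $G$ (contracting $uv$ replaces $u,v$ by one vertex adjacent to all neighbours of $u$ or $v$) yields $G'$ with $\gamma_{t2}(G')<\gamma_{t2}(G)$. \textsc{1-Edge Contraction($\gamma_{t2}$)}: given $G$, decide whether $ct_{\gamma_{t2}}(G)\leq 1$. $P_3+kP_2$ is the disjoint union of a path on three vertices and $k$ copies of a single edge. -}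

module Defs where

open import Data.Bool.Base using (if_then_else_)
open import Data.Empty using (⊥)
open import Data.Fin.Base using (Fin; toℕ; fromℕ<; splitAt; remQuot; punchIn)
import Data.Fin.Properties as Fin
open import Data.Fin.Subset using (Subset; _∈_; _∉_; ∣_∣)
open import Data.Nat.Base using (ℕ; zero; suc; _+_; _*_; _∸_; _^_; _≤_; _<_; _≡ᵇ_)
open import Data.Nat.Properties using (_≟_; _<?_; 1+n≢n)
open import Data.Product.Base using (Σ-syntax; ∃-syntax; _×_; _,_; uncurry)
open import Data.Sum.Base using (_⊎_; inj₁; inj₂; swap)
open import Data.Sum.Relation.Binary.Pointwise using (Pointwise; inj₁; inj₂; ⊎-symmetric; ⊎-decidable)
open import Function.Base using (_∘_; _on_)
open import Function.Bundles using (_⇔_)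
open import Function.Definitions using (Injective)
open import Level using (0ℓ; _⊔_)
open import Relation.Binary.Core using (Rel)
open import Relation.Binary.Definitions using (Symmetric; Decidable)
open import Relation.Binary.PropositionalEquality using (_≡_; _≢_; refl; sym)
open import Relation.Nullary using (¬_; yes; no; does; ¬?; _×-dec_; _⊎-dec_)

record Graph (n : ℕ) : Set₁ where
  field
    Adj        : Rel (Fin n) 0ℓ
    adj?       : Decidable Adj
    adj-sym    : Symmetric Adj
    adj-irrefl : ∀ {u} → ¬ Adj u u

open Graph public

data Walk {n} (G : Graph n) : ℕ → Fin n → Fin n → Set where
  here : ∀ {u} → Walk G 0 u u
  step : ∀ {ℓ u v w} → Adj G u v → Walk G ℓ v w → Walk G (suc ℓ) u w

DistAtMost : ∀ {n} → Graph n → ℕ → Fin n → Fin n → Set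
DistAtMost G d u v = ∃[ ℓ ] (ℓ ≤ d × Walk G ℓ u v)

Connected : ∀ {n} → Graph n → Set
Connected G = ∀ u v → ∃[ ℓ ] Walk G ℓ u v

Path : ∀ n → Graph n
Path n = record
  { Adj        = λ i j → toℕ j ≡ suc (toℕ i) ⊎ toℕ i ≡ suc (toℕ j)
  ; adj?       = λ i j → (toℕ j ≟ suc (toℕ i)) ⊎-dec (toℕ i ≟ suc (toℕ j))
  ; adj-sym    = swap
  ; adj-irrefl = λ { (inj₁ e) → 1+n≢n (sym e) ; (inj₂ e) → 1+n≢n (sym e) }
  }

Empty : Graph 0
Empty = record
  { Adj        = λ _ _ → ⊥
  ; adj?       = λ ()
  ; adj-sym    = λ ()
  ; adj-irrefl = λ ()
  }

infixr 6 _⊕_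
_⊕_ : ∀ {m n} → Graph m → Graph n → Graph (m + n)
_⊕_ {m} G H = record
  { Adj        = Pointwise (Adj G) (Adj H) on splitAt m
  ; adj?       = λ i j → ⊎-decidable (adj? G) (adj? H) (splitAt m i) (splitAt m j)
  ; adj-sym    = ⊎-symmetric (adj-sym G) (adj-sym H)
  ; adj-irrefl = λ {u} → irrefl (splitAt m u)
  }
  where
  irrefl : ∀ x → ¬ Pointwise (Adj G) (Adj H) x x
  irrefl (inj₁ _) (inj₁ e) = adj-irrefl G e
  irrefl (inj₂ _) (inj₂ e) = adj-irrefl H e

copies : ∀ {n} k → Graph n → Graph (k * n)
copies zero    G = Empty
copies (suc k) G = G ⊕ copies k G

P₃+_P₂ : ∀ k → Graph (3 + k * 2)
P₃+ k P₂ = Path 3 ⊕ copies k (Path 2)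

InducedIn : ∀ {m n} → Graph m → Graph n → Set
InducedIn {m} {n} H G = Σ[ f ∈ (Fin m → Fin n) ]
  (Injective _≡_ _≡_ f × (∀ i j → Adj H i j ⇔ Adj G (f i) (f j)))

Free : ∀ {m n} → Graph m → Graph n → Set
Free H G = ¬ InducedIn H G

-- The merged vertex keeps the name u; the vertex v is deleted, and a : Fin n
-- names the surviving vertex punchIn v a of G.
contract : ∀ {n} → Graph (suc n) → (u v : Fin (suc n)) → Graph n
contract {n} G u v = record
  { Adj        = λ a b → a ≢ b × Merged (ι a) (ι b)
  ; adj?       = λ a b → ¬? (a Fin.≟ b) ×-dec merged? (ι a) (ι b)
  ; adj-sym    = λ (a≢b , m) → a≢b ∘ sym , merged-sym m
  ; adj-irrefl = λ (a≢a , _) → a≢a refl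
  }
  where
  ι : Fin n → Fin (suc n)
  ι = punchIn v

  Merged : Rel (Fin (suc n)) 0ℓ
  Merged x y = Adj G x y ⊎ (x ≡ u × Adj G v y) ⊎ (y ≡ u × Adj G v x)

  merged? : Decidable Merged
  merged? x y = adj? G x y
    ⊎-dec ((x Fin.≟ u) ×-dec adj? G v y)
    ⊎-dec ((y Fin.≟ u) ×-dec adj? G v x)

  merged-sym : Symmetric Merged
  merged-sym (inj₁ e) = inj₁ (adj-sym G e)
  merged-sym (inj₂ m) = inj₂ (swap m)

data _⟶[_]_ : ∀ {m n} → Graph m → ℕ → Graph n → Set₁ where
  done : ∀ {n} {G : Graph n} → G ⟶[ 0 ] G
  step : ∀ {m n k} {G : Graph (suc m)} {H : Graph n} u v → Adj G u v →
         contract G u v ⟶[ k ] H → G ⟶[ suc k ] H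

IsLeast : ∀ {ℓ} → (ℕ → Set ℓ) → ℕ → Set ℓ
IsLeast P m = P m × (∀ j → P j → m ≤ j)

SemitotalDominating : ∀ {n} → Graph n → Subset n → Set
SemitotalDominating G D =
  (∀ v → v ∉ D → ∃[ u ] (u ∈ D × Adj G v u)) ×
  (∀ v → v ∈ D → ∃[ w ] (w ∈ D × w ≢ v × DistAtMost G 2 v w))

-- No m qualifies for the one-vertex graph, which has no semitotal dominating set.
γt2[_]≡_ : ∀ {n} → Graph n → ℕ → Set
γt2[ G ]≡ m = IsLeast (λ s → ∃[ D ] (SemitotalDominating G D × ∣ D ∣ ≡ s)) m

_γt2<_ : ∀ {m n} → Graph m → Graph n → Set
H γt2< G = ∃[ a ] ∃[ b ] (γt2[ H ]≡ a × γt2[ G ]≡ b × a < b)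

ReducibleBy : ∀ {n} → Graph n → ℕ → Set₁
ReducibleBy G k = ∃[ m ] Σ[ H ∈ Graph m ] (G ⟶[ k ] H × H γt2< G)

ct[_]≡_ : ∀ {n} → Graph n → ℕ → Set₁
ct[ G ]≡ k = IsLeast (ReducibleBy G) k

OneEdgeContraction : ∀ {n} → Graph n → Set₁
OneEdgeContraction G = ∃[ k ] (ct[ G ]≡ k × k ≤ 1)

-- Unit-cost random access machine with addition and truncated subtraction, in
-- structured (while-program) form.  Multiplication is not an instruction, so
-- after t steps every value has O(t) bits more than the input, and polynomial
-- time here coincides with polynomial time on Turing machines.

infixl 6 _⊞_ _⊟_
data Expr : Set where
  lit     : ℕ → Expr
  reg     : ℕ → Expr
  mem     : Expr → Expr
  _⊞_ _⊟_ : Expr → Expr → Expr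

infix  4 _≔_ mem[_]≔_
infixr 3 _⨾_
data Program : Set where
  skip            : Program
  _≔_             : ℕ → Expr → Program
  mem[_]≔_        : Expr → Expr → Program
  _⨾_             : Program → Program → Program
  if≢0_then_else_ : Expr → Program → Program → Program
  while≢0_loop_   : Expr → Program → Program

record State : Set where
  constructor ⟨_,_⟩
  field
    registers : ℕ → ℕ
    memory    : ℕ → ℕ

open State public

_[_↦_] : (ℕ → ℕ) → ℕ → ℕ → (ℕ → ℕ)
(f [ i ↦ x ]) j = if i ≡ᵇ j then x else f j

⟦_⟧ : Expr → State → ℕ
⟦ lit c ⟧ s = c
⟦ reg i ⟧ s = registers s i
⟦ mem e ⟧ s = memory s (⟦ e ⟧ s)
⟦ d ⊞ e ⟧ s = ⟦ d ⟧ s + ⟦ e ⟧ s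
⟦ d ⊟ e ⟧ s = ⟦ d ⟧ s ∸ ⟦ e ⟧ s

cost : Expr → ℕ
cost (lit _) = 1
cost (reg _) = 1
cost (mem e) = 1 + cost e
cost (d ⊞ e) = 1 + cost d + cost e
cost (d ⊟ e) = 1 + cost d + cost e

-- Exec p s t s′ : p started in s halts in s′ after exactly t steps.
data Exec : Program → State → ℕ → State → Set where
  skip   : ∀ {s} → Exec skip s 1 s
  assign : ∀ {i e s} →
           Exec (i ≔ e) s (1 + cost e)
                ⟨ registers s [ i ↦ ⟦ e ⟧ s ] , memory s ⟩
  store  : ∀ {d e s} →
           Exec (mem[ d ]≔ e) s (1 + cost d + cost e)
                ⟨ registers s , memory s [ ⟦ d ⟧ s ↦ ⟦ e ⟧ s ] ⟩
  seq    : ∀ {p q s s′ s″ t t′} →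
           Exec p s t s′ → Exec q s′ t′ s″ → Exec (p ⨾ q) s (t + t′) s″
  then′  : ∀ {e p q s s′ t} → ⟦ e ⟧ s ≢ 0 →
           Exec p s t s′ → Exec (if≢0 e then p else q) s (1 + cost e + t) s′
  else′  : ∀ {e p q s s′ t} → ⟦ e ⟧ s ≡ 0 →
           Exec q s t s′ → Exec (if≢0 e then p else q) s (1 + cost e + t) s′
  iter   : ∀ {e p s s′ s″ t t′} → ⟦ e ⟧ s ≢ 0 →
           Exec p s t s′ → Exec (while≢0 e loop p) s′ t′ s″ →
           Exec (while≢0 e loop p) s (1 + cost e + t + t′) s″
  exit   : ∀ {e p s} → ⟦ e ⟧ s ≡ 0 →
           Exec (while≢0 e loop p) s (1 + cost e) s

-- A graph on n vertices is presented with n in register 0 and its adjacency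
-- matrix, row by row, in memory cells 0 … n * n ∸ 1; all else is 0.
input : ∀ {n} → Graph n → State
input {n} G = ⟨ (λ _ → 0) [ 0 ↦ n ] , matrix ⟩
  where
  matrix : ℕ → ℕ
  matrix a with a <? n * n
  ... | yes a<n² = if does (uncurry (adj? G) (remQuot n (fromℕ< a<n²))) then 1 else 0
  ... | no  _    = 0

Accepting : State → Set
Accepting s = registers s 0 ≢ 0

-- One program decides the problem 𝒫 on every input from the class 𝒞, in a
-- number of steps polynomial in the number of vertices (equivalently, in the
-- n² bits of the adjacency matrix).
PolyTimeSolvableOn : ∀ {a b} → (∀ {n} → Graph n → Set a) → (∀ {n} → Graph n → Set b) → Set (Level.suc 0ℓ ⊔ a ⊔ b)
PolyTimeSolvableOn 𝒫 𝒞 =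
  Σ[ p ∈ Program ] ∃[ c ] ∃[ d ] (∀ {n} (G : Graph n) → 𝒞 G →
    ∃[ t ] ∃[ s ] (Exec p (input G) t s × t ≤ c * n ^ d + c × (𝒫 G ⇔ Accepting s)))

{-# OPTIONS --safe #-}
module Submission where

-- An edge contraction lowers γ = γt2(G) as soon as some semitotal dominating set of
-- size γ contains a friendly triple x ~ y, d(y, z) ≤ 2: contract xy.  Let G be
-- connected, (P₃ + kP₂)-free and not reducible, with γ large, and let D be a minimum
-- semitotal dominating set.  Take a set A of at most 2k + 3 vertices beyond whose closed
-- neighbourhood G has no edges.  Exchange arguments bound D \ N[A] in terms of k, so
-- some a ∈ A has many neighbours in D, and further exchanges provide many of them with
-- private neighbours, forming a large induced matching.  The vertices touching at
-- most one edge of the matching induce disjoint cliques, each containing exactly one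
-- vertex of D, and all but 2k + 3 of these cliques contain a simplicial vertex of G.  What
-- remains is a first-order property of G (`Obstructed` below), and conversely that
-- property forbids a reduction, because each clique needs a dominator of its own.
-- For small γ the problem is first-order as well, and first-order properties of
-- graphs are decidable in polynomial time by nested loops over the vertices.

open import Defs
open import Data.Bool.Base using (true; false; if_then_else_; T)
open import Data.Empty using (⊥; ⊥-elim)
open import Data.Fin.Base using (Fin; zero; suc; toℕ; fromℕ<; remQuot; combine; punchIn; punchOut; splitAt; join)
import Data.Fin.Properties as Fin
open import Data.Fin.Subset using (Subset; ∣_∣)
import Data.Fin.Subset as Subset
import Data.Fin.Subset.Properties as Subset
open import Data.List.Base using (List; []; _∷_; map; length; _++_; _ʳ++_; reverse; filter; take; drop; allFin; deduplicate)
import Data.List.Properties as List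
open import Data.List.Membership.Propositional using (_∈_; _∉_; find; lose)
open import Data.List.Membership.Propositional.Properties
open import Data.List.Relation.Unary.All as All using (All; []; _∷_)
import Data.List.Relation.Unary.All.Properties as All
open import Data.List.Relation.Unary.Any as Any using (Any; here; there)
import Data.List.Relation.Unary.Any.Properties as Any
open import Data.List.Relation.Unary.AllPairs as AllPairs using (AllPairs; []; _∷_)
import Data.List.Relation.Unary.AllPairs.Properties as AllPairs
open import Data.List.Relation.Unary.Unique.Propositional using (Unique)
import Data.List.Relation.Unary.Unique.Propositional.Properties as Unique
import Data.List.Relation.Unary.Unique.DecPropositional.Properties as UniqueDec
open import Data.Nat.Base
open import Data.Nat.Properties
open import Data.Nat.Tactic.RingSolver using (solve-∀)
open import Data.Product.Base using (∃-syntax; _×_; _,_; proj₁; proj₂; uncurry)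
import Data.Product.Properties as Product
open import Data.Sum.Base as Sum using (_⊎_; inj₁; inj₂; [_,_]′)
open import Data.Sum.Relation.Binary.Pointwise using (Pointwise; inj₁; inj₂)
open import Data.Unit.Base using (⊤; tt)
open import Data.Vec.Base using (Vec; []; _∷_; lookup; here; there)
open import Function.Base using (_∘_; id; case_of_)
open import Function.Bundles using (_⇔_; mk⇔; Equivalence)
open import Relation.Binary.PropositionalEquality
open import Relation.Nullary using (¬_; Dec; yes; no; does; ¬?; _×-dec_; _⊎-dec_; _→-dec_; decidable-stable)
import Relation.Nullary.Decidable as Dec
open import Relation.Unary using (Decidable)

-- First-order properties of graphs on the random access machine

-- The obstacle is that γ and the number of cliques are unbounded, while a formula has a fixed
-- number of quantifiers: it can name neither a minimum set nor an induced matching. A simplicial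
-- vertex makes its clique recognisable without reference to either, so only the cliques without one
-- have to be listed, and the structural part aims at a bound on their number in terms of k. Most
-- exchange arguments follow one pattern. Some vertices of a minimum set are traded for no more
-- others in such a way that the result, were it dominating, would contain a friendly triple or have
-- fewer vertices outside N[A]. Hence some vertex stays undominated; it is adjacent to a removed
-- vertex and to none of the inserted ones. Such vertices provide the edges of a forbidden P₃ + kP₂.
-- The semitotal condition is the complication: a removal must not cost another vertex its mate at
-- distance at most two. A bounded subset of D that contains a mate for every vertex of D, and is
-- spared by the exchanges, settles this.

update-same : ∀ f i x → (f [ i ↦ x ]) i ≡ x
update-same f i x with i ≡ᵇ i in eq
... | true  = refl
... | false = ⊥-elim (subst T eq (≡⇒≡ᵇ i i refl))

update-other : ∀ f {i} x {j} → j ≢ i → (f [ i ↦ x ]) j ≡ f j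
update-other f {i} x {j} j≢i with i ≡ᵇ j in eq
... | true  = ⊥-elim (j≢i (sym (≡ᵇ⇒≡ i j (subst T (sym eq) tt))))
... | false = refl

memory-adj : ∀ {n} (G : Graph n) x y →
             memory (input G) (toℕ x * n + toℕ y) ≡ (if does (adj? G x y) then 1 else 0)
memory-adj {n} G x y with toℕ x * n + toℕ y <? n * n
... | yes a<n² = cong (λ p → if does (uncurry (adj? G) p) then 1 else 0)
                   (trans (cong (remQuot n) index) (Fin.remQuot-combine x y))
  where
  index : fromℕ< a<n² ≡ combine x y
  index = Fin.toℕ-injective (trans (Fin.toℕ-fromℕ< a<n²)
            (trans (cong (_+ toℕ y) (*-comm (toℕ x) n)) (sym (Fin.toℕ-combine x y))))
... | no a≮n² = ⊥-elim (a≮n² (subst (_< n * n)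
                  (trans (Fin.toℕ-combine x y) (cong (_+ toℕ y) (*-comm n (toℕ x))))
                  (Fin.toℕ<n (combine x y))))

-- A variable bound at depth l holds its value x in register 2 + 2l and x * n,
-- the offset of row x of the adjacency matrix, in register 3 + 2l; register 1
-- receives truth values.

level : ∀ d → Fin d → ℕ
level (suc d) zero    = d
level (suc d) (suc i) = level d i

level< : ∀ {d} i → level d i < d
level< {suc d} zero    = ≤-refl
level< {suc d} (suc i) = m≤n⇒m≤1+n (level< i)

valueReg rowReg : ℕ → ℕ
valueReg l = 2 + (l + l)
rowReg l = 3 + (l + l)

frontier : ℕ → ℕ
frontier d = 2 + (d + d)

record Represents {n d} (G : Graph n) (ρ : Vec (Fin n) d) (s : State) : Set where
  field
    size   : registers s 0 ≡ n
    values : ∀ i → registers s (valueReg (level d i)) ≡ toℕ (lookup ρ i)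
    rows   : ∀ i → registers s (rowReg (level d i)) ≡ toℕ (lookup ρ i) * n
    matrix : ∀ a → memory s a ≡ memory (input G) a

open Represents

-- The contract of a program at depth `d`: it may overwrite register 1 and everything from the
-- frontier on, which is the scratch space of its own quantifiers. This is what allows it to run
-- inside the loops that bind its variables.
record Frame (d : ℕ) (s s′ : State) : Set where
  field
    same-registers : ∀ {j} → j ≢ 1 → j < frontier d → registers s′ j ≡ registers s j
    same-memory    : ∀ a → memory s′ a ≡ memory s a

open Frame

Truth : Set → ℕ → Set
Truth P r = (P × r ≢ 0) ⊎ (¬ P × r ≡ 0)

Pred : ℕ → Set₁
Pred d = ∀ {n} → Graph n → Vec (Fin n) d → Set

-- The time bound uses `suc n` because its powers are never 0, so constants can be absorbed into the
-- factor. Deciding the predicate is part of the record since disjunction, implication and the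
-- universal quantifier are expressed through negation, conjunction and the existential one, which
-- takes stability to justify.
record PolyDef {d} (P : Pred d) : Set₁ where
  field
    program           : Program
    factor exponent   : ℕ
    run : ∀ {n} (G : Graph n) ρ {s} → Represents G ρ s →
          ∃[ t ] ∃[ s′ ] (Exec program s t s′ × t ≤ factor * suc n ^ exponent ×
                          Frame d s s′ × Truth (P G ρ) (registers s′ 1))
    decide : ∀ {n} (G : Graph n) ρ → Dec (P G ρ)

open PolyDef

value<frontier : ∀ {d} i → valueReg (level d i) < frontier d
value<frontier i = +-monoʳ-< 2 (+-mono-< (level< i) (level< i))

row<frontier : ∀ {d} i → rowReg (level d i) < frontier d
row<frontier {d} i = +-monoʳ-≤ 2 (≤-trans (≤-reflexive (sym (cong suc (+-suc _ _)))) (+-mono-≤ (level< i) (level< i)))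

frame-refl : ∀ {d s} → Frame d s s
frame-refl = record { same-registers = λ _ _ → refl ; same-memory = λ _ → refl }

frame-trans : ∀ {d s s′ s″} → Frame d s s′ → Frame d s′ s″ → Frame d s s″
frame-trans f g = record
  { same-registers = λ p q → trans (same-registers g p q) (same-registers f p q)
  ; same-memory    = λ a → trans (same-memory g a) (same-memory f a)
  }

frame-weaken : ∀ {d s s′} → Frame (suc d) s s′ → Frame d s s′
frame-weaken {d} f = record
  { same-registers = λ p q → same-registers f p (≤-trans q (+-monoʳ-≤ 2 (+-mono-≤ (n≤1+n d) (n≤1+n d))))
  ; same-memory    = same-memory f
  }

frame-result : ∀ {d s} x → Frame d s ⟨ registers s [ 1 ↦ x ] , memory s ⟩
frame-result {s = s} x = record
  { same-registers = λ p _ → update-other (registers s) x p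
  ; same-memory    = λ _ → refl
  }

frame-above : ∀ {d s} {i} x → frontier d ≤ i → Frame d s ⟨ registers s [ i ↦ x ] , memory s ⟩
frame-above {s = s} x d≤i = record
  { same-registers = λ _ q → update-other (registers s) x (<⇒≢ (<-≤-trans q d≤i))
  ; same-memory    = λ _ → refl
  }

represents-frame : ∀ {n d} {G : Graph n} {ρ : Vec (Fin n) d} {s s′} →
                   Frame d s s′ → Represents G ρ s → Represents G ρ s′
represents-frame f r = record
  { size   = trans (same-registers f (λ ()) (s≤s z≤n)) (size r)
  ; values = λ i → trans (same-registers f (λ ()) (value<frontier i)) (values r i)
  ; rows   = λ i → trans (same-registers f (λ ()) (row<frontier i)) (rows r i)
  ; matrix = λ a → trans (same-memory f a) (matrix r a)
  }

1≤suc^ : ∀ n e → 1 ≤ suc n ^ e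
1≤suc^ n e = m^n>0 (suc n) e

bound-+ : ∀ {t u} c d e f n → t ≤ c * suc n ^ e → u ≤ d * suc n ^ f →
          t + u ≤ (c + d) * suc n ^ (e + f)
bound-+ c d e f n t≤ u≤ = ≤-trans (+-mono-≤
    (≤-trans t≤ (*-monoʳ-≤ c (^-monoʳ-≤ (suc n) (m≤m+n e f))))
    (≤-trans u≤ (*-monoʳ-≤ d (^-monoʳ-≤ (suc n) (m≤n+m f e)))))
  (≤-reflexive (sym (*-distribʳ-+ (suc n ^ (e + f)) c d)))

def-resp : ∀ {d} {P Q : Pred d} → (∀ {n} (G : Graph n) ρ → P G ρ ⇔ Q G ρ) → PolyDef P → PolyDef Q
def-resp P⇔Q p = record
  { program = program p ; factor = factor p ; exponent = exponent p
  ; run = λ G ρ r → case run p G ρ r of λ where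
      (t , s′ , x , b , f , inj₁ (q , v)) → t , s′ , x , b , f , inj₁ (Equivalence.to (P⇔Q G ρ) q , v)
      (t , s′ , x , b , f , inj₂ (q , v)) → t , s′ , x , b , f , inj₂ (q ∘ Equivalence.from (P⇔Q G ρ) , v)
  ; decide = λ G ρ → Dec.map (P⇔Q G ρ) (decide p G ρ)
  }

def-≡ : ∀ {d} (i j : Fin d) → PolyDef (λ _ ρ → lookup ρ i ≡ lookup ρ j)
def-≡ {d} i j = record
  { program = 1 ≔ e ; factor = 10 ; exponent = 0
  ; run = λ {n} G ρ {s} r → _ , _ , assign , ≤-refl , frame-result _ ,
      subst (Truth _) (sym (trans (update-same (registers s) 1 _) (value r)))
        (truth (lookup ρ i) (lookup ρ j))
  ; decide = λ _ ρ → lookup ρ i Fin.≟ lookup ρ j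
  }
  where
  a b : ℕ
  a = valueReg (level d i)
  b = valueReg (level d j)

  e : Expr
  -- With truncated subtraction the sum of the two differences is the distance of the values, so `e`
  -- evaluates to 1 if they agree and to 0 otherwise.
  e = lit 1 ⊟ ((reg a ⊟ reg b) ⊞ (reg b ⊟ reg a))

  value : ∀ {n} {G : Graph n} {ρ : Vec (Fin n) d} {s} → Represents G ρ s → ⟦ e ⟧ s ≡
          1 ∸ ((toℕ (lookup ρ i) ∸ toℕ (lookup ρ j)) + (toℕ (lookup ρ j) ∸ toℕ (lookup ρ i)))
  value r rewrite values r i | values r j = refl

  truth : ∀ {n} (x y : Fin n) → Truth (x ≡ y) (1 ∸ ((toℕ x ∸ toℕ y) + (toℕ y ∸ toℕ x)))
  truth x y with x Fin.≟ y
  ... | yes refl rewrite n∸n≡0 (toℕ x) = inj₁ (refl , λ ())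
  ... | no x≢y = inj₂ (x≢y , m≤n⇒m∸n≡0 {1} (pos (toℕ x) (toℕ y) (x≢y ∘ Fin.toℕ-injective)))
    where
    pos : ∀ a b → a ≢ b → 1 ≤ (a ∸ b) + (b ∸ a)
    pos zero    zero    a≢b = ⊥-elim (a≢b refl)
    pos zero    (suc b) a≢b = s≤s z≤n
    pos (suc a) zero    a≢b = s≤s z≤n
    pos (suc a) (suc b) a≢b = pos a b (a≢b ∘ cong suc)

def-adj : ∀ {d} (i j : Fin d) → PolyDef (λ G ρ → Adj G (lookup ρ i) (lookup ρ j))
def-adj {d} i j = record
  { program = 1 ≔ e ; factor = 5 ; exponent = 0
  ; run = λ {n} G ρ {s} r → _ , _ , assign , ≤-refl , frame-result _ ,
      subst (Truth _) (sym (trans (update-same (registers s) 1 _) (value r)))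
        (truth (adj? G (lookup ρ i) (lookup ρ j)))
  ; decide = λ G ρ → adj? G (lookup ρ i) (lookup ρ j)
  }
  where
  e : Expr
  e = mem (reg (rowReg (level d i)) ⊞ reg (valueReg (level d j)))

  value : ∀ {n} {G : Graph n} {ρ : Vec (Fin n) d} {s} → Represents G ρ s →
          ⟦ e ⟧ s ≡ (if does (adj? G (lookup ρ i) (lookup ρ j)) then 1 else 0)
  value {G = G} {ρ} {s} r = trans (matrix r _)
    (trans (cong₂ (λ a b → memory (input G) (a + b)) (rows r i) (values r j)) (memory-adj G _ _))

  truth : ∀ {P} (P? : Dec P) → Truth P (if does P? then 1 else 0)
  truth (yes p) = inj₁ (p , λ ())
  truth (no ¬p) = inj₂ (¬p , refl)

def-¬ : ∀ {d} {P : Pred d} → PolyDef P → PolyDef (λ G ρ → ¬ P G ρ)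
def-¬ p = record
  { program = program p ⨾ 1 ≔ lit 1 ⊟ reg 1
  ; factor = factor p + 4 ; exponent = exponent p + 0
  ; run = λ {n} G ρ r → case run p G ρ r of λ (t , s′ , x , b , f , v) →
      _ , _ , seq x assign , bound-+ (factor p) 4 (exponent p) 0 n b ≤-refl ,
      frame-trans f (frame-result _) ,
      subst (Truth _) (sym (update-same (registers s′) 1 _)) (truth v)
  ; decide = λ G ρ → ¬? (decide p G ρ)
  }
  where
  truth : ∀ {P r} → Truth P r → Truth (¬ P) (1 ∸ r)
  truth {r = zero}  (inj₁ (_ , r≢0)) = ⊥-elim (r≢0 refl)
  truth {r = suc r} (inj₁ (p , _))   = inj₂ ((λ ¬p → ¬p p) , 0∸n≡0 r)
  truth             (inj₂ (¬p , refl)) = inj₁ (¬p , λ ())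

def-× : ∀ {d} {P Q : Pred d} → PolyDef P → PolyDef Q → PolyDef (λ G ρ → P G ρ × Q G ρ)
def-× {d} {P} {Q} p q = record
  { program = program p ⨾ if≢0 reg 1 then program q else skip
  ; factor = factor p + (3 + factor q) ; exponent = exponent p + exponent q
  ; run = exec
  ; decide = λ G ρ → decide p G ρ ×-dec decide q G ρ
  }
  where
  exec : ∀ {n} (G : Graph n) ρ {s} → Represents G ρ s → _
  exec {n} G ρ {s} r with run p G ρ r
  ... | t , s′ , x , b , f , inj₂ (¬p , r≡0) =
    _ , s′ , seq x (else′ r≡0 skip) ,
    bound-+ (factor p) (3 + factor q) (exponent p) (exponent q) n b
      (≤-trans (m≤m+n 3 (factor q)) (m≤m*n (3 + factor q) (suc n ^ exponent q) ⦃ >-nonZero (1≤suc^ n (exponent q)) ⦄)) ,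
    f , inj₂ (¬p ∘ proj₁ , r≡0)
  ... | t , s′ , x , b , f , inj₁ (p′ , r≢0) with run q G ρ (represents-frame f r)
  ... | u , s″ , y , c , g , v =
    _ , s″ , seq x (then′ r≢0 y) ,
    bound-+ (factor p) (3 + factor q) (exponent p) (exponent q) n b
      (≤-trans (+-mono-≤ {2} {3 * suc n ^ exponent q}
         (≤-trans (n≤1+n 2) (m≤m*n 3 (suc n ^ exponent q) ⦃ >-nonZero (1≤suc^ n (exponent q)) ⦄)) c)
         (≤-reflexive (sym (*-distribʳ-+ (suc n ^ exponent q) 3 (factor q))))) ,
    frame-trans f g , truth v
    where
    truth : ∀ {r} → Truth (Q G ρ) r → Truth (P G ρ × Q G ρ) r
    truth (inj₁ (q′ , v)) = inj₁ ((p′ , q′) , v)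
    truth (inj₂ (¬q , v)) = inj₂ (¬q ∘ proj₂ , v)

module Exists {d} {P : Pred (suc d)} (p : PolyDef P) where

  x′ y′ : ℕ
  x′ = valueReg d
  y′ = rowReg d

  test : Expr
  test = reg 0 ⊟ reg x′

  body : Program
  -- Success sets the counter to n: the loop test then fails, and register 1 keeps its nonzero value
  -- as the result.
  body = program p ⨾ if≢0 reg 1 then (x′ ≔ reg 0)
                     -- In the absence of a multiplication instruction the row offset is advanced by
                     -- n along with the counter.
                     else (x′ ≔ reg x′ ⊞ lit 1 ⨾ y′ ≔ reg y′ ⊞ reg 0)

  loop : Program
  loop = while≢0 test loop body

  module _ {n} (G : Graph n) (ρ : Vec (Fin n) d) where

    record Inv (i : ℕ) (s : State) : Set where
      field
        rep : Represents G ρ s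
        val : registers s x′ ≡ i
        row : registers s y′ ≡ i * n
        res : registers s 1 ≡ 0

    open Inv

    time : ℕ
    time = factor p * suc n ^ exponent p

    Found : ℕ → Set
    Found i = ∃[ x ] (i ≤ toℕ x × P G (x ∷ ρ))

    inside : ∀ {s} x → Inv (toℕ x) s → Represents G (x ∷ ρ) s
    inside x v = record
      { size   = size (rep v)
      ; values = λ { zero → val v ; (suc i) → values (rep v) i }
      ; rows   = λ { zero → row v ; (suc i) → rows (rep v) i }
      ; matrix = matrix (rep v)
      }

    -- Per iteration, beyond the body `p`, the loop test takes 4 steps and the branch at most 10;
    -- the last, failing test takes another 4. The number `f` bounds the remaining iterations.
    Outcome : ℕ → ℕ → State → Set
    Outcome f i s = ∃[ t ] ∃[ s′ ] (Exec loop s t s′ × t ≤ f * (time + 14) + 4 ×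
                                    Frame d s s′ × Truth (Found i) (registers s′ 1))

    finish : ∀ {i s} → i ≡ n → Inv i s → Outcome 0 i s
    finish {i} {s} i≡n v = _ , s , exit stop , ≤-refl , frame-refl ,
      inj₂ ((λ (x , i≤x , _) → <⇒≱ (Fin.toℕ<n x) (subst (_≤ toℕ x) i≡n i≤x)) , res v)
      where
      stop : registers s 0 ∸ registers s x′ ≡ 0
      stop rewrite size (rep v) | val v | i≡n = n∸n≡0 n

    go-on : ∀ {i s} → i < n → Inv i s → ⟦ test ⟧ s ≢ 0
    go-on i<n v rewrite size (rep v) | val v = m>n⇒m∸n≢0 i<n

    break : ∀ f {t i s s₁} → i < n → Inv i s → Exec (program p) s t s₁ → t ≤ time →
            Frame (suc d) s s₁ → registers s₁ 1 ≢ 0 → Found i → Outcome (suc f) i s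
    break f {t} {i} {s} {s₁} i<n v ex b fr r≢0 found =
      4 + (t + 4) + 4 , s₂ , iter (go-on i<n v) (seq ex (then′ r≢0 assign)) (exit stop) , bound ,
      frame-trans (frame-weaken fr) (frame-above _ ≤-refl) , inj₁ (found , r≢0)
      where
      s₂ : State
      s₂ = ⟨ registers s₁ [ x′ ↦ registers s₁ 0 ] , memory s₁ ⟩
      stop : ⟦ test ⟧ s₂ ≡ 0
      stop = trans (cong (registers s₁ 0 ∸_) (update-same (registers s₁) x′ (registers s₁ 0))) (n∸n≡0 (registers s₁ 0))
      bound : 4 + (t + 4) + 4 ≤ suc f * (time + 14) + 4
      bound = +-monoˡ-≤ 4 (≤-trans (≤-trans (≤-reflexive (shuffle t))
                (+-mono-≤ b (m≤m+n 8 6))) (m≤m+n (time + 14) (f * (time + 14))))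
        where
        shuffle : ∀ t → 4 + (t + 4) ≡ t + 8
        shuffle = solve-∀

    advance : State → State
    advance s = ⟨ (registers s [ x′ ↦ registers s x′ + 1 ]) [ y′ ↦ (registers s [ x′ ↦ registers s x′ + 1 ]) y′ + (registers s [ x′ ↦ registers s x′ + 1 ]) 0 ] , memory s ⟩

    frame-advance : ∀ {s} → Frame d s (advance s)
    frame-advance = frame-trans (frame-above _ ≤-refl) (frame-above _ (n≤1+n x′))

    inv-advance : ∀ {i s s₁} → Inv i s → Frame (suc d) s s₁ → registers s₁ 1 ≡ 0 → Inv (suc i) (advance s₁)
    inv-advance {i} {s} {s₁} v fr r≡0 = record
      { rep = represents-frame (frame-trans (frame-weaken fr) frame-advance) (rep v)
      ; val = trans (update-other r₂ _ (y′≢x′ ∘ sym))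
                (trans (update-same (registers s₁) x′ _)
                  (trans (cong (_+ 1) (trans (same-registers fr (λ ()) x<) (val v))) (+-comm i 1)))
      ; row = trans (update-same r₂ y′ _)
                (trans (cong₂ _+_
                  (trans (update-other (registers s₁) _ y′≢x′) (trans (same-registers fr (λ ()) y<) (row v)))
                  (trans (same-registers fr (λ ()) (s≤s z≤n)) (size (rep v)))) (+-comm (i * n) n))
      ; res = r≡0
      }
      where
      r₂ : ℕ → ℕ
      r₂ = registers s₁ [ x′ ↦ registers s₁ x′ + 1 ]
      x< : x′ < frontier (suc d)
      x< = +-monoʳ-< 2 (+-mono-< (n<1+n d) (n<1+n d))
      y< : y′ < frontier (suc d)
      y< = s≤s (s≤s (≤-reflexive (cong suc (sym (+-suc d d)))))
      y′≢x′ : y′ ≢ x′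
      y′≢x′ = 1+n≢n

    continue : ∀ {f t i s s₁} → (i<n : i < n) → Inv i s → Exec (program p) s t s₁ → t ≤ time →
               Frame (suc d) s s₁ → registers s₁ 1 ≡ 0 → ¬ P G (fromℕ< i<n ∷ ρ) →
               Outcome f (suc i) (advance s₁) → Outcome (suc f) i s
    continue {f} {t} {i} i<n v ex b fr r≡0 ¬found (t′ , s′ , ex′ , b′ , fr′ , truth) =
      4 + (t + 10) + t′ , s′ , iter (go-on i<n v) (seq ex (else′ r≡0 (seq assign assign))) ex′ , bound ,
      frame-trans (frame-weaken fr) (frame-trans frame-advance fr′) , skip-one truth
      where
      bound : 4 + (t + 10) + t′ ≤ suc f * (time + 14) + 4
      bound = ≤-trans (+-mono-≤ (≤-trans (≤-reflexive (shuffle t)) (+-monoˡ-≤ 14 b)) b′)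
                (≤-reflexive (sym (+-assoc (time + 14) (f * (time + 14)) 4)))
        where
        shuffle : ∀ t → 4 + (t + 10) ≡ t + 14
        shuffle = solve-∀
      skip-one : ∀ {r} → Truth (Found (suc i)) r → Truth (Found i) r
      skip-one (inj₁ ((x , i<x , px) , w)) = inj₁ ((x , <⇒≤ i<x , px) , w)
      skip-one (inj₂ (none , w)) = inj₂ (absent , w)
        where
        absent : ¬ Found i
        absent (x , i≤x , px) with m≤n⇒m<n∨m≡n i≤x
        ... | inj₁ i<x = none (x , i<x , px)
        ... | inj₂ i≡x = ¬found (subst (λ z → P G (z ∷ ρ)) (Fin.toℕ-injective (trans (sym i≡x) (sym (Fin.toℕ-fromℕ< i<n)))) px)

    search : ∀ f {i s} → i + f ≡ n → Inv i s → Outcome f i s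
    search zero    {i}     i+0≡n v = finish (trans (sym (+-identityʳ i)) i+0≡n) v
    search (suc f) {i} {s} i+f≡n v = dispatch (run p G (fromℕ< i<n ∷ ρ)
        (inside (fromℕ< i<n) (subst (λ j → Inv j s) (sym (Fin.toℕ-fromℕ< i<n)) v)))
      where
      i<n : i < n
      i<n = ≤-trans (m≤m+n (suc i) f) (≤-reflexive (trans (sym (+-suc i f)) i+f≡n))
      dispatch : ∃[ t ] ∃[ s₁ ] (Exec (program p) s t s₁ × t ≤ time × Frame (suc d) s s₁ ×
                                 Truth (P G (fromℕ< i<n ∷ ρ)) (registers s₁ 1)) → Outcome (suc f) i s
      dispatch (_ , _ , ex , b , fr , inj₁ (found , r≢0)) =
        break f i<n v ex b fr r≢0 (_ , ≤-reflexive (sym (Fin.toℕ-fromℕ< i<n)) , found)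
      dispatch (_ , _ , ex , b , fr , inj₂ (¬found , r≡0)) =
        continue {f} i<n v ex b fr r≡0 ¬found
          (search f (trans (sym (+-suc i f)) i+f≡n) (inv-advance v fr r≡0))

  whole : Program
  whole = 1 ≔ lit 0 ⨾ x′ ≔ lit 0 ⨾ y′ ≔ lit 0 ⨾ loop

  whole-bound : ∀ n {t} → t ≤ n * (factor p * suc n ^ exponent p + 14) + 4 →
                2 + (2 + (2 + t)) ≤ (factor p + 24) * suc n ^ (suc (exponent p))
  whole-bound n {t} t≤ = begin
    6 + t                               ≤⟨ +-monoʳ-≤ 6 t≤ ⟩
    6 + (n * (c * m + 14) + 4)          ≤⟨ +-monoʳ-≤ 6 (+-monoˡ-≤ 4 (*-monoˡ-≤ (c * m + 14) (n≤1+n n))) ⟩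
    6 + (suc n * (c * m + 14) + 4)      ≤⟨ +-monoʳ-≤ 6 (+-monoˡ-≤ 4 (*-monoʳ-≤ (suc n) (+-monoʳ-≤ (c * m) (m≤m*n 14 m ⦃ >-nonZero (1≤suc^ n (exponent p)) ⦄)))) ⟩
    6 + (suc n * (c * m + 14 * m) + 4)  ≡⟨ shuffle (suc n) c m ⟩
    (c + 14) * (suc n * m) + 10         ≤⟨ +-monoʳ-≤ ((c + 14) * (suc n * m)) (m≤m*n 10 (suc n * m) ⦃ >-nonZero (1≤suc^ n (suc (exponent p))) ⦄) ⟩
    (c + 14) * (suc n * m) + 10 * (suc n * m) ≡⟨ shuffle′ c (suc n * m) ⟩
    (c + 24) * (suc n * m)              ∎
    where
    open ≤-Reasoning
    c m : ℕ
    c = factor p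
    m = suc n ^ exponent p
    shuffle : ∀ a c m → 6 + (a * (c * m + 14 * m) + 4) ≡ (c + 14) * (a * m) + 10
    shuffle = solve-∀
    shuffle′ : ∀ c x → (c + 14) * x + 10 * x ≡ (c + 24) * x
    shuffle′ = solve-∀

  def : PolyDef (λ G ρ → ∃[ x ] P G (x ∷ ρ))
  def = record
    { program = whole ; factor = factor p + 24 ; exponent = suc (exponent p)
    ; run = exec
    ; decide = λ G ρ → Fin.any? λ x → decide p G (x ∷ ρ)
    }
    where
    module _ {n} (G : Graph n) (ρ : Vec (Fin n) d) where
      start : State → State
      start s = ⟨ ((registers s [ 1 ↦ 0 ]) [ x′ ↦ 0 ]) [ y′ ↦ 0 ] , memory s ⟩

      frame-start : ∀ {s} → Frame d s (start s)
      frame-start = frame-trans (frame-result 0) (frame-trans (frame-above 0 ≤-refl) (frame-above 0 (n≤1+n x′)))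

      inv-start : ∀ {s} → Represents G ρ s → Inv G ρ 0 (start s)
      inv-start {s} r = record
        { rep = represents-frame frame-start r
        ; val = trans (update-other ((registers s [ 1 ↦ 0 ]) [ x′ ↦ 0 ]) {y′} 0 {x′} (1+n≢n ∘ sym)) (update-same (registers s [ 1 ↦ 0 ]) x′ 0)
        ; row = update-same ((registers s [ 1 ↦ 0 ]) [ x′ ↦ 0 ]) y′ 0
        ; res = refl
        }

      forget : ∀ {r} → Truth (Found G ρ 0) r → Truth (∃[ x ] P G (x ∷ ρ)) r
      forget (inj₁ ((x , _ , px) , w)) = inj₁ ((x , px) , w)
      forget (inj₂ (none , w)) = inj₂ ((λ (x , px) → none (x , z≤n , px)) , w)

      exec : ∀ {s} → Represents G ρ s → ∃[ t ] ∃[ s′ ] (Exec whole s t s′ ×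
             t ≤ (factor p + 24) * suc n ^ suc (exponent p) × Frame d s s′ × Truth (∃[ x ] P G (x ∷ ρ)) (registers s′ 1))
      exec r = let t , s′ , ex , b , fr , truth = search G ρ n refl (inv-start r) in
        2 + (2 + (2 + t)) , s′ , seq assign (seq assign (seq assign ex)) , whole-bound n b ,
        frame-trans frame-start fr , forget truth

def-∃ : ∀ {d} {P : Pred (suc d)} → PolyDef P → PolyDef (λ G ρ → ∃[ x ] P G (x ∷ ρ))
def-∃ p = Exists.def p

def-⊎ : ∀ {d} {P Q : Pred d} → PolyDef P → PolyDef Q → PolyDef (λ G ρ → P G ρ ⊎ Q G ρ)
def-⊎ p q = def-resp (λ G ρ → mk⇔
  (λ ¬¬ → decidable-stable (decide p G ρ ⊎-dec decide q G ρ) λ ¬⊎ → ¬¬ (¬⊎ ∘ inj₁ , ¬⊎ ∘ inj₂))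
  (λ { (inj₁ x) (¬x , _) → ¬x x ; (inj₂ y) (_ , ¬y) → ¬y y }))
  (def-¬ (def-× (def-¬ p) (def-¬ q)))

def-→ : ∀ {d} {P Q : Pred d} → PolyDef P → PolyDef Q → PolyDef (λ G ρ → P G ρ → Q G ρ)
def-→ p q = def-resp (λ G ρ → mk⇔
  (λ ¬¬ x → decidable-stable (decide q G ρ) λ ¬y → ¬¬ (x , ¬y))
  (λ f (x , ¬y) → ¬y (f x)))
  (def-¬ (def-× p (def-¬ q)))

def-∀ : ∀ {d} {P : Pred (suc d)} → PolyDef P → PolyDef (λ G ρ → ∀ x → P G (x ∷ ρ))
def-∀ p = def-resp (λ G ρ → mk⇔
  (λ ¬∃¬ x → decidable-stable (decide p G (x ∷ ρ)) λ ¬x → ¬∃¬ (x , ¬x))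
  (λ f (x , ¬x) → ¬x (f x)))
  (def-¬ (def-∃ (def-¬ p)))

def-⊤ : ∀ {d} → PolyDef {d} (λ _ _ → ⊤)
def-⊤ = def-resp (λ _ _ → mk⇔ (λ _ → tt) (λ _ x≢x → proj₂ x≢x refl)) (def-¬ (def-∃ (def-¬ (def-≡ zero zero))))

def-All : ∀ {d} {P : ∀ {n} → Graph n → Vec (Fin n) d → Fin n → Set} →
          (∀ i → PolyDef (λ G ρ → P G ρ (lookup ρ i))) →
          ∀ is → PolyDef (λ G ρ → All (P G ρ) (map (lookup ρ) is))
def-All p []       = def-resp (λ _ _ → mk⇔ (λ _ → []) _) def-⊤
def-All p (i ∷ is) = def-resp (λ _ _ → mk⇔ (λ (x , xs) → x ∷ xs) λ { (x ∷ xs) → x , xs })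
  (def-× (p i) (def-All p is))

def-Any : ∀ {d} {P : ∀ {n} → Graph n → Vec (Fin n) d → Fin n → Set} →
          (∀ i → PolyDef (λ G ρ → P G ρ (lookup ρ i))) →
          ∀ is → PolyDef (λ G ρ → Any (P G ρ) (map (lookup ρ) is))
def-Any p []       = def-resp (λ _ _ → mk⇔ (λ ¬⊤ → ⊥-elim (¬⊤ tt)) λ ()) (def-¬ def-⊤)
def-Any p (i ∷ is) = def-resp (λ _ _ → mk⇔ (λ { (inj₁ x) → here x ; (inj₂ x) → there x }) Any.toSum) (def-⊎ (p i) (def-Any p is))

def-AllPairs : ∀ {d} {R : ∀ {n} → Graph n → Fin n → Fin n → Set} →
               (∀ i j → PolyDef {d} (λ G ρ → R G (lookup ρ i) (lookup ρ j))) →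
               ∀ is → PolyDef (λ G ρ → AllPairs (R G) (map (lookup ρ) is))
def-AllPairs r []       = def-resp (λ _ _ → mk⇔ (λ _ → []) _) def-⊤
def-AllPairs {R = R} r (i ∷ is) = def-resp (λ _ _ → mk⇔ (λ (x , xs) → x ∷ xs) λ { (x ∷ xs) → x , xs })
  (def-× (def-All {P = λ G ρ → R G (lookup ρ i)} (r i) is) (def-AllPairs {R = R} r is))

def-∃< : ∀ {d} {P : ℕ → Pred d} → (∀ s → PolyDef (P s)) → ∀ b → PolyDef (λ G ρ → ∃[ s ] (s < b × P s G ρ))
def-∃< p zero    = def-resp (λ _ _ → mk⇔ (λ ¬⊤ → ⊥-elim (¬⊤ tt)) λ ()) (def-¬ def-⊤)
def-∃< {P = P} p (suc b) = def-resp (λ G ρ → mk⇔ (to G ρ) (from G ρ)) (def-⊎ (p b) (def-∃< p b))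
  where
  to : ∀ {n} (G : Graph n) ρ → P b G ρ ⊎ ∃[ s ] (s < b × P s G ρ) → ∃[ s ] (s < suc b × P s G ρ)
  to G ρ (inj₁ x)             = b , ≤-refl , x
  to G ρ (inj₂ (s , s<b , x)) = s , m≤n⇒m≤1+n s<b , x
  from : ∀ {n} (G : Graph n) ρ → ∃[ s ] (s < suc b × P s G ρ) → P b G ρ ⊎ ∃[ s ] (s < b × P s G ρ)
  from G ρ (s , s<1+b , x) with m≤n⇒m<n∨m≡n (≤-pred s<1+b)
  ... | inj₁ s<b  = inj₂ (s , s<b , x)
  ... | inj₂ refl = inj₁ x

module _ {P : ∀ {n} → Graph n → List (Fin n) → List (Fin n) → Set}
         (p : ∀ {d} (js is : List (Fin d)) → PolyDef (λ G ρ → P G (map (lookup ρ) js) (map (lookup ρ) is))) where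

  -- A list of length at most `b` amounts to `b` nested quantifiers, after each of which the list
  -- may end. The newest variable is put in front, so the list is built backwards, whence `ʳ++`. The
  -- indices `js` are parameters that are merely renamed under each binder.
  def-∃list-onto : ∀ b {d} (js is : List (Fin d)) →
    PolyDef (λ G ρ → ∃[ ys ] (length ys ≤ b × P G (map (lookup ρ) js) (ys ʳ++ map (lookup ρ) is)))
  def-∃list-onto zero    js is = def-resp (λ _ _ → mk⇔ (λ x → [] , z≤n , x) λ { ([] , _ , x) → x }) (p js is)
  def-∃list-onto (suc b) js is = def-resp (λ G ρ → mk⇔ (to G ρ) (from G ρ))
    (def-⊎ (p js is) (def-∃ (def-∃list-onto b (map suc js) (zero ∷ map suc is))))
    where
    shift : ∀ {n d} y (ρ : Vec (Fin n) d) ks → map (lookup (y ∷ ρ)) (map suc ks) ≡ map (lookup ρ) ks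
    shift y ρ ks = sym (List.map-∘ ks)
    to : ∀ {n} (G : Graph n) ρ → _ → _
    to G ρ (inj₁ x) = [] , z≤n , x
    to G ρ (inj₂ (y , ys , l , x)) = y ∷ ys , s≤s l ,
      subst₂ (λ a b → P G a (ys ʳ++ (y ∷ b))) (shift y ρ js) (shift y ρ is) x
    from : ∀ {n} (G : Graph n) ρ → ∃[ ys ] (length ys ≤ suc b × P G (map (lookup ρ) js) (ys ʳ++ map (lookup ρ) is)) → _
    from G ρ ([] , _ , x) = inj₁ x
    from G ρ (y ∷ ys , s≤s l , x) = inj₂ (y , ys , l ,
      subst₂ (λ a b → P G a (ys ʳ++ (y ∷ b))) (sym (shift y ρ js)) (sym (shift y ρ is)) x)

  def-∃list : ∀ b {d} (js : List (Fin d)) → PolyDef (λ G ρ → ∃[ ys ] (length ys ≤ b × P G (map (lookup ρ) js) ys))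
  def-∃list b js = def-resp {P = λ G ρ → ∃[ ys ] (length ys ≤ b × P G (map (lookup ρ) js) (reverse ys))} (λ G ρ → mk⇔
    (λ (ys , l , x) → reverse ys , ≤-trans (≤-reflexive (List.length-reverse ys)) l , x)
    (λ (ys , l , x) → reverse ys , ≤-trans (≤-reflexive (List.length-reverse ys)) l ,
      subst (P G _) (sym (List.reverse-involutive ys)) x))
    (def-∃list-onto b js [])

*-^-distrib : ∀ m n e → (m * n) ^ e ≡ m ^ e * n ^ e
*-^-distrib m n zero    = refl
*-^-distrib m n (suc e) rewrite *-^-distrib m n e = shuffle m n (m ^ e) (n ^ e)
  where
  shuffle : ∀ a b c d → a * b * (c * d) ≡ a * c * (b * d)
  shuffle = solve-∀

polyTimeSolvable : ∀ {a b} {𝒫 : ∀ {n} → Graph n → Set a} {𝒞 : ∀ {n} → Graph n → Set b} {P : Pred 0} → PolyDef P →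
                   (∀ {n} (G : Graph n) → 𝒞 G → 𝒫 G ⇔ P G []) → PolyTimeSolvableOn 𝒫 𝒞
polyTimeSolvable {𝒫 = 𝒫} {𝒞} {P} p 𝒫⇔P = (program p ⨾ 0 ≔ reg 1) , c * 2 ^ e + c + 2 , e , solve
  where
  c e : ℕ
  c = factor p
  e = exponent p

  represents : ∀ {n} (G : Graph n) → Represents G [] (input G)
  represents G = record { size = refl ; values = λ () ; rows = λ () ; matrix = λ _ → refl }

  -- The summand 1 is for n = 0, where `n ^ e` vanishes as soon as e is positive.
  suc^≤ : ∀ n → suc n ^ e ≤ 2 ^ e * n ^ e + 1
  suc^≤ zero    = ≤-trans (≤-reflexive (^-zeroˡ e)) (m≤n+m 1 (2 ^ e * 0 ^ e))
  suc^≤ (suc n) = ≤-trans (≤-trans (^-monoˡ-≤ e (≤-trans (≤-reflexive (+-comm 1 (suc n))) (+-monoʳ-≤ (suc n) (s≤s z≤n))))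
    (≤-reflexive (trans (cong (_^ e) (double (suc n))) (*-^-distrib 2 (suc n) e)))) (m≤m+n _ 1)
    where
    double : ∀ m → m + m ≡ 2 * m
    double = solve-∀

  bound : ∀ n {t} → t ≤ c * suc n ^ e → t + 2 ≤ (c * 2 ^ e + c + 2) * n ^ e + (c * 2 ^ e + c + 2)
  bound n {t} t≤ = begin
    t + 2                                         ≤⟨ +-monoˡ-≤ 2 (≤-trans t≤ (*-monoʳ-≤ c (suc^≤ n))) ⟩
    c * (2 ^ e * n ^ e + 1) + 2                   ≡⟨ shuffle c (2 ^ e) (n ^ e) ⟩
    c * 2 ^ e * n ^ e + (c + 2)                   ≤⟨ +-mono-≤ (*-monoˡ-≤ (n ^ e) (≤-trans (m≤m+n (c * 2 ^ e) c) (m≤m+n (c * 2 ^ e + c) 2))) (+-monoˡ-≤ 2 (m≤n+m c (c * 2 ^ e))) ⟩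
    (c * 2 ^ e + c + 2) * n ^ e + (c * 2 ^ e + c + 2) ∎
    where
    open ≤-Reasoning
    shuffle : ∀ c x y → c * (x * y + 1) + 2 ≡ c * x * y + (c + 2)
    shuffle = solve-∀

  solve : ∀ {n} (G : Graph n) → 𝒞 G → ∃[ t ] ∃[ s ] (Exec (program p ⨾ 0 ≔ reg 1) (input G) t s ×
          t ≤ (c * 2 ^ e + c + 2) * n ^ e + (c * 2 ^ e + c + 2) × (𝒫 G ⇔ Accepting s))
  solve {n} G 𝒞G with run p G [] (represents G)
  ... | t , s , ex , b , _ , inj₁ (x , r≢0) = _ , _ , seq ex assign , bound n b ,
        mk⇔ (λ _ → r≢0) (λ _ → Equivalence.from (𝒫⇔P G 𝒞G) x)
  ... | t , s , ex , b , _ , inj₂ (¬x , r≡0) = _ , _ , seq ex assign , bound n b ,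
        mk⇔ (λ y → ⊥-elim (¬x (Equivalence.to (𝒫⇔P G 𝒞G) y))) (λ r≢0 → ⊥-elim (r≢0 r≡0))

-- Semitotal dominating sets as lists of vertices

module _ {a} {A : Set a} where

  length-filter-split : ∀ {p} {P : A → Set p} (P? : Decidable P) xs →
                        length xs ≡ length (filter P? xs) + length (filter (¬? ∘ P?) xs)
  length-filter-split P? [] = refl
  length-filter-split P? (x ∷ xs) with P? x
  ... | yes _ = cong suc (length-filter-split P? xs)
  ... | no  _ = trans (cong suc (length-filter-split P? xs)) (sym (+-suc _ _))

  ∈-take : ∀ c {xs : List A} {x} → x ∈ take c xs → x ∈ xs
  ∈-take (suc c) {_ ∷ _} (here eq)   = here eq
  ∈-take (suc c) {_ ∷ _} (there x∈) = there (∈-take c x∈)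

  ∈-drop : ∀ c {xs : List A} {x} → x ∈ drop c xs → x ∈ xs
  ∈-drop zero            x∈ = x∈
  ∈-drop (suc c) {_ ∷ _} x∈ = there (∈-drop c x∈)

  length-take-≤ : ∀ {c} {xs : List A} → c ≤ length xs → length (take c xs) ≡ c
  length-take-≤ {c} {xs} c≤ = trans (List.length-take c xs) (m≤n⇒m⊓n≡m c≤)

  take-drop-disjoint : ∀ c {xs : List A} {x} → Unique xs → x ∈ take c xs → x ∉ drop c xs
  take-drop-disjoint (suc c) {_ ∷ _} (x∉ ∷ _) (here refl) x∈ = All.lookup x∉ (∈-drop c x∈) refl
  take-drop-disjoint (suc c) {_ ∷ _} (_ ∷ u) (there x∈) y∈  = take-drop-disjoint c u x∈ y∈

  AllPairs-lookup : ∀ {r} {R : A → A → Set r} {xs x y} → (∀ {x y} → R x y → R y x) →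
                    AllPairs R xs → x ∈ xs → y ∈ xs → x ≢ y → R x y
  AllPairs-lookup s (p ∷ _)  (here refl) (here refl) x≢y = ⊥-elim (x≢y refl)
  AllPairs-lookup s (p ∷ _)  (here refl) (there y∈)  x≢y = All.lookup p y∈
  AllPairs-lookup s (p ∷ _)  (there x∈)  (here refl) x≢y = s (All.lookup p x∈)
  AllPairs-lookup s (_ ∷ ps) (there x∈)  (there y∈)  x≢y = AllPairs-lookup s ps x∈ y∈ x≢y

-- Pigeonhole principle: the element that hits the first slot hits no other one, so it can be
-- deleted from `L` before the remaining slots are treated.
disjoint-slots : ∀ {a b i} {A : Set a} {B : Set b} (I : A → B → Set i) {slots} {L} →
                 All (λ s → Any (I s) L) slots →
                 AllPairs (λ s s′ → ∀ x → I s x → ¬ I s′ x) slots → length slots ≤ length L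
disjoint-slots I [] [] = z≤n
disjoint-slots {B = B} I {s ∷ slots} {L} (hit ∷ hits) (apart ∷ aparts) with find hit
... | x , x∈L , Isx with ∈-∃++ x∈L
... | ys , zs , refl = ≤-trans (s≤s (disjoint-slots I (All.zipWith remaining (apart , hits)) aparts))
    (≤-reflexive (trans (cong suc (List.length-++ ys)) (trans (sym (+-suc _ _)) (sym (List.length-++ ys)))))
  where
  remaining : ∀ {s′} → (∀ x → I s x → ¬ I s′ x) × Any (I s′) (ys ++ x ∷ zs) → Any (I s′) (ys ++ zs)
  remaining (apart , any) with Any.++⁻ ys any
  ... | inj₁ i         = Any.++⁺ˡ i
  ... | inj₂ (here i)  = ⊥-elim (apart x Isx i)
  ... | inj₂ (there i) = Any.++⁺ʳ ys i

unique-length-≤ : ∀ {a} {A : Set a} {xs ys : List A} → Unique xs → (∀ {x} → x ∈ xs → x ∈ ys) → length xs ≤ length ys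
unique-length-≤ {xs = xs} u sub = disjoint-slots _≡_ (All.tabulate sub)
  (AllPairs.map (λ s≢s′ x s≡x s′≡x → s≢s′ (trans s≡x (sym s′≡x))) u)

module _ {n : ℕ} where

  open import Data.List.Membership.DecPropositional (Fin._≟_ {n}) public using (_∈?_)

  infixl 6 _∖_
  _∖_ : List (Fin n) → List (Fin n) → List (Fin n)
  L ∖ []      = L
  L ∖ (s ∷ S) = filter (λ x → ¬? (x Fin.≟ s)) (L ∖ S)

  ∈-∖⁺ : ∀ S {L x} → x ∈ L → x ∉ S → x ∈ L ∖ S
  ∈-∖⁺ []      x∈L _   = x∈L
  ∈-∖⁺ (s ∷ S) x∈L x∉S = ∈-filter⁺ _ (∈-∖⁺ S x∈L (x∉S ∘ there)) (x∉S ∘ here)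

  ∈-∖⁻ : ∀ S {L x} → x ∈ L ∖ S → x ∈ L × x ∉ S
  ∈-∖⁻ []      x∈ = x∈ , λ ()
  ∈-∖⁻ (s ∷ S) x∈ with ∈-filter⁻ (λ x → ¬? (x Fin.≟ s)) x∈
  ... | x∈′ , x≢s = proj₁ (∈-∖⁻ S x∈′) , λ { (here eq) → x≢s eq ; (there x∈S) → proj₂ (∈-∖⁻ S x∈′) x∈S }

  ∖-Unique : ∀ S {L} → Unique L → Unique (L ∖ S)
  ∖-Unique []      u = u
  ∖-Unique (s ∷ S) u = Unique.filter⁺ _ (∖-Unique S u)

  length-∖ : ∀ {S L} → Unique S → (∀ {x} → x ∈ S → x ∈ L) → length S + length (L ∖ S) ≤ length L
  length-∖ [] _ = ≤-refl
  length-∖ {s ∷ S} {L} (s∉S ∷ u) sub = ≤-trans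
    (≤-trans (≤-reflexive (sym (+-suc (length S) _)))
      (+-monoʳ-≤ (length S) (List.filter-notAll (λ x → ¬? (x Fin.≟ s)) (L ∖ S)
        (lose (∈-∖⁺ S (sub (here refl)) (λ s∈S → All.lookup s∉S s∈S refl)) (λ s≢s → s≢s refl)))))
    (length-∖ u (sub ∘ there))

  length-∖-≥ : ∀ S {L} → Unique L → length L ≤ length S + length (L ∖ S)
  length-∖-≥ S {L} u = ≤-trans (unique-length-≤ {ys = S ++ (L ∖ S)} u split) (≤-reflexive (List.length-++ S))
    where
    split : ∀ {x} → x ∈ L → x ∈ S ++ (L ∖ S)
    split {x} x∈L with x ∈? S
    ... | yes x∈S = ∈-++⁺ˡ x∈S
    ... | no  x∉S = ∈-++⁺ʳ S (∈-∖⁺ S x∈L x∉S)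

module _ {n} (G : Graph n) where

  Touch : Fin n → Fin n → Set
  Touch x y = x ≡ y ⊎ Adj G x y

  touch? : ∀ x y → Dec (Touch x y)
  touch? x y = (x Fin.≟ y) ⊎-dec adj? G x y

  touch-sym : ∀ {x y} → Touch x y → Touch y x
  touch-sym (inj₁ e) = inj₁ (sym e)
  touch-sym (inj₂ e) = inj₂ (adj-sym G e)

  Dominates : List (Fin n) → Fin n → Set
  Dominates L v = Any (Touch v) L

  Near : Fin n → Fin n → Set
  Near v w = Adj G v w ⊎ ∃[ x ] (Adj G v x × Adj G x w)

  Mate : List (Fin n) → Fin n → Set
  Mate L v = Any (λ w → w ≢ v × Near v w) L

  -- Lists may repeat vertices, so their lengths serve only as upper bounds on sizes. That is enough
  -- for a minimum, and lists of bounded length can be quantified over by `def-∃list`.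
  SD : List (Fin n) → Set
  SD L = (∀ v → Dominates L v) × All (Mate L) L

  SD≤ : ℕ → Set
  SD≤ s = ∃[ L ] (length L ≤ s × SD L)

  -- The graph G with v contracted into u, on the vertices of G other than v.
  Merge : Fin n → Fin n → Fin n → Fin n → Set
  Merge u v x y = x ≢ y × (Adj G x y ⊎ (x ≡ u × Adj G v y) ⊎ (y ≡ u × Adj G v x))

  MergeNear : Fin n → Fin n → Fin n → Fin n → Set
  MergeNear u v x y = Merge u v x y ⊎ ∃[ z ] (z ≢ v × Merge u v x z × Merge u v z y)

  MergedSD : Fin n → Fin n → List (Fin n) → Set
  MergedSD u v L = All (_≢ v) L ×
    (∀ x → x ≢ v → Any (λ y → x ≡ y ⊎ Merge u v x y) L) ×
    All (λ x → Any (λ y → y ≢ x × MergeNear u v x y) L) L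

  -- Says within `G` itself that some contraction has a semitotal dominating set of size at most
  -- `s`; staying on the vertices of `G` makes it a first-order property of `G`.
  MergedSD≤ : ℕ → Set
  MergedSD≤ s = ∃[ u ] ∃[ v ] (Adj G u v × ∃[ L ] (length L ≤ s × MergedSD u v L))

def-touch : ∀ {d} (i j : Fin d) → PolyDef (λ G ρ → Touch G (lookup ρ i) (lookup ρ j))
def-touch i j = def-⊎ (def-≡ i j) (def-adj i j)

def-dominates : ∀ {d} i (is : List (Fin d)) → PolyDef (λ G ρ → Dominates G (map (lookup ρ) is) (lookup ρ i))
def-dominates i is = def-Any {P = λ G ρ y → Touch G (lookup ρ i) y} (λ j → def-touch i j) is

def-near : ∀ {d} (i j : Fin d) → PolyDef (λ G ρ → Near G (lookup ρ i) (lookup ρ j))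
def-near i j = def-⊎ (def-adj i j) (def-∃ (def-× (def-adj (suc i) zero) (def-adj zero (suc j))))

shift : ∀ {n d} y (ρ : Vec (Fin n) d) ks → map (lookup (y ∷ ρ)) (map suc ks) ≡ map (lookup ρ) ks
shift y ρ ks = sym (List.map-∘ ks)

module _ {d} {P : ∀ {n} → Graph n → Fin n → Vec (Fin n) d → List (Fin n) → Set} (is : List (Fin d)) where

  private
    shift⇔ : ∀ {n} (G : Graph n) ρ x →
             P G x ρ (map (lookup (x ∷ ρ)) (map suc is)) ⇔ P G x ρ (map (lookup ρ) is)
    shift⇔ G ρ x = mk⇔ (subst (P G x ρ) (shift x ρ is)) (subst (P G x ρ) (sym (shift x ρ is)))

  def-∀-list : PolyDef {suc d} (λ { G (x ∷ ρ) → P G x ρ (map (lookup (x ∷ ρ)) (map suc is)) }) →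
               PolyDef (λ G ρ → ∀ x → P G x ρ (map (lookup ρ) is))
  def-∀-list p = def-resp (λ G ρ → mk⇔
    (λ f x → Equivalence.to (shift⇔ G ρ x) (f x)) (λ f x → Equivalence.from (shift⇔ G ρ x) (f x))) (def-∀ p)

def-SD : ∀ {d} (is : List (Fin d)) → PolyDef (λ G ρ → SD G (map (lookup ρ) is))
def-SD is = def-×
  (def-∀-list {P = λ G x ρ L → Dominates G L x} is
    (def-resp (λ { G (x ∷ ρ) → mk⇔ id id }) (def-dominates zero (map suc is))))
  (def-All {P = λ G ρ → Mate G (map (lookup ρ) is)}
    (λ i → def-Any {P = λ G ρ w → w ≢ lookup ρ i × Near G (lookup ρ i) w}
      (λ j → def-× (def-¬ (def-≡ j i)) (def-near i j)) is) is)

def-merge : ∀ {d} (u v i j : Fin d) → PolyDef (λ G ρ → Merge G (lookup ρ u) (lookup ρ v) (lookup ρ i) (lookup ρ j))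
def-merge u v i j = def-× (def-¬ (def-≡ i j))
  (def-⊎ (def-adj i j) (def-⊎ (def-× (def-≡ i u) (def-adj v j)) (def-× (def-≡ j u) (def-adj v i))))

def-mergeNear : ∀ {d} (u v i j : Fin d) → PolyDef (λ G ρ → MergeNear G (lookup ρ u) (lookup ρ v) (lookup ρ i) (lookup ρ j))
def-mergeNear u v i j = def-⊎ (def-merge u v i j) (def-∃ (def-× (def-¬ (def-≡ zero (suc v)))
  (def-× (def-merge (suc u) (suc v) (suc i) zero) (def-merge (suc u) (suc v) zero (suc j)))))

def-mergedSD : ∀ {d} (u v : Fin d) (is : List (Fin d)) →
               PolyDef (λ G ρ → MergedSD G (lookup ρ u) (lookup ρ v) (map (lookup ρ) is))
def-mergedSD u v is = def-×
  (def-All {P = λ _ ρ x → x ≢ lookup ρ v} (λ i → def-¬ (def-≡ i v)) is)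
  (def-× (def-∀-list {P = λ G x ρ L → x ≢ lookup ρ v → Any (λ y → x ≡ y ⊎ Merge G (lookup ρ u) (lookup ρ v) x y) L} is
    (def-resp (λ { G (x ∷ ρ) → mk⇔ id id }) (def-→ (def-¬ (def-≡ zero (suc v)))
      (def-Any {P = λ { G (x ∷ ρ) y → x ≡ y ⊎ Merge G (lookup ρ u) (lookup ρ v) x y }}
        (λ j → def-resp (λ { G (x ∷ ρ) → mk⇔ id id }) (def-⊎ (def-≡ zero j) (def-merge (suc u) (suc v) zero j))) (map suc is)))))
  (def-All {P = λ G ρ x → Any (λ y → y ≢ x × MergeNear G (lookup ρ u) (lookup ρ v) x y) (map (lookup ρ) is)}
    (λ i → def-Any {P = λ G ρ y → y ≢ lookup ρ i × MergeNear G (lookup ρ u) (lookup ρ v) (lookup ρ i) y}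
      (λ j → def-× (def-¬ (def-≡ j i)) (def-mergeNear u v i j)) is) is))

def-SD≤ : ∀ s → PolyDef {0} (λ G _ → SD≤ G s)
def-SD≤ s = def-∃list {P = λ G _ → SD G} (λ _ → def-SD) s []

def-mergedSD≤ : ∀ s → PolyDef {0} (λ G _ → MergedSD≤ G s)
def-mergedSD≤ s = def-∃ (def-∃ (def-× (def-adj (suc zero) zero) (def-∃list {P = P} p s (suc zero ∷ zero ∷ []))))
  where
  P : ∀ {n} → Graph n → List (Fin n) → List (Fin n) → Set
  P G (u ∷ v ∷ []) L = MergedSD G u v L
  P G _            L = ⊥
  p : ∀ {d} (js is : List (Fin d)) → PolyDef (λ G ρ → P G (map (lookup ρ) js) (map (lookup ρ) is))
  p (u ∷ v ∷ []) is = def-mergedSD u v is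
  p []               is = def-resp (λ _ _ → mk⇔ (λ f → f tt) λ ()) (def-¬ def-⊤)
  p (_ ∷ [])         is = def-resp (λ _ _ → mk⇔ (λ f → f tt) λ ()) (def-¬ def-⊤)
  p (_ ∷ _ ∷ _ ∷ _)  is = def-resp (λ _ _ → mk⇔ (λ f → f tt) λ ()) (def-¬ def-⊤)

-- Translation between lists, subsets and contracted graphs

elements : ∀ {n} → Subset n → List (Fin n)
elements []          = []
elements (true ∷ p)  = zero ∷ map suc (elements p)
elements (false ∷ p) = map suc (elements p)

length-elements : ∀ {n} (p : Subset n) → length (elements p) ≡ ∣ p ∣
length-elements []          = refl
length-elements (true ∷ p)  = cong suc (trans (List.length-map suc (elements p)) (length-elements p))
length-elements (false ∷ p) = trans (List.length-map suc (elements p)) (length-elements p)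

∈-elements⁺ : ∀ {n} {p : Subset n} {x} → x Subset.∈ p → x ∈ elements p
∈-elements⁺ {p = true ∷ p}  here       = here refl
∈-elements⁺ {p = true ∷ p}  (there x∈) = there (∈-map⁺ suc (∈-elements⁺ x∈))
∈-elements⁺ {p = false ∷ p} (there x∈) = ∈-map⁺ suc (∈-elements⁺ x∈)

∈-elements⁻ : ∀ {n} (p : Subset n) {x} → x ∈ elements p → x Subset.∈ p
∈-elements⁻ (true ∷ p)  (here refl) = here
∈-elements⁻ (true ∷ p)  (there x∈) with ∈-map⁻ suc x∈
... | y , y∈ , refl = there (∈-elements⁻ p y∈)
∈-elements⁻ (false ∷ p) x∈ with ∈-map⁻ suc x∈
... | y , y∈ , refl = there (∈-elements⁻ p y∈)

insert : ∀ {n} → Fin n → Subset n → Subset n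
insert zero    (_ ∷ p) = true ∷ p
insert (suc x) (b ∷ p) = b ∷ insert x p

∣insert∣ : ∀ {n} (x : Fin n) p → ∣ insert x p ∣ ≤ suc ∣ p ∣
∣insert∣ zero    (true ∷ p)  = n≤1+n _
∣insert∣ zero    (false ∷ p) = ≤-refl
∣insert∣ (suc x) (true ∷ p)  = s≤s (∣insert∣ x p)
∣insert∣ (suc x) (false ∷ p) = ∣insert∣ x p

∈-insert-same : ∀ {n} (x : Fin n) p → x Subset.∈ insert x p
∈-insert-same zero    (_ ∷ p) = here
∈-insert-same (suc x) (_ ∷ p) = there (∈-insert-same x p)

∈-insert-old : ∀ {n} (x : Fin n) p {y} → y Subset.∈ p → y Subset.∈ insert x p
∈-insert-old zero    (_ ∷ p) here       = here
∈-insert-old zero    (_ ∷ p) (there y∈) = there y∈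
∈-insert-old (suc x) (_ ∷ p) here       = here
∈-insert-old (suc x) (_ ∷ p) (there y∈) = there (∈-insert-old x p y∈)

∈-insert⁻ : ∀ {n} (x : Fin n) p {y} → y Subset.∈ insert x p → y ≡ x ⊎ y Subset.∈ p
∈-insert⁻ zero    (_ ∷ p) here       = inj₁ refl
∈-insert⁻ zero    (_ ∷ p) (there y∈) = inj₂ (there y∈)
∈-insert⁻ (suc x) (_ ∷ p) here       = inj₂ here
∈-insert⁻ (suc x) (_ ∷ p) (there y∈) = Sum.map (cong suc) there (∈-insert⁻ x p y∈)

toSubset : ∀ {n} → List (Fin n) → Subset n
toSubset []      = Subset.⊥
toSubset (x ∷ L) = insert x (toSubset L)

∣toSubset∣ : ∀ {n} (L : List (Fin n)) → ∣ toSubset L ∣ ≤ length L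
∣toSubset∣ {n} []  = ≤-reflexive (Subset.∣⊥∣≡0 n)
∣toSubset∣ (x ∷ L) = ≤-trans (∣insert∣ x (toSubset L)) (s≤s (∣toSubset∣ L))

∈-toSubset⁺ : ∀ {n} {L : List (Fin n)} {x} → x ∈ L → x Subset.∈ toSubset L
∈-toSubset⁺ {L = x ∷ L} (here refl) = ∈-insert-same x (toSubset L)
∈-toSubset⁺ {L = x ∷ L} (there y∈)  = ∈-insert-old x (toSubset L) (∈-toSubset⁺ y∈)

∈-toSubset⁻ : ∀ {n} (L : List (Fin n)) {x} → x Subset.∈ toSubset L → x ∈ L
∈-toSubset⁻ []      x∈ = ⊥-elim (Subset.∉⊥ x∈)
∈-toSubset⁻ (x ∷ L) y∈ = [ here , there ∘ ∈-toSubset⁻ L ]′ (∈-insert⁻ x (toSubset L) y∈)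

module _ {n} (G : Graph n) where

  near⇒dist : ∀ {v w} → Near G v w → DistAtMost G 2 v w
  near⇒dist (inj₁ e)           = 1 , s≤s z≤n , step e here
  near⇒dist (inj₂ (x , e , f)) = 2 , ≤-refl , step e (step f here)

  dist⇒near : ∀ {v w} → w ≢ v → DistAtMost G 2 v w → Near G v w
  dist⇒near w≢v (_ , _ , here)                  = ⊥-elim (w≢v refl)
  dist⇒near w≢v (_ , _ , step e here)           = inj₁ e
  dist⇒near w≢v (_ , _ , step e (step f here))  = inj₂ (_ , e , f)
  dist⇒near w≢v (_ , s≤s (s≤s ()) , step e (step f (step _ _)))

  SD-elements : ∀ {D} → SemitotalDominating G D → SD G (elements D)
  SD-elements {D} (dom , mates) = dominated , All.tabulate mated
    where
    dominated : ∀ v → Dominates G (elements D) v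
    dominated v with v Subset.∈? D
    ... | yes v∈D = lose (∈-elements⁺ v∈D) (inj₁ refl)
    ... | no  v∉D = let u , u∈D , e = dom v v∉D in lose (∈-elements⁺ u∈D) (inj₂ e)
    mated : ∀ {v} → v ∈ elements D → Mate G (elements D) v
    mated v∈ = let w , w∈D , w≢v , dist = mates _ (∈-elements⁻ D v∈) in
      lose (∈-elements⁺ w∈D) (w≢v , dist⇒near w≢v dist)

  SD-toSubset : ∀ {L} → SD G L → SemitotalDominating G (toSubset L)
  SD-toSubset {L} (dom , mates) = dominated , mated
    where
    dominated : ∀ v → v Subset.∉ toSubset L → ∃[ u ] (u Subset.∈ toSubset L × Adj G v u)
    dominated v v∉ with find (dom v)
    ... | u , u∈L , inj₁ refl = ⊥-elim (v∉ (∈-toSubset⁺ u∈L))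
    ... | u , u∈L , inj₂ e    = u , ∈-toSubset⁺ u∈L , e
    mated : ∀ v → v Subset.∈ toSubset L → ∃[ w ] (w Subset.∈ toSubset L × w ≢ v × DistAtMost G 2 v w)
    mated v v∈ = let w , w∈L , w≢v , near = find (All.lookup mates (∈-toSubset⁻ L v∈)) in
      w , ∈-toSubset⁺ w∈L , w≢v , near⇒dist near

  γ⇒SD≤ : ∀ {m} → γt2[ G ]≡ m → SD≤ G m
  γ⇒SD≤ ((D , sd , refl) , _) = elements D , ≤-reflexive (length-elements D) , SD-elements sd

  γ⇒least : ∀ {m s} → γt2[ G ]≡ m → SD≤ G s → m ≤ s
  γ⇒least (_ , least) (L , l , sd) = ≤-trans (least _ (_ , SD-toSubset sd , refl)) (≤-trans (∣toSubset∣ L) l)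

  SD≤? : ∀ s → Dec (SD≤ G s)
  SD≤? s = PolyDef.decide (def-SD≤ s) G []

  SD≤-mono : ∀ {s t} → s ≤ t → SD≤ G s → SD≤ G t
  SD≤-mono s≤t (L , l , sd) = L , ≤-trans l s≤t , sd

  least-SD≤ : ∀ s → SD≤ G s → ∃[ m ] (m ≤ s × SD≤ G m × ∀ {t} → SD≤ G t → m ≤ t)
  least-SD≤ zero    p = 0 , z≤n , p , λ _ → z≤n
  least-SD≤ (suc s) p with SD≤? s
  ... | yes q = let m , m≤s , r = least-SD≤ s q in m , m≤n⇒m≤1+n m≤s , r
  ... | no ¬q = suc s , ≤-refl , p , λ {t} q → ≰⇒> λ t≤s → ¬q (SD≤-mono t≤s q)

  least⇒γ : ∀ {m} → SD≤ G m → (∀ {t} → SD≤ G t → m ≤ t) → γt2[ G ]≡ m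
  least⇒γ {m} (L , l , sd) least = (toSubset L , SD-toSubset sd , ≤-antisym (≤-trans (∣toSubset∣ L) l) (bound (SD-toSubset sd))) ,
    λ { _ (D , sd′ , refl) → bound sd′ }
    where
    bound : ∀ {D} → SemitotalDominating G D → m ≤ ∣ D ∣
    bound {D} sd′ = least (elements D , ≤-reflexive (length-elements D) , SD-elements sd′)

module _ {n} (G : Graph (suc n)) (u v : Fin (suc n)) where

  private
    ι : Fin n → Fin (suc n)
    ι = punchIn v
    H : Graph n
    H = contract G u v

    merge⇒adj : ∀ {a b} → Merge G u v (ι a) (ι b) → Adj H a b
    merge⇒adj (ιa≢ιb , m) = ιa≢ιb ∘ cong ι , m

    adj⇒merge : ∀ {a b} → Adj H a b → Merge G u v (ι a) (ι b)
    adj⇒merge (a≢b , m) = a≢b ∘ Fin.punchIn-injective v _ _ , m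

    onto : ∀ {x} → x ≢ v → ∃[ a ] (ι a ≡ x)
    onto x≢v = punchOut (x≢v ∘ sym) , Fin.punchIn-punchOut (x≢v ∘ sym)

  contract⇒merged : ∀ {L} → SD H L → MergedSD G u v (map (punchIn v) L)
  contract⇒merged {L} (dom , mates) =
    All.map⁺ (All.universal (Fin.punchInᵢ≢i v) L) , dominated , All.map⁺ (All.map mated mates)
    where
    dominated : ∀ x → x ≢ v → Any (λ y → x ≡ y ⊎ Merge G u v x y) (map ι L)
    dominated x x≢v with onto x≢v
    ... | a , refl = Any.map⁺ (Any.map (Sum.map (cong ι) adj⇒merge) (dom a))
    mated : ∀ {a} → Mate H L a → Any (λ y → y ≢ ι a × MergeNear G u v (ι a) y) (map ι L)
    mated m = Any.map⁺ (Any.map (λ (w≢a , near) → w≢a ∘ Fin.punchIn-injective v _ _ ,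
      Sum.map adj⇒merge (λ (x , e , f) → ι x , Fin.punchInᵢ≢i v x , adj⇒merge e , adj⇒merge f) near) m)

  merged⇒contract : ∀ {L} → MergedSD G u v L → ∃[ L′ ] (length L′ ≡ length L × SD H L′)
  merged⇒contract {L} (avoid , sd) with preimage avoid
    where
    preimage : ∀ {L} → All (_≢ v) L → ∃[ L′ ] (map ι L′ ≡ L)
    preimage []          = [] , refl
    preimage (x≢v ∷ xs) = let a , eq = onto x≢v ; L′ , eqs = preimage xs in a ∷ L′ , cong₂ _∷_ eq eqs
  merged⇒contract (avoid , dom , mates) | L′ , refl =
    L′ , sym (List.length-map ι L′) , dominated , All.map mated (All.map⁻ mates)
    where
    dominated : ∀ a → Dominates H L′ a
    dominated a = Any.map (Sum.map (Fin.punchIn-injective v _ _) merge⇒adj) (Any.map⁻ (dom (ι a) (Fin.punchInᵢ≢i v a)))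
    mated : ∀ {a} → Any (λ y → y ≢ ι a × MergeNear G u v (ι a) y) (map ι L′) → Mate H L′ a
    mated m = Any.map (λ (w≢a , near) → w≢a ∘ cong ι , Sum.map merge⇒adj through near) (Any.map⁻ m)
      where
      through : ∀ {a b} → ∃[ z ] (z ≢ v × Merge G u v (ι a) z × Merge G u v z (ι b)) → ∃[ x ] (Adj H a x × Adj H x b)
      through (z , z≢v , e , f) with onto z≢v
      ... | x , refl = x , merge⇒adj e , merge⇒adj f

module _ {n} (G : Graph n) where

  -- The case of no contraction is void because γ is not smaller than itself. In the other case the
  -- value after contraction serves as `s`.
  oneEdge⇒merged : OneEdgeContraction G → ∃[ m ] ∃[ s ] (SD≤ G m × MergedSD≤ G s × ¬ SD≤ G s × s < m)
  oneEdge⇒merged (0 , ((_ , _ , done , a , b , γa , γb , a<b) , _) , _) =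
    ⊥-elim (<⇒≱ a<b (γ⇒least G γb (γ⇒SD≤ G γa)))
  oneEdge⇒merged (1 , ((_ , H , step u v e done , a , b , γa , γb , a<b) , _) , _) =
    let L , l , sd = γ⇒SD≤ (contract G u v) γa in
    b , a , γ⇒SD≤ G γb ,
    (u , v , e , map (punchIn v) L , ≤-trans (≤-reflexive (List.length-map (punchIn v) L)) l , contract⇒merged G u v sd) ,
    (λ q → <⇒≱ a<b (γ⇒least G γb q)) , a<b
  oneEdge⇒merged (suc (suc _) , _ , s≤s ())

-- A number `s` that separates the two minima suffices, without either being known: the contraction
-- has γ at most `s` and `G` has γ above `s`. The hypothesis `SD≤ G m` guarantees that `G` has a
-- semitotal dominating set at all.
merged⇒oneEdge : ∀ {n} (G : Graph n) {m s} → SD≤ G m → MergedSD≤ G s → ¬ SD≤ G s → OneEdgeContraction G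
merged⇒oneEdge {suc n} G {m} {s} sd (u , v , e , L , l , merged) ¬sd
  with merged⇒contract G u v merged | least-SD≤ G m sd
... | L′ , len , sd′ | b , _ , p , least with least-SD≤ (contract G u v) s (L′ , ≤-trans (≤-reflexive len) l , sd′)
... | a , a≤s , q , least′ =
  1 , ((n , contract G u v , step u v e done , a , b ,
        least⇒γ (contract G u v) q least′ , least⇒γ G p least ,
        ≰⇒> (λ b≤a → ¬sd (SD≤-mono G (≤-trans b≤a a≤s) p))) , positive) , ≤-refl
  where
  positive : ∀ j → ReducibleBy G j → 1 ≤ j
  positive zero    (_ , _ , done , a , b , γa , γb , a<b) = ⊥-elim (<⇒≱ a<b (γ⇒least G γb (γ⇒SD≤ G γa)))
  positive (suc j) _ = s≤s z≤n

-- A first-order obstruction to reducibility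

module _ {n} (G : Graph n) where

  Simplicial : Fin n → Set
  Simplicial m = ∀ x y → Adj G m x → Adj G m y → Touch G x y

  -- In the graphs for which an obstruction is constructed, `Good` turns out to be the union of the
  -- low cliques with a simplicial vertex, `Linked` the set of high vertices and `Bad` the union of
  -- the remaining low cliques. Phrased by simplicial vertices, the partition refers neither to the
  -- minimum set nor to the matching.
  Good : Fin n → Set
  Good v = ∃[ m ] (Simplicial m × Touch G v m)

  NextToGood : Fin n → Set
  NextToGood v = ∃[ g ] (Good g × Adj G v g)

  Linked : Fin n → Set
  Linked v = ¬ Good v × NextToGood v

  Bad : Fin n → Set
  Bad v = ¬ Good v × ¬ NextToGood v

  Far : Fin n → Fin n → Set
  Far m m′ = ∀ x y → Touch G x m → Touch G y m′ → ¬ Touch G x y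

  CompleteTo : Fin n → Fin n → Set
  CompleteTo t m = ∀ x → Adj G m x → Adj G t x

  -- Good ∪ Bad induces a disjoint union of cliques.  Those in Good contain a
  -- simplicial vertex and so need a dominator of their own; the cliques in Bad,
  -- represented by es, cannot be dominated as cheaply with the help of a linked vertex.
  record Obstruction (es : List (Fin n)) : Set where
    field
      good-cliques  : ∀ m m′ → Simplicial m → Simplicial m′ → Touch G m m′ ⊎ Far m m′
      bad-cliques   : ∀ x y z → Bad x → Bad y → Bad z → Adj G x y → Adj G y z → Touch G x z
      es-apart      : AllPairs (λ e e′ → ¬ Touch G e e′) es
      es-bad        : All Bad es
      es-cover      : ∀ v → Bad v → Dominates G es v
      good-linked   : ∀ m → Simplicial m → ∃[ y ] ∃[ t ] (Adj G m y × Linked t × Adj G y t)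
      es-linked     : All (λ e → ∃[ t ] (Linked t × Adj G e t)) es
      linked-spread : ∀ t → Linked t → ∃[ m ] ∃[ m′ ] (Simplicial m × Simplicial m′ × ¬ Touch G m m′ ×
                                                      CompleteTo t m × CompleteTo t m′)
      es-optimal    : ¬ (∃[ xs ] (length xs ≤ length es × Any Linked xs × (∀ v → Bad v → Dominates G xs v)))

  Obstructed : ℕ → Set
  Obstructed b = ∃[ es ] (length es ≤ b × Obstruction es)

def-simplicial : ∀ {d} (i : Fin d) → PolyDef (λ G ρ → Simplicial G (lookup ρ i))
def-simplicial i = def-∀ (def-∀ (def-→ (def-adj (suc (suc i)) (suc zero)) (def-→ (def-adj (suc (suc i)) zero) (def-touch (suc zero) zero))))

def-good : ∀ {d} (i : Fin d) → PolyDef (λ G ρ → Good G (lookup ρ i))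
def-good i = def-∃ (def-× (def-simplicial zero) (def-touch (suc i) zero))

def-nextToGood : ∀ {d} (i : Fin d) → PolyDef (λ G ρ → NextToGood G (lookup ρ i))
def-nextToGood i = def-∃ (def-× (def-good zero) (def-adj (suc i) zero))

def-linked : ∀ {d} (i : Fin d) → PolyDef (λ G ρ → Linked G (lookup ρ i))
def-linked i = def-× (def-¬ (def-good i)) (def-nextToGood i)

def-bad : ∀ {d} (i : Fin d) → PolyDef (λ G ρ → Bad G (lookup ρ i))
def-bad i = def-× (def-¬ (def-good i)) (def-¬ (def-nextToGood i))

def-far : ∀ {d} (i j : Fin d) → PolyDef (λ G ρ → Far G (lookup ρ i) (lookup ρ j))
def-far i j = def-∀ (def-∀ (def-→ (def-touch (suc zero) (suc (suc i))) (def-→ (def-touch zero (suc (suc j))) (def-¬ (def-touch (suc zero) zero)))))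

def-completeTo : ∀ {d} (i j : Fin d) → PolyDef (λ G ρ → CompleteTo G (lookup ρ i) (lookup ρ j))
def-completeTo i j = def-∀ (def-→ (def-adj (suc j) zero) (def-adj (suc i) zero))

def-covers-bad : ∀ {d} (is : List (Fin d)) → PolyDef (λ G ρ → ∀ v → Bad G v → Dominates G (map (lookup ρ) is) v)
def-covers-bad is = def-∀-list {P = λ G v ρ L → Bad G v → Dominates G L v} is
  (def-resp (λ { G (v ∷ ρ) → mk⇔ id id }) (def-→ (def-bad zero) (def-dominates zero (map suc is))))

def-optimal : ∀ {d} (js : List (Fin d)) → PolyDef (λ G ρ → ¬ (∃[ xs ]
  (length xs ≤ length (map (lookup ρ) js) × Any (Linked G) xs × (∀ v → Bad G v → Dominates G xs v))))
def-optimal js = def-¬ (def-resp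
  {P = λ G ρ → ∃[ xs ] (length xs ≤ length js × Any (Linked G) xs × (∀ v → Bad G v → Dominates G xs v))}
  (λ G ρ → mk⇔ (λ (xs , l , q) → xs , ≤-trans l (≤-reflexive (sym (List.length-map _ js))) , q)
               (λ (xs , l , q) → xs , ≤-trans l (≤-reflexive (List.length-map _ js)) , q))
  (def-∃list {P = λ G _ xs → Any (Linked G) xs × (∀ v → Bad G v → Dominates G xs v)}
    (λ _ is → def-× (def-Any {P = λ G _ → Linked G} def-linked is) (def-covers-bad is)) (length js) js))

def-obstruction : ∀ {d} (is : List (Fin d)) → PolyDef (λ G ρ → Obstruction G (map (lookup ρ) is))
def-obstruction is = def-resp
  (λ G ρ → mk⇔
    (λ (a , b , c , d , e , f , g , h , i) → record
      { good-cliques = a ; bad-cliques = b ; es-apart = c ; es-bad = d ; es-cover = e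
      ; good-linked = f ; es-linked = g ; linked-spread = h ; es-optimal = i })
    (λ o → let open Obstruction o in
      good-cliques , bad-cliques , es-apart , es-bad , es-cover , good-linked , es-linked , linked-spread , es-optimal))
  (def-× (def-∀ (def-∀ (def-→ (def-simplicial (suc zero)) (def-→ (def-simplicial zero)
    (def-⊎ (def-touch (suc zero) zero) (def-far (suc zero) zero))))))
  (def-× (def-∀ (def-∀ (def-∀ (def-→ (def-bad (suc (suc zero))) (def-→ (def-bad (suc zero)) (def-→ (def-bad zero)
    (def-→ (def-adj (suc (suc zero)) (suc zero)) (def-→ (def-adj (suc zero) zero) (def-touch (suc (suc zero)) zero)))))))))
  (def-× (def-AllPairs {R = λ G e e′ → ¬ Touch G e e′} (λ i j → def-¬ (def-touch i j)) is)
  (def-× (def-All {P = λ G _ → Bad G} def-bad is)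
  (def-× (def-covers-bad is)
  (def-× (def-∀ (def-→ (def-simplicial zero) (def-∃ (def-∃
    (def-× (def-adj (suc (suc zero)) (suc zero)) (def-× (def-linked zero) (def-adj (suc zero) zero)))))))
  (def-× (def-All {P = λ G _ e → ∃[ t ] (Linked G t × Adj G e t)}
    (λ i → def-∃ (def-× (def-linked zero) (def-adj (suc i) zero))) is)
  (def-× (def-∀ (def-→ (def-linked zero) (def-∃ (def-∃
    (def-× (def-simplicial (suc zero)) (def-× (def-simplicial zero) (def-× (def-¬ (def-touch (suc zero) zero))
    (def-× (def-completeTo (suc (suc zero)) (suc zero)) (def-completeTo (suc (suc zero)) zero)))))))))
  (def-optimal is)))))))))

def-obstructed : ∀ b → PolyDef {0} (λ G _ → Obstructed G b)
def-obstructed b = def-∃list {P = λ G _ → Obstruction G} (λ _ → def-obstruction) b []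

-- The obstruction forbids a reduction

module Soundness {n} (G : Graph n) {es : List (Fin n)} (obstruction : Obstruction G es) where

  open Obstruction obstruction

  simplicial? : ∀ m → Dec (Simplicial G m)
  simplicial? m = Fin.all? λ x → Fin.all? λ y → adj? G m x →-dec (adj? G m y →-dec touch? G x y)

  good? : ∀ v → Dec (Good G v)
  good? v = Fin.any? λ m → simplicial? m ×-dec touch? G v m

  nextToGood? : ∀ v → Dec (NextToGood G v)
  nextToGood? v = Fin.any? λ g → good? g ×-dec adj? G v g

  simplicial-touch : ∀ {m x y} → Simplicial G m → Touch G x m → Touch G y m → Touch G x y
  simplicial-touch s (inj₁ refl) q           = touch-sym G q
  simplicial-touch s (inj₂ e)    (inj₁ refl) = inj₂ e
  simplicial-touch s (inj₂ e)    (inj₂ f)    = s _ _ (adj-sym G e) (adj-sym G f)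

  -- Greedy choice of one simplicial vertex for each clique in `Good`.
  representatives : ∀ L → ∃[ ms ] (All (Simplicial G) ms × AllPairs (λ m m′ → ¬ Touch G m m′) ms ×
                                   (∀ {m} → m ∈ L → Simplicial G m → Dominates G ms m))
  representatives [] = [] , [] , [] , λ ()
  representatives (x ∷ L) with representatives L
  ... | ms , simp , apart , cover with simplicial? x ×-dec ¬? (Any.any? (touch? G x) ms)
  ... | yes (s , ¬any) = x ∷ ms , s ∷ simp , All.¬Any⇒All¬ ms ¬any ∷ apart ,
        λ { (here refl) _ → here (inj₁ refl) ; (there m∈) s′ → there (cover m∈ s′) }
  ... | no ¬new = ms , simp , apart , λ where
        (here refl) s → decidable-stable (Any.any? (touch? G x) ms) λ ¬any → ¬new (s , ¬any)
        (there m∈) s → cover m∈ s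

  ms : List (Fin n)
  ms = proj₁ (representatives (allFin n))

  ms-simplicial : All (Simplicial G) ms
  ms-simplicial = proj₁ (proj₂ (representatives (allFin n)))

  ms-apart : AllPairs (λ m m′ → ¬ Touch G m m′) ms
  ms-apart = proj₁ (proj₂ (proj₂ (representatives (allFin n))))

  ms-cover : ∀ {m} → Simplicial G m → Dominates G ms m
  ms-cover = proj₂ (proj₂ (proj₂ (representatives (allFin n)))) (∈-allFin _)

  cliques : List (Fin n)
  cliques = ms ++ es

  IsSlot : Fin n → Set
  IsSlot s = Simplicial G s ⊎ Bad G s

  cliques-slots : All IsSlot cliques
  cliques-slots = All.++⁺ (All.map inj₁ ms-simplicial) (All.map inj₂ es-bad)

  -- Linked vertices are left out because one of them may be adjacent to several members of `es`,
  -- which would spoil the disjointness of the slots.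
  InSlot : Fin n → Fin n → Set
  InSlot s x = Touch G x s × ¬ Linked G x

  slot-unlinked : ∀ {s} → IsSlot s → ¬ Linked G s
  slot-unlinked (inj₁ simp) (¬good , _) = ¬good (_ , simp , inj₁ refl)
  slot-unlinked (inj₂ (_ , ¬next)) (_ , next) = ¬next next

  next-good⇒good : ∀ {v g} → ¬ Linked G v → Good G g → Adj G v g → Good G v
  next-good⇒good ¬linked good e = decidable-stable (good? _) λ ¬good → ¬linked (¬good , _ , good , e)

  touches-bad⇒bad : ∀ {v b} → Bad G b → Touch G v b → ¬ Linked G v → Bad G v
  touches-bad⇒bad bad (inj₁ refl) _ = bad
  touches-bad⇒bad {v} (_ , ¬next) (inj₂ e) ¬linked = ¬good , λ next → ¬linked (¬good , next)
    where
    ¬good : ¬ Good G v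
    ¬good good = ¬next (v , good , adj-sym G e)

  -- Slots behave like components once the linked vertices are deleted: an unlinked neighbour of a
  -- good vertex is good, two simplicial vertices touch or have distant neighbourhoods, and an
  -- unlinked neighbour of a bad vertex is bad, where adjacency is transitive.
  inSlot-extend : ∀ {s v u} → IsSlot s → InSlot s v → Touch G u v → ¬ Linked G u → InSlot s u
  inSlot-extend slot (t , _) (inj₁ refl) ¬linked = t , ¬linked
  inSlot-extend {s} {v} {u} (inj₁ simp) (t , _) (inj₂ e) ¬linked
    with next-good⇒good ¬linked (s , simp , t) e
  ... | m′ , simp′ , t′ with good-cliques s m′ simp simp′
  ... | inj₁ touch = simplicial-touch simp′ t′ touch , ¬linked
  ... | inj₂ far   = ⊥-elim (far v u t t′ (inj₂ (adj-sym G e)))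
  inSlot-extend (inj₂ bad) (inj₁ refl , _) (inj₂ e) ¬linked = inj₂ e , ¬linked
  inSlot-extend (inj₂ bad) (inj₂ f , ¬linkedᵛ) (inj₂ e) ¬linked =
    bad-cliques _ _ _ (touches-bad⇒bad badᵛ (inj₂ e) ¬linked) badᵛ bad e f , ¬linked
    where
    badᵛ = touches-bad⇒bad bad (inj₂ f) ¬linkedᵛ

  cliques-apart : AllPairs (λ s s′ → ¬ Touch G s s′) cliques
  cliques-apart = AllPairs.++⁺ ms-apart es-apart
    (All.map (λ simp → All.map (λ (¬good , _) t → ¬good (_ , simp , touch-sym G t)) es-bad) ms-simplicial)

  slots-disjoint : AllPairs (λ s s′ → ∀ x → InSlot s x → ¬ InSlot s′ x) cliques
  slots-disjoint = go cliques-slots cliques-apart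
    where
    go : ∀ {L} → All IsSlot L → AllPairs (λ s s′ → ¬ Touch G s s′) L →
         AllPairs (λ s s′ → ∀ x → InSlot s x → ¬ InSlot s′ x) L
    go [] [] = []
    go (slot ∷ slots) (apart ∷ aparts) = All.zipWith
      (λ (slot′ , ¬t) x i (t , _) → ¬t (touch-sym G (proj₁ (inSlot-extend slot i (touch-sym G t) (slot-unlinked slot′)))))
      (slots , apart) ∷ go slots aparts

  r : ℕ
  r = length cliques

  hits⇒≤ : ∀ {L} → (∀ {s} → s ∈ cliques → Any (InSlot s) L) → r ≤ length L
  hits⇒≤ hits = disjoint-slots InSlot (All.tabulate hits) slots-disjoint

  -- A vertex that touches a simplicial vertex is good, and it touches only one member of `ms` by
  -- `good-cliques`. So `ms` uses up that many good vertices of `L`.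
  count-good : ∀ L → (∀ {m} → m ∈ ms → Dominates G L m) → length ms + length (filter (¬? ∘ good?) L) ≤ length L
  count-good L dom = ≤-trans (+-monoˡ-≤ _ (disjoint-slots (λ m x → Touch G x m) (All.tabulate hit) (go ms-simplicial ms-apart)))
    (≤-reflexive (sym (length-filter-split good? L)))
    where
    hit : ∀ {m} → m ∈ ms → Any (λ x → Touch G x m) (filter good? L)
    hit m∈ = let x , x∈L , t = find (dom m∈) in
      lose (∈-filter⁺ good? x∈L (_ , All.lookup ms-simplicial m∈ , touch-sym G t)) (touch-sym G t)
    go : ∀ {L} → All (Simplicial G) L → AllPairs (λ s s′ → ¬ Touch G s s′) L →
         AllPairs (λ s s′ → ∀ x → Touch G x s → ¬ Touch G x s′) L
    go [] [] = []
    go (simp ∷ simps) (apart ∷ aparts) = All.zipWith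
      (λ (simp′ , ¬t) x t t′ → [ ¬t , (λ far → far x x t t′ (inj₁ refl)) ]′ (good-cliques _ _ simp simp′))
      (simps , apart) ∷ go simps aparts

  ≤-es : ∀ {a b} → length ms + a ≤ b → b ≤ r → a ≤ length es
  ≤-es p q = +-cancelˡ-≤ (length ms) _ _ (≤-trans p (≤-trans q (≤-reflexive (List.length-++ ms))))

  bad-dominated : ∀ {L v} → Bad G v → Dominates G L v → Dominates G (filter (¬? ∘ good?) L) v
  bad-dominated (¬good , ¬next) dom with find dom
  ... | x , x∈L , inj₁ refl = lose (∈-filter⁺ (¬? ∘ good?) x∈L ¬good) (inj₁ refl)
  ... | x , x∈L , inj₂ e    = lose (∈-filter⁺ (¬? ∘ good?) x∈L (λ good → ¬next (x , good , e))) (inj₂ e)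

  -- Apart from its good vertices, at least one for each member of `ms`, such an `L` has at most as
  -- many vertices as `es`. These still dominate `Bad`, since a bad vertex has no good neighbour, so
  -- a linked one among them would contradict `es-optimal`.
  no-linked : ∀ {L} → (∀ v → Dominates G L v) → length L ≤ r → ∀ {t} → t ∈ L → ¬ Linked G t
  no-linked {L} dom l t∈L linked = es-optimal
    (filter (¬? ∘ good?) L , ≤-es (count-good L (λ _ → dom _)) l ,
     lose (∈-filter⁺ (¬? ∘ good?) t∈L (proj₁ linked)) linked ,
     λ v bad → bad-dominated bad (dom v))

  -- Both vertices are unlinked, so whatever slot contains `v` also contains `u`. Without `v` all
  -- slots would still be hit, by fewer than `r` vertices.
  no-adjacent-pair : ∀ {L u v} → (∀ v → Dominates G L v) → length L ≤ r → u ∈ L → v ∈ L → ¬ Adj G u v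
  no-adjacent-pair {L} {u} {v} dom l u∈L v∈L e with ∈-∃++ v∈L
  ... | ys , zs , refl = <⇒≱ (≤-trans shorter l) (hits⇒≤ hits)
    where
    shorter : suc (length (ys ++ zs)) ≤ length (ys ++ v ∷ zs)
    shorter = ≤-reflexive (trans (cong suc (List.length-++ ys)) (trans (sym (+-suc _ _)) (sym (List.length-++ ys))))
    u∈ : u ∈ ys ++ zs
    u∈ with ∈-++⁻ ys u∈L
    ... | inj₁ p            = ∈-++⁺ˡ p
    ... | inj₂ (here refl)  = ⊥-elim (adj-irrefl G e)
    ... | inj₂ (there p)    = ∈-++⁺ʳ ys p
    hits : ∀ {s} → s ∈ cliques → Any (InSlot s) (ys ++ zs)
    hits s∈ with find (dom _)
    ... | x , x∈L , t with ∈-++⁻ ys x∈L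
    ... | inj₁ p            = lose (∈-++⁺ˡ p) (touch-sym G t , no-linked dom l x∈L)
    ... | inj₂ (there p)    = lose (∈-++⁺ʳ ys p) (touch-sym G t , no-linked dom l x∈L)
    ... | inj₂ (here refl)  = lose u∈ (inSlot-extend (All.lookup cliques-slots s∈)
                                (touch-sym G t , no-linked dom l x∈L) (inj₂ e) (no-linked dom l u∈L))

  -- With `x₀` added, `L` dominates everything within size `r`, so `L` has no linked vertex. A slot
  -- is then hit through the dominator of any of its vertices other than `x₀`; the difficulty is a
  -- slot represented by `x₀` itself.
  no-near-domination : ∀ {L x₀ x₁} → (∀ x → x ≢ x₀ → Dominates G L x) → length L < r → ¬ Adj G x₀ x₁
  no-near-domination {L} {x₀} {x₁} dom l e = <⇒≱ l (hits⇒≤ hits)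
    where
    dom′ : ∀ x → Dominates G (x₀ ∷ L) x
    dom′ x with x Fin.≟ x₀
    ... | yes x≡x₀ = here (inj₁ x≡x₀)
    ... | no  x≢x₀ = there (dom x x≢x₀)
    unlinked : ∀ {t} → t ∈ L → ¬ Linked G t
    unlinked t∈L = no-linked dom′ l (there t∈L)
    via : ∀ {s y} → IsSlot s → InSlot s y → y ≢ x₀ → Any (InSlot s) L
    via slot i y≢x₀ = let z , z∈L , t = find (dom _ y≢x₀) in
      lose z∈L (inSlot-extend slot i (touch-sym G t) (unlinked z∈L))
    hits : ∀ {s} → s ∈ cliques → Any (InSlot s) L
    hits {s} s∈ with s Fin.≟ x₀
    ... | no s≢x₀ = via (All.lookup cliques-slots s∈) (inj₁ refl , slot-unlinked (All.lookup cliques-slots s∈)) s≢x₀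
    ... | yes refl with All.lookup cliques-slots s∈
    ... | slot@(inj₁ simp) = let y , _ , f , _ = good-linked s simp in
          via slot (inj₂ (adj-sym G f) , λ (¬good , _) → ¬good (s , simp , inj₂ (adj-sym G f)))
            (λ eq → adj-irrefl G (subst (Adj G s) eq f))
    ... | slot@(inj₂ bad) with nextToGood? x₁
    ... | no ¬next = via slot (inj₂ (adj-sym G e) , λ (_ , next) → ¬next next) (λ { refl → adj-irrefl G e })
    -- A linked `x₁` dominates `x₀`, and the non-good part of `L` dominates the rest of `Bad`. As
    -- `L` has fewer than `r` members, there is room for `x₁` within the length of `es`.
    ... | yes next = ⊥-elim (es-optimal (x₁ ∷ filter (¬? ∘ good?) L ,
            ≤-es (≤-trans (≤-reflexive (+-suc _ _)) (s≤s (count-good L dom-ms))) l , here linked , covered))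
      where
      linked : Linked G x₁
      linked = (λ good → proj₂ bad (x₁ , good , e)) , next
      dom-ms : ∀ {m} → m ∈ ms → Dominates G L m
      dom-ms m∈ = dom _ λ { refl → proj₁ bad (_ , All.lookup ms-simplicial m∈ , inj₁ refl) }
      covered : ∀ v → Bad G v → Dominates G (x₁ ∷ filter (¬? ∘ good?) L) v
      covered v badᵛ with v Fin.≟ x₀
      ... | yes refl = here (inj₂ e)
      ... | no v≢x₀  = there (bad-dominated badᵛ (dom v v≢x₀))

  -- If the merged vertex belongs to a set of size below `r`, adding `v` gives a dominating set of
  -- `G` of size at most `r` with the adjacent pair `u`, `v`. If not, the merged vertex is dominated
  -- through a neighbour of `u` or of `v`, so at most the other one of the two stays undominated in
  -- `G`. Either case has been excluded.
  merged-≥ : ∀ {u v L} → Adj G u v → MergedSD G u v L → r ≤ length L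
  merged-≥ {u} {v} {L} e (avoid , dom , _) with r ≤? length L
  ... | yes r≤ = r≤
  ... | no  r≰ with u ∈? L
  ... | yes u∈L = ⊥-elim (no-adjacent-pair dom′ (≰⇒> r≰) (there u∈L) (here refl) e)
    where
    dom′ : ∀ x → Dominates G (v ∷ L) x
    dom′ x with x Fin.≟ v
    ... | yes x≡v = here (inj₁ x≡v)
    ... | no  x≢v with find (dom x x≢v)
    ... | y , y∈L , inj₁ x≡y = there (lose y∈L (inj₁ x≡y))
    ... | y , y∈L , inj₂ (_ , inj₁ f) = there (lose y∈L (inj₂ f))
    ... | y , y∈L , inj₂ (_ , inj₂ (inj₁ (refl , _))) = there (lose u∈L (inj₁ refl))
    ... | y , y∈L , inj₂ (_ , inj₂ (inj₂ (refl , f))) = here (inj₂ (adj-sym G f))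
  ... | no u∉L = ⊥-elim (finish (find (dom u λ { refl → adj-irrefl G e })))
    where
    dom′ : ∀ x → x ≢ u → x ≢ v → Dominates G L x
    dom′ x x≢u x≢v with find (dom x x≢v)
    ... | y , y∈L , inj₁ x≡y = lose y∈L (inj₁ x≡y)
    ... | y , y∈L , inj₂ (_ , inj₁ f) = lose y∈L (inj₂ f)
    ... | y , y∈L , inj₂ (_ , inj₂ (inj₁ (x≡u , _))) = ⊥-elim (x≢u x≡u)
    ... | y , y∈L , inj₂ (_ , inj₂ (inj₂ (refl , f))) = ⊥-elim (u∉L y∈L)
    all-but-u : Dominates G L v → ∀ x → x ≢ u → Dominates G L x
    all-but-u domᵛ x x≢u with x Fin.≟ v
    ... | yes refl = domᵛ
    ... | no  x≢v  = dom′ x x≢u x≢v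
    all-but-v : Dominates G L u → ∀ x → x ≢ v → Dominates G L x
    all-but-v domᵘ x x≢v with x Fin.≟ u
    ... | yes refl = domᵘ
    ... | no  x≢u  = dom′ x x≢u x≢v
    finish : ∃[ y ] (y ∈ L × (u ≡ y ⊎ Merge G u v u y)) → ⊥
    finish (y , y∈L , inj₁ refl) = u∉L y∈L
    finish (y , y∈L , inj₂ (_ , inj₁ f)) = no-near-domination (all-but-v (lose y∈L (inj₂ f))) (≰⇒> r≰) (adj-sym G e)
    finish (y , y∈L , inj₂ (_ , inj₂ (inj₁ (_ , f)))) = no-near-domination (all-but-u (lose y∈L (inj₂ f))) (≰⇒> r≰) e
    finish (y , y∈L , inj₂ (_ , inj₂ (inj₂ (refl , f)))) = u∉L y∈L

  -- The neighbours of a simplicial vertex are good, so it has no linked neighbour and is poorly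
  -- placed for a mate. The exit vertex of its clique has one. The default `m` does not occur for
  -- members of `ms`.
  exit-vertex : Fin n → Fin n
  exit-vertex m with simplicial? m
  ... | yes s = proj₁ (good-linked m s)
  ... | no _  = m

  exit-adj : ∀ {m} → Simplicial G m → Adj G m (exit-vertex m)
  exit-adj {m} s with simplicial? m
  ... | yes s′ = proj₁ (proj₂ (proj₂ (good-linked m s′)))
  ... | no ¬s  = ⊥-elim (¬s s)

  exit-linked : ∀ {m} → Simplicial G m → ∃[ t ] (Linked G t × Adj G (exit-vertex m) t)
  exit-linked {m} s with simplicial? m
  ... | yes s′ = let _ , t , _ , p = good-linked m s′ in t , p
  ... | no ¬s  = ⊥-elim (¬s s)

  transversal : List (Fin n)
  transversal = map exit-vertex ms ++ es

  exit∈ : ∀ {m} → m ∈ ms → exit-vertex m ∈ transversal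
  exit∈ m∈ = ∈-++⁺ˡ (∈-map⁺ exit-vertex m∈)

  -- A simplicial exit vertex would put its linked neighbour into Good.
  reach-exit : ∀ {t m} → Simplicial G m → CompleteTo G t m →
               ∃[ m′ ] (m′ ∈ ms × Simplicial G m′ × Touch G m m′ × Adj G t (exit-vertex m′))
  reach-exit {t} {m} s complete with find (ms-cover s)
  ... | m′ , m′∈ , touch with All.lookup ms-simplicial m′∈
  ... | s′ with simplicial-touch s′ (inj₂ (adj-sym G (exit-adj s′))) touch
  ... | inj₁ refl = let t′ , (¬good , _) , e = exit-linked s′ in ⊥-elim (¬good (m , s , inj₂ (adj-sym G e)))
  ... | inj₂ e    = m′ , m′∈ , s′ , touch , complete _ (adj-sym G e)

  -- The linked neighbour `t` is adjacent to the exits of two different cliques, and at least one of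
  -- these exits is not `x`.
  linked-mate : ∀ {x t} → x ∈ transversal → Linked G t → Adj G x t →
                (∀ {m m′} → Simplicial G m → Simplicial G m′ → ¬ Touch G m m′ → x ≡ exit-vertex m → x ≢ exit-vertex m′) →
                Mate G transversal x
  linked-mate {x} x∈ linked e distinct with linked-spread _ linked
  ... | m , m′ , s , s′ , ¬touch , c , c′ with reach-exit s c | reach-exit s′ c′
  ... | p , p∈ , sp , tp , ep | q , q∈ , sq , tq , eq with x Fin.≟ exit-vertex p
  ... | no x≢ = lose (exit∈ p∈) (x≢ ∘ sym , inj₂ (_ , e , ep))
  ... | yes x≡ = lose (exit∈ q∈) (distinct sp sq apart x≡ ∘ sym , inj₂ (_ , e , eq))
    where
    apart : ¬ Touch G p q
    apart pq with good-cliques m m′ s s′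
    ... | inj₁ touch = ¬touch touch
    ... | inj₂ far   = far p q (touch-sym G tp) (touch-sym G tq) pq

  exits-distinct : ∀ {x m m′} → Simplicial G m → Simplicial G m′ → ¬ Touch G m m′ → x ≡ exit-vertex m → x ≢ exit-vertex m′
  exits-distinct s s′ ¬touch refl eq with good-cliques _ _ s s′
  ... | inj₁ touch = ¬touch touch
  ... | inj₂ far   = far _ _ (inj₂ (adj-sym G (exit-adj s))) (inj₂ (adj-sym G (exit-adj s′))) (inj₁ eq)

  transversal-SD : SD G transversal
  transversal-SD = dominated , All.tabulate mated
    where
    dominated : ∀ v → Dominates G transversal v
    dominated v with good? v | nextToGood? v
    ... | yes (m , s , touch) | _ with find (ms-cover s)
    ... | m′ , m′∈ , touch′ = lose (exit∈ m′∈) (simplicial-touch s′ (simplicial-touch s touch (touch-sym G touch′)) (inj₂ (adj-sym G (exit-adj s′))))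
      where s′ = All.lookup ms-simplicial m′∈
    dominated v | no ¬good | yes next = let m , _ , s , _ , _ , c , _ = linked-spread v (¬good , next)
                                            _ , m′∈ , _ , _ , e = reach-exit s c in lose (exit∈ m′∈) (inj₂ e)
    dominated v | no ¬good | no ¬next = Any.++⁺ʳ (map exit-vertex ms) (es-cover v (¬good , ¬next))
    mated : ∀ {x} → x ∈ transversal → Mate G transversal x
    mated {x} x∈ with ∈-++⁻ (map exit-vertex ms) x∈
    ... | inj₁ p with ∈-map⁻ exit-vertex p
    ... | m , m∈ , refl = let t , linked , e = exit-linked (All.lookup ms-simplicial m∈) in
          linked-mate x∈ linked e exits-distinct
    mated {x} x∈ | inj₂ x∈es = let t , linked , e = All.lookup es-linked x∈es in linked-mate x∈ linked e exits-distinct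

  length-transversal : length transversal ≡ r
  length-transversal = trans (List.length-++ (map exit-vertex ms))
    (trans (cong (_+ length es) (List.length-map exit-vertex ms)) (sym (List.length-++ ms)))

  -- The transversal is a semitotal dominating set of size `r`, and no contraction gets below `r`.
  not-reducible : ¬ OneEdgeContraction G
  not-reducible one = let _ , s , _ , (u , v , e , L , l , merged) , ¬sd , _ = oneEdge⇒merged G one in
    ¬sd (transversal , ≤-trans (≤-reflexive length-transversal) (≤-trans (merged-≥ e merged) l) , transversal-SD)

-- Induced copies of P₃ + kP₂

module _ {a} {A : Set a} where

  AllPairs-extract : ∀ {r} {R : A → A → Set r} {xs x} → (∀ {x y} → R x y → R y x) → AllPairs R xs → x ∈ xs →
    ∃[ rest ] (length xs ≡ suc (length rest) × AllPairs R rest × All (R x) rest × (∀ {y} → y ∈ rest → y ∈ xs))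
  AllPairs-extract s (p ∷ ps) (here refl) = _ , refl , ps , p , there
  AllPairs-extract {xs = y ∷ xs} s (p ∷ ps) (there x∈) with AllPairs-extract s ps x∈
  ... | rest , l , qs , q , sub = y ∷ rest , cong suc l ,
    All.tabulate (λ z∈ → All.lookup p (sub z∈)) ∷ qs , s (All.lookup p x∈) ∷ q ,
    λ { (here refl) → here refl ; (there z∈) → there (sub z∈) }

  AllPairs-with : ∀ {p r q} {P : A → Set p} {R : A → A → Set r} {Q : A → A → Set q} →
                  (∀ {x y} → P x → P y → R x y → Q x y) → ∀ {xs} → All P xs → AllPairs R xs → AllPairs Q xs
  AllPairs-with f [] [] = []
  AllPairs-with f (p ∷ ps) (r ∷ rs) = All.zipWith (λ (q , r) → f p q r) (ps , r) ∷ AllPairs-with f ps rs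

  filter-≤1 : ∀ {p} {P : A → Set p} (P? : Decidable P) {xs} →
              AllPairs (λ x y → P x → ¬ P y) xs → length (filter P? xs) ≤ 1
  filter-≤1 P? [] = z≤n
  filter-≤1 P? {x ∷ xs} (r ∷ rs) with P? x
  ... | no  _  = filter-≤1 P? rs
  ... | yes px = s≤s (≤-reflexive (cong length (List.filter-none P? (All.map (λ f → f px) r))))

  length-filter-mono : ∀ {p q} {P : A → Set p} {Q : A → Set q} (P? : Decidable P) (Q? : Decidable Q) xs →
                       length (filter P? (filter Q? xs)) ≤ length (filter P? xs)
  length-filter-mono P? Q? [] = z≤n
  length-filter-mono P? Q? (x ∷ xs) with does (Q? x)
  ... | false with does (P? x)
  ...   | false = length-filter-mono P? Q? xs
  ...   | true  = m≤n⇒m≤1+n (length-filter-mono P? Q? xs)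
  length-filter-mono P? Q? (x ∷ xs) | true with does (P? x)
  ...   | false = length-filter-mono P? Q? xs
  ...   | true  = s≤s (length-filter-mono P? Q? xs)

  two-elements : ∀ {xs : List A} → Unique xs → 2 ≤ length xs → ∃[ x ] ∃[ y ] (x ∈ xs × y ∈ xs × x ≢ y)
  two-elements {_ ∷ []} _ (s≤s ())
  two-elements {x ∷ y ∷ _} ((x≢y ∷ _) ∷ _) _ = x , y , here refl , there (here refl) , x≢y

module _ {n} (G : Graph n) where

  Embeds : ∀ {m} → Graph m → (Fin m → Fin n) → Set
  Embeds H f = (∀ {i j} → f i ≡ f j → i ≡ j) × (∀ i j → Adj H i j ⇔ Adj G (f i) (f j))

  embeds-⊕ : ∀ {m m′} {H : Graph m} {H′ : Graph m′} {f f′} → Embeds H f → Embeds H′ f′ →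
             (∀ i j → ¬ Touch G (f i) (f′ j)) → Embeds (H ⊕ H′) ([ f , f′ ]′ ∘ splitAt m)
  embeds-⊕ {m} {m′} {H} {H′} {f} {f′} (inj , iff) (inj′ , iff′) apart = injective , adjacent
    where
    injective : ∀ {i j} → [ f , f′ ]′ (splitAt m i) ≡ [ f , f′ ]′ (splitAt m j) → i ≡ j
    injective {i} {j} eq = trans (sym (Fin.join-splitAt m m′ i))
      (trans (cong (join m m′) (go (splitAt m i) (splitAt m j) eq)) (Fin.join-splitAt m m′ j))
      where
      go : ∀ x y → [ f , f′ ]′ x ≡ [ f , f′ ]′ y → x ≡ y
      go (inj₁ x) (inj₁ y) eq = cong inj₁ (inj eq)
      go (inj₁ x) (inj₂ y) eq = ⊥-elim (apart x y (inj₁ eq))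
      go (inj₂ x) (inj₁ y) eq = ⊥-elim (apart y x (inj₁ (sym eq)))
      go (inj₂ x) (inj₂ y) eq = cong inj₂ (inj′ eq)
    adjacent : ∀ i j → Adj (H ⊕ H′) i j ⇔ Adj G ([ f , f′ ]′ (splitAt m i)) ([ f , f′ ]′ (splitAt m j))
    adjacent i j = go (splitAt m i) (splitAt m j)
      where
      go : ∀ x y → Pointwise (Adj H) (Adj H′) x y ⇔ Adj G ([ f , f′ ]′ x) ([ f , f′ ]′ y)
      go (inj₁ x) (inj₁ y) = mk⇔ (λ { (inj₁ e) → Equivalence.to (iff x y) e }) (inj₁ ∘ Equivalence.from (iff x y))
      go (inj₁ x) (inj₂ y) = mk⇔ (λ ()) (λ e → ⊥-elim (apart x y (inj₂ e)))
      go (inj₂ x) (inj₁ y) = mk⇔ (λ ()) (λ e → ⊥-elim (apart y x (inj₂ (adj-sym G e))))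
      go (inj₂ x) (inj₂ y) = mk⇔ (λ { (inj₂ e) → Equivalence.to (iff′ x y) e }) (inj₂ ∘ Equivalence.from (iff′ x y))

  Edge : Fin n × Fin n → Set
  Edge (x , y) = Adj G x y

  Hits : Fin n → Fin n × Fin n → Set
  Hits v (x , y) = Touch G v x ⊎ Touch G v y

  hits? : ∀ v e → Dec (Hits v e)
  hits? v (x , y) = touch? G v x ⊎-dec touch? G v y

  Apart : Fin n × Fin n → Fin n × Fin n → Set
  Apart (x , y) e = ¬ Hits x e × ¬ Hits y e

  apart-sym : ∀ {e e′} → Apart e e′ → Apart e′ e
  apart-sym (p , q) = (λ { (inj₁ t) → p (inj₁ (touch-sym G t)) ; (inj₂ t) → q (inj₁ (touch-sym G t)) }) ,
                      (λ { (inj₁ t) → p (inj₂ (touch-sym G t)) ; (inj₂ t) → q (inj₂ (touch-sym G t)) })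

  InducedMatching : List (Fin n × Fin n) → Set
  InducedMatching M = All Edge M × AllPairs Apart M

  record HasP₃+ (k : ℕ) : Set where
    constructor mkP₃+
    field
      {x y z}  : Fin n
      xy       : Adj G x y
      yz       : Adj G y z
      xz       : ¬ Touch G x z
      M        : List (Fin n × Fin n)
      len      : length M ≡ k
      matching : InducedMatching M
      off      : ∀ {e} → e ∈ M → ¬ Hits x e × ¬ Hits y e × ¬ Hits z e

  pair : Fin n → Fin n → Fin 2 → Fin n
  pair x y zero       = x
  pair x y (suc zero) = y

  embeds-Path₂ : ∀ {x y} → Adj G x y → Embeds (Path 2) (pair x y)
  embeds-Path₂ {x} {y} e = injective , adjacent
    where
    injective : ∀ {i j} → pair x y i ≡ pair x y j → i ≡ j
    injective {zero}     {zero}     _    = refl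
    injective {zero}     {suc zero} refl = ⊥-elim (adj-irrefl G e)
    injective {suc zero} {zero}     refl = ⊥-elim (adj-irrefl G e)
    injective {suc zero} {suc zero} _    = refl
    adjacent : ∀ i j → Adj (Path 2) i j ⇔ Adj G (pair x y i) (pair x y j)
    adjacent zero       zero       = mk⇔ (λ { (inj₁ ()) ; (inj₂ ()) }) (⊥-elim ∘ adj-irrefl G)
    adjacent zero       (suc zero) = mk⇔ (λ _ → e) (λ _ → inj₁ refl)
    adjacent (suc zero) zero       = mk⇔ (λ _ → adj-sym G e) (λ _ → inj₂ refl)
    adjacent (suc zero) (suc zero) = mk⇔ (λ { (inj₁ ()) ; (inj₂ ()) }) (⊥-elim ∘ adj-irrefl G)

  triple : Fin n → Fin n → Fin n → Fin 3 → Fin n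
  triple x y z zero             = x
  triple x y z (suc zero)       = y
  triple x y z (suc (suc zero)) = z

  embeds-Path₃ : ∀ {x y z} → Adj G x y → Adj G y z → ¬ Touch G x z → Embeds (Path 3) (triple x y z)
  embeds-Path₃ {x} {y} {z} e f ¬t = injective , adjacent
    where
    injective : ∀ {i j} → triple x y z i ≡ triple x y z j → i ≡ j
    injective {zero}           {zero}           _    = refl
    injective {zero}           {suc zero}       refl = ⊥-elim (adj-irrefl G e)
    injective {zero}           {suc (suc zero)} eq   = ⊥-elim (¬t (inj₁ eq))
    injective {suc zero}       {zero}           refl = ⊥-elim (adj-irrefl G e)
    injective {suc zero}       {suc zero}       _    = refl
    injective {suc zero}       {suc (suc zero)} refl = ⊥-elim (adj-irrefl G f)
    injective {suc (suc zero)} {zero}           eq   = ⊥-elim (¬t (inj₁ (sym eq)))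
    injective {suc (suc zero)} {suc zero}       refl = ⊥-elim (adj-irrefl G f)
    injective {suc (suc zero)} {suc (suc zero)} _    = refl
    adjacent : ∀ i j → Adj (Path 3) i j ⇔ Adj G (triple x y z i) (triple x y z j)
    adjacent zero             zero             = mk⇔ (λ { (inj₁ ()) ; (inj₂ ()) }) (⊥-elim ∘ adj-irrefl G)
    adjacent zero             (suc zero)       = mk⇔ (λ _ → e) (λ _ → inj₁ refl)
    adjacent zero             (suc (suc zero)) = mk⇔ (λ { (inj₁ ()) ; (inj₂ ()) }) (λ g → ⊥-elim (¬t (inj₂ g)))
    adjacent (suc zero)       zero             = mk⇔ (λ _ → adj-sym G e) (λ _ → inj₂ refl)
    adjacent (suc zero)       (suc zero)       = mk⇔ (λ { (inj₁ ()) ; (inj₂ ()) }) (⊥-elim ∘ adj-irrefl G)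
    adjacent (suc zero)       (suc (suc zero)) = mk⇔ (λ _ → f) (λ _ → inj₁ refl)
    adjacent (suc (suc zero)) zero             = mk⇔ (λ { (inj₁ ()) ; (inj₂ ()) }) (λ g → ⊥-elim (¬t (inj₂ (adj-sym G g))))
    adjacent (suc (suc zero)) (suc zero)       = mk⇔ (λ _ → adj-sym G f) (λ _ → inj₂ refl)
    adjacent (suc (suc zero)) (suc (suc zero)) = mk⇔ (λ { (inj₁ ()) ; (inj₂ ()) }) (⊥-elim ∘ adj-irrefl G)

  End : Fin n → Fin n × Fin n → Set
  End v (x , y) = v ≡ x ⊎ v ≡ y

  pair-end : ∀ x y i → End (pair x y i) (x , y)
  pair-end x y zero       = inj₁ refl
  pair-end x y (suc zero) = inj₂ refl

  end-hits : ∀ {u v e} → End v e → Touch G u v → Hits u e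
  end-hits (inj₁ refl) t = inj₁ t
  end-hits (inj₂ refl) t = inj₂ t

  end-apart : ∀ {v e e′} → End v e → Apart e e′ → ¬ Hits v e′
  end-apart (inj₁ refl) = proj₁
  end-apart (inj₂ refl) = proj₂

  embeds-matching : ∀ {M} → InducedMatching M →
                    ∃[ f ] (Embeds (copies (length M) (Path 2)) f × ∀ i → ∃[ e ] (e ∈ M × End (f i) e))
  embeds-matching ([] , []) = (λ ()) , ((λ { {()} }) , λ ()) , λ ()
  embeds-matching {(x , y) ∷ M} (e ∷ es , a ∷ as) with embeds-matching (es , as)
  ... | f , emb , ends = [ pair x y , f ]′ ∘ splitAt 2 ,
      embeds-⊕ {H = Path 2} {H′ = copies (length M) (Path 2)} (embeds-Path₂ e) emb apart , λ i → ends′ (splitAt 2 i)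
    where
    apart : ∀ i j → ¬ Touch G (pair x y i) (f j)
    apart i j t = let _ , e∈ , end = ends j in end-apart (pair-end x y i) (All.lookup a e∈) (end-hits end t)
    ends′ : ∀ s → ∃[ e ] (e ∈ (x , y) ∷ M × End ([ pair x y , f ]′ s) e)
    ends′ (inj₁ i) = (x , y) , here refl , pair-end x y i
    ends′ (inj₂ j) = let e , e∈ , end = ends j in e , there e∈ , end

  P₃+⇒induced : ∀ {k} → HasP₃+ k → InducedIn (P₃+ k P₂) G
  P₃+⇒induced (mkP₃+ {x} {y} {z} e f ¬t M refl matching off) with embeds-matching matching
  ... | g , emb , ends = _ , embeds-⊕ {H = Path 3} {H′ = copies (length M) (Path 2)} (embeds-Path₃ e f ¬t) emb apart
    where
    apart : ∀ i j → ¬ Touch G (triple x y z i) (g j)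
    apart i j t with ends j
    apart zero             j t | _ , e∈ , end = proj₁ (off e∈) (end-hits end t)
    apart (suc zero)       j t | _ , e∈ , end = proj₁ (proj₂ (off e∈)) (end-hits end t)
    apart (suc (suc zero)) j t | _ , e∈ , end = proj₂ (proj₂ (off e∈)) (end-hits end t)

  -- Every vertex of `A` has a neighbour in `A`, so whenever all of `A` is put into a dominating
  -- set, the vertices in N[A] have mates.
  record Anchor (b : ℕ) : Set where
    field
      A           : List (Fin n)
      A-size      : length A ≤ b
      A-nonempty  : 0 < length A
      A-neighbour : ∀ {a} → a ∈ A → ∃[ a′ ] (a′ ∈ A × Adj G a a′)
      A-outside   : ∀ {c c′} → ¬ Dominates G A c → ¬ Dominates G A c′ → ¬ Adj G c c′

  vertices : List (Fin n × Fin n) → List (Fin n)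
  vertices []            = []
  vertices ((x , y) ∷ M) = x ∷ y ∷ vertices M

  length-vertices : ∀ M → length (vertices M) ≡ 2 * length M
  length-vertices []      = refl
  length-vertices (_ ∷ M) = trans (cong (2 +_) (length-vertices M)) (sym (*-suc 2 (length M)))

  end∈vertices : ∀ {M x y} → (x , y) ∈ M → x ∈ vertices M × y ∈ vertices M
  end∈vertices {_ ∷ M} (here refl) = here refl , there (here refl)
  end∈vertices {_ ∷ M} (there e∈)  = let p , q = end∈vertices e∈ in there (there p) , there (there q)

  vertices-neighbour : ∀ {M a} → All Edge M → a ∈ vertices M → ∃[ a′ ] (a′ ∈ vertices M × Adj G a a′)
  vertices-neighbour {_ ∷ _} (e ∷ _) (here refl)         = _ , there (here refl) , e
  vertices-neighbour {_ ∷ _} (e ∷ _) (there (here refl)) = _ , here refl , adj-sym G e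
  vertices-neighbour {_ ∷ _} (_ ∷ es) (there (there a∈)) =
    let a′ , a′∈ , f = vertices-neighbour es a∈ in a′ , there (there a′∈) , f

  -- `A` is the vertex set of an induced P₃ + kP₂, hence the size 3 + 2k; an edge beyond its closed
  -- neighbourhood would extend the copy.
  anchor-P₃+ : ∀ {k} → HasP₃+ k → ¬ HasP₃+ (suc k) → Anchor (3 + 2 * k)
  anchor-P₃+ (mkP₃+ {x} {y} {z} e f ¬t M refl (edges , aparts) off) ¬next = record
    { A = A ; A-size = ≤-reflexive (cong (3 +_) (length-vertices M)) ; A-nonempty = s≤s z≤n
    ; A-neighbour = neighbour ; A-outside = outside }
    where
    A : List (Fin n)
    A = x ∷ y ∷ z ∷ vertices M
    neighbour : ∀ {a} → a ∈ A → ∃[ a′ ] (a′ ∈ A × Adj G a a′)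
    neighbour (here refl)                 = y , there (here refl) , e
    neighbour (there (here refl))         = x , here refl , adj-sym G e
    neighbour (there (there (here refl))) = y , there (here refl) , adj-sym G f
    neighbour (there (there (there a∈)))  =
      let a′ , a′∈ , g = vertices-neighbour edges a∈ in a′ , there (there (there a′∈)) , g
    outside : ∀ {c c′} → ¬ Dominates G A c → ¬ Dominates G A c′ → ¬ Adj G c c′
    outside {c} {c′} ¬d ¬d′ g = ¬next (mkP₃+ e f ¬t ((c , c′) ∷ M) refl (g ∷ edges , All.tabulate new ∷ aparts)
      λ { (here refl) → away (here refl) , away (there (here refl)) , away (there (there (here refl))) ; (there e∈) → off e∈ })
      where
      away : ∀ {a} → a ∈ A → ¬ Hits a (c , c′)
      away a∈ (inj₁ t) = ¬d (lose a∈ (touch-sym G t))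
      away a∈ (inj₂ t) = ¬d′ (lose a∈ (touch-sym G t))
      new : ∀ {e} → e ∈ M → Apart (c , c′) e
      new {p , q} e∈ = let p∈ , q∈ = end∈vertices e∈ in
        apart-sym {p , q} {c , c′} (away (there (there (there p∈))) , away (there (there (there q∈))))

  -- A connected graph without an induced P₃ is complete, so a single edge dominates it.
  anchor-complete : Connected G → ∀ {u v} → Adj G u v → ¬ HasP₃+ 0 → Anchor 3
  anchor-complete conn {u} {v} e ¬p = record
    { A = u ∷ v ∷ [] ; A-size = n≤1+n 2 ; A-nonempty = s≤s z≤n
    ; A-neighbour = λ { (here refl) → v , there (here refl) , e ; (there (here refl)) → u , here refl , adj-sym G e }
    ; A-outside = λ {c} ¬d _ _ → ¬d (here (touch (proj₂ (conn c u)))) }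
    where
    touch : ∀ {ℓ w} → Walk G ℓ w u → Touch G w u
    touch here = inj₁ refl
    touch {w = w} (step f rest) with touch rest
    ... | inj₁ refl = inj₂ f
    ... | inj₂ g = decidable-stable (touch? G w u) λ ¬t → ¬p (mkP₃+ f g ¬t [] refl ([] , []) λ ())

  -- Descends to the largest j < k for which P₃ + jP₂ occurs, if there is one. The double negation
  -- replaces a decision of `HasP₃+`; it is harmless because the anchor is used to derive a
  -- contradiction.
  anchor : Connected G → ∀ {u v} → Adj G u v → ∀ k → ¬ HasP₃+ k → ¬ ¬ Anchor (3 + 2 * k)
  anchor conn e zero    ¬p none = none (anchor-complete conn e ¬p)
  anchor conn e (suc k) ¬p none = anchor conn e k
    (λ p → none (widen (anchor-P₃+ p ¬p))) (none ∘ widen)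
    where
    widen : Anchor (3 + 2 * k) → Anchor (3 + 2 * suc k)
    widen a = record { Anchor a ; A-size = ≤-trans (Anchor.A-size a) (+-monoʳ-≤ 3 (*-monoʳ-≤ 2 (n≤1+n k))) }

-- Irreducible graphs with large γ

module _ {n} (G : Graph n) where

  touch-near : ∀ {v w a} → Touch G v a → Touch G w a → w ≢ v → Near G v w
  touch-near (inj₁ refl) (inj₁ refl) w≢v = ⊥-elim (w≢v refl)
  touch-near (inj₁ refl) (inj₂ f)    w≢v = inj₁ (adj-sym G f)
  touch-near (inj₂ e)    (inj₁ refl) w≢v = inj₁ e
  touch-near (inj₂ e)    (inj₂ f)    w≢v = inj₂ (_ , e , adj-sym G f)

  touch-adj : ∀ {v w} → Touch G v w → v ≢ w → Adj G v w
  touch-adj (inj₁ v≡w) v≢w = ⊥-elim (v≢w v≡w)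
  touch-adj (inj₂ e)   _   = e

  adj⇒≢ : ∀ {v w} → Adj G v w → v ≢ w
  adj⇒≢ e refl = adj-irrefl G e

  dominates? : ∀ L v → Dec (Dominates G L v)
  dominates? L v = Any.any? (touch? G v) L

  module Friendly {x y} (xy : Adj G x y) where

    π : Fin n → Fin n
    π a with a Fin.≟ y
    ... | yes _ = x
    ... | no  _ = a

    π-id : ∀ {a} → a ≢ y → π a ≡ a
    π-id {a} a≢y with a Fin.≟ y
    ... | yes a≡y = ⊥-elim (a≢y a≡y)
    ... | no  _   = refl

    π-y : π y ≡ x
    π-y with y Fin.≟ y
    ... | yes _   = refl
    ... | no  y≢y = ⊥-elim (y≢y refl)

    π-avoids : ∀ a → π a ≢ y
    π-avoids a with a Fin.≟ y
    ... | yes _   = adj⇒≢ xy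
    ... | no  a≢y = a≢y

    π-adj : ∀ {a b} → Adj G a b → π a ≡ π b ⊎ Merge G x y (π a) (π b)
    π-adj {a} {b} e with a Fin.≟ y | b Fin.≟ y
    ... | yes refl | yes refl = ⊥-elim (adj-irrefl G e)
    ... | no _     | no _     = inj₂ (adj⇒≢ e , inj₁ e)
    ... | yes refl | no _ with x Fin.≟ b
    ...   | yes x≡b = inj₁ x≡b
    ...   | no  x≢b = inj₂ (x≢b , inj₂ (inj₁ (refl , e)))
    π-adj {a} {b} e | no _ | yes refl with a Fin.≟ x
    ...   | yes a≡x = inj₁ a≡x
    ...   | no  a≢x = inj₂ (a≢x , inj₂ (inj₂ (refl , adj-sym G e)))

    π-near : ∀ {a b} → Near G a b → π a ≡ π b ⊎ MergeNear G x y (π a) (π b)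
    π-near (inj₁ e) = Sum.map₂ inj₁ (π-adj e)
    π-near (inj₂ (q , e , f)) with π-adj e | π-adj f
    ... | inj₁ p | inj₁ r = inj₁ (trans p r)
    ... | inj₁ p | inj₂ m = inj₂ (inj₁ (subst (λ w → Merge G x y w _) (sym p) m))
    ... | inj₂ m | inj₁ r = inj₂ (inj₁ (subst (Merge G x y _) r m))
    ... | inj₂ m | inj₂ m′ = inj₂ (inj₂ (π q , π-avoids q , m , m′))

    merged : List (Fin n) → List (Fin n)
    merged L = x ∷ (L ∖ (x ∷ y ∷ []))

    π∈ : ∀ {L a} → a ∈ L → π a ∈ merged L
    π∈ {L} {a} a∈ with a Fin.≟ y | a Fin.≟ x
    ... | yes _   | _        = here refl
    ... | no _    | yes refl = here refl
    ... | no a≢y  | no a≢x   = there (∈-∖⁺ (x ∷ y ∷ []) a∈ λ { (here e) → a≢x e ; (there (here e)) → a≢y e })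

    -- Domination and nearness pass along `π`; a mate could only be lost by being identified with
    -- its vertex, which happens to the pair `x`, `y` alone. The merged vertex obtains `z` as its
    -- mate instead, and this is the use of a friendly triple.
    merged-SD : ∀ {L z} → SD G L → y ∈ L → z ∈ L → z ≢ x → z ≢ y → Near G y z → MergedSD G x y (merged L)
    merged-SD {L} {z} (dom , mates) y∈ z∈ z≢x z≢y near = adj⇒≢ xy ∷ All.tabulate avoid , dominated , All.tabulate mated
      where
      avoid : ∀ {w} → w ∈ L ∖ (x ∷ y ∷ []) → w ≢ y
      avoid w∈ refl = proj₂ (∈-∖⁻ (x ∷ y ∷ []) {L} w∈) (there (here refl))
      dominated : ∀ w → w ≢ y → Any (λ d → w ≡ d ⊎ Merge G x y w d) (merged L)
      dominated w w≢y with find (dom w)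
      ... | d , d∈ , inj₁ refl = lose (π∈ d∈) (inj₁ (sym (π-id w≢y)))
      ... | d , d∈ , inj₂ e = lose (π∈ d∈) (subst (λ v → v ≡ π d ⊎ Merge G x y v (π d)) (π-id w≢y) (π-adj e))
      mate-of : ∀ {a b} → b ∈ L → π b ≢ π a → Near G a b → Any (λ w → w ≢ π a × MergeNear G x y (π a) w) (merged L)
      mate-of b∈ ≢ near′ with π-near near′
      ... | inj₁ eq = ⊥-elim (≢ (sym eq))
      ... | inj₂ m  = lose (π∈ b∈) (≢ , m)
      mated : ∀ {m} → m ∈ merged L → Any (λ w → w ≢ m × MergeNear G x y m w) (merged L)
      mated (here refl) = subst (λ v → Any (λ w → w ≢ v × MergeNear G x y v w) (merged L)) π-y
        (mate-of z∈ (λ eq → z≢x (trans (sym (π-id z≢y)) (trans eq π-y))) near)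
      mated {m} (there m∈) with ∈-∖⁻ (x ∷ y ∷ []) m∈
      ... | m∈L , m∉ with find (All.lookup mates m∈L)
      ... | w , w∈ , w≢m , near′ = subst (λ v → Any (λ w → w ≢ v × MergeNear G x y v w) (merged L)) (π-id m≢y)
              (mate-of w∈ distinct near′)
        where
        m≢y : m ≢ y
        m≢y eq = m∉ (there (here eq))
        distinct : π w ≢ π m
        distinct eq with w Fin.≟ y
        ... | yes refl = m∉ (here (trans (sym (π-id m≢y)) (sym eq)))
        ... | no  _    = w≢m (trans eq (π-id m≢y))

    merged-length : ∀ {L} → x ∈ L → y ∈ L → suc (length (merged L)) ≤ length L
    merged-length x∈ y∈ = length-∖ ((adj⇒≢ xy ∷ []) ∷ [] ∷ [])
      λ { (here refl) → x∈ ; (there (here refl)) → y∈ }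

¬¬-minimal : ∀ {a p} {A : Set a} {P : A → Set p} (μ : A → ℕ) x → P x →
             ¬ ¬ (∃[ y ] (P y × (∀ {z} → P z → μ y ≤ μ z)))
¬¬-minimal {P = P} μ x px none = go (μ x) x px ≤-refl
  where
  go : ∀ b x → P x → μ x ≤ b → ⊥
  go b x px μ≤b = none (x , px , λ {z} pz → ≮⇒≥ λ μz<μx → below b x μ≤b z pz μz<μx)
    where
    below : ∀ b x → μ x ≤ b → ∀ z → P z → μ z < μ x → ⊥
    below zero    x μ≤b z pz lt = n≮0 (≤-trans lt μ≤b)
    below (suc b) x μ≤b z pz lt = go b z pz (≤-pred (≤-trans lt μ≤b))

-- A friendly triple x ~ y, d(y, z) ≤ 2 in a minimum set would shrink when xy is contracted.
record Irreducible {n} (G : Graph n) (k γ : ℕ) : Set where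
  field
    free       : ¬ HasP₃+ G k
    conn       : Connected G
    minimum    : ∀ {L} → SD G L → γ ≤ length L
    unfriendly : ∀ {L} → SD G L → length L ≤ γ → ∀ {x y z} → x ∈ L → y ∈ L → z ∈ L →
                 Adj G x y → z ≢ x → z ≢ y → ¬ Near G y z

  P₃-matching : ∀ {x y z} → Adj G x y → Adj G y z → ¬ Touch G x z → ∀ M → k ≤ length M → InducedMatching G M →
                (∀ {e} → e ∈ M → ¬ Hits G x e × ¬ Hits G y e × ¬ Hits G z e) → ⊥
  P₃-matching e f ¬t M l (edges , aparts) off = free (mkP₃+ e f ¬t (take k M) (length-take-≤ l)
    (All.take⁺ k edges , AllPairs.take⁺ k aparts) (off ∘ ∈-take k))

irreducible : ∀ {n} (G : Graph n) {k γ} → ¬ HasP₃+ G k → Connected G → (∀ {s} → SD≤ G s → γ ≤ s) →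
              ¬ MergedSD≤ G (pred γ) → Irreducible G k γ
irreducible G {k} {γ} free conn least ¬merged = record
  { free = free ; conn = conn ; minimum = λ sd → least (_ , ≤-refl , sd)
  ; unfriendly = λ {L} sd l x∈ y∈ z∈ e z≢x z≢y near → let open Friendly G e in
      ¬merged (_ , _ , e , merged L , pred-mono-≤ (≤-trans (merged-length x∈ y∈) l) , merged-SD sd y∈ z∈ z≢x z≢y near) }

fresh : ∀ {n} {L : List (Fin n)} S → Unique L → length S < length L → ∃[ x ] (x ∈ L × x ∉ S)
fresh {L = L} S u l with L ∖ S in eq | length-∖-≥ S u
... | []    | bound = ⊥-elim (<⇒≱ l (≤-trans bound (≤-reflexive (+-identityʳ _))))
... | x ∷ _ | _     = x , ∈-∖⁻ S (subst (x ∈_) (sym eq) (here refl))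

-- Vertices of a minimum set outside N[A]

module Outside {n} (G : Graph n) {k γ b} (irr : Irreducible G k γ) (anc : Anchor G b)
  (n-neighbour : ∀ v → ∃[ w ] Adj G v w) where

  open Irreducible irr
  open Anchor anc

  InC : Fin n → Set
  InC v = ¬ Dominates G A v

  inC? : ∀ v → Dec (InC v)
  inC? v = ¬? (dominates? G A v)

  next-C : ∀ {c z} → InC c → Adj G c z → Dominates G A z
  next-C {c} {z} inC e = decidable-stable (dominates? G A z) λ ¬d → A-outside inC ¬d e

  count-C : List (Fin n) → ℕ
  count-C L = length (filter inC? L)

  -- The number of vertices outside N[A] is a secondary objective: an exchange that keeps the size
  -- but moves vertices into N[A] becomes contradictory.
  record Optimal (D : List (Fin n)) : Set where
    field
      D-SD      : SD G D
      D-length  : length D ≤ γ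
      D-unique  : Unique D
      D-fewest  : ∀ {L} → SD G L → length L ≤ γ → count-C D ≤ count-C L

  dedup : List (Fin n) → List (Fin n)
  dedup = deduplicate Fin._≟_

  dedup-unique : ∀ L → Unique (dedup L)
  dedup-unique = UniqueDec.deduplicate-! Fin._≟_

  ∈-dedup⁺ : ∀ {L x} → x ∈ L → x ∈ dedup L
  ∈-dedup⁺ = ∈-deduplicate⁺ Fin._≟_

  ∈-dedup⁻ : ∀ L {x} → x ∈ dedup L → x ∈ L
  ∈-dedup⁻ = ∈-deduplicate⁻ Fin._≟_

  any-dedup : ∀ {p} {P : Fin n → Set p} {L} → Any P L → Any P (dedup L)
  any-dedup any = let _ , x∈ , p = find any in lose (∈-dedup⁺ x∈) p

  dedup-SD : ∀ {L} → SD G L → SD G (dedup L)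
  dedup-SD {L} (dom , mates) = (λ v → any-dedup (dom v)) , All.tabulate λ v∈ → any-dedup (All.lookup mates (∈-dedup⁻ L v∈))

  optimal : ∀ {L} → SD G L → length L ≤ γ → ¬ ¬ (∃[ D ] Optimal D)
  optimal {L} sd l none = ¬¬-minimal {P = λ D → SD G D × length D ≤ γ × Unique D} count-C (dedup L)
    (dedup-SD sd , ≤-trans (List.length-deduplicate Fin._≟_ L) l , dedup-unique L)
    λ (D , (sd , l , u) , best) → none (D , record { D-SD = sd ; D-length = l ; D-unique = u ; D-fewest = λ {L} sd′ l′ →
      ≤-trans (best (dedup-SD sd′ , ≤-trans (List.length-deduplicate Fin._≟_ L) l′ , dedup-unique L))
        (unique-length-≤ (Unique.filter⁺ inC? (dedup-unique L))
          λ x∈ → let x∈′ , c = ∈-filter⁻ inC? x∈ in ∈-filter⁺ inC? (∈-dedup⁻ L x∈′) c) })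

  module _ {D} (opt : Optimal D) where

    open Optimal opt

    D-dominates : ∀ v → Dominates G D v
    D-dominates = proj₁ D-SD

    X Y : List (Fin n)
    X = filter inC? D
    Y = filter (¬? ∘ inC?) D

    X⊆D : ∀ {x} → x ∈ X → x ∈ D × InC x
    X⊆D = ∈-filter⁻ inC?

    NoCommon : Fin n → Fin n → Set
    NoCommon c c′ = ∀ x → Adj G c x → ¬ Adj G c′ x

    noCommon-sym : ∀ {c c′} → NoCommon c c′ → NoCommon c′ c
    noCommon-sym p x e f = p x f e

    common? : ∀ c c′ → Dec (∃[ x ] (Adj G c x × Adj G c′ x))
    common? c c′ = Fin.any? λ x → adj? G c x ×-dec adj? G c′ x

    -- Greedy splitting: as long as two vertices have a common neighbour, both go to `R` and the
    -- neighbour to `F`, so `R` is twice as long as `F`. No two vertices of `X′` are left with a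
    -- common neighbour.
    record Packing (L : List (Fin n)) : Set where
      field
        X′ R F  : List (Fin n)
        cover   : ∀ {x} → x ∈ L → x ∈ X′ ⊎ x ∈ R
        X′⊆     : ∀ {x} → x ∈ X′ → x ∈ L
        R⊆      : ∀ {x} → x ∈ R → x ∈ L
        sizes   : length X′ + (length F + length F) ≤ length L
        R-size  : length R ≡ length F + length F
        packed  : AllPairs NoCommon X′
        F-dom   : ∀ {x} → x ∈ R → Any (Adj G x) F
        F-next  : ∀ {y} → y ∈ F → ∃[ x ] (x ∈ L × Adj G x y)

    packing : ∀ L → Packing L
    packing [] = record { X′ = [] ; R = [] ; F = [] ; cover = λ () ; X′⊆ = λ () ; R⊆ = λ () ; sizes = z≤n
                        ; R-size = refl ; packed = [] ; F-dom = λ () ; F-next = λ () }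
    packing (x ∷ L) with packing L
    ... | p with Any.any? (common? x) (Packing.X′ p)
    ... | no ¬any = let open Packing p in record
      { X′ = x ∷ X′ ; R = R ; F = F
      ; cover = λ { (here refl) → inj₁ (here refl) ; (there y∈) → Sum.map₁ there (cover y∈) }
      ; X′⊆ = λ { (here refl) → here refl ; (there y∈) → there (X′⊆ y∈) }
      ; R⊆ = there ∘ R⊆ ; sizes = s≤s sizes ; R-size = R-size
      ; packed = All.map (λ ¬c y e f → ¬c (y , e , f)) (All.¬Any⇒All¬ X′ ¬any) ∷ packed
      ; F-dom = F-dom ; F-next = λ y∈ → let z , z∈ , e = F-next y∈ in z , there z∈ , e }
    ... | yes any with find any
    ... | c , c∈ , y , xy , cy = let open Packing p in record
      { X′ = X′ ∖ (c ∷ []) ; R = x ∷ c ∷ R ; F = y ∷ F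
      ; cover = λ { (here refl) → inj₂ (here refl) ; (there z∈) → move (cover z∈) }
      ; X′⊆ = λ z∈ → there (X′⊆ (proj₁ (∈-∖⁻ (c ∷ []) z∈)))
      ; R⊆ = λ { (here refl) → here refl ; (there (here refl)) → there (X′⊆ c∈) ; (there (there z∈)) → there (R⊆ z∈) }
      ; sizes = ≤-trans (shuffle (length (X′ ∖ (c ∷ []))) (length F))
                  (s≤s (≤-trans (+-monoˡ-≤ _ (length-∖ {S = c ∷ []} ([] ∷ []) λ { (here refl) → c∈ })) sizes))
      ; R-size = trans (cong (2 +_) R-size) (cong suc (sym (+-suc _ _)))
      ; packed = AllPairs.filter⁺ (λ z → ¬? (z Fin.≟ c)) packed
      ; F-dom = λ { (here refl) → here xy ; (there (here refl)) → here cy ; (there (there z∈)) → there (F-dom z∈) }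
      ; F-next = λ { (here refl) → x , here refl , xy ; (there w∈) → let z , z∈ , e = F-next w∈ in z , there z∈ , e } }
      where
      move : ∀ {z} → z ∈ Packing.X′ p ⊎ z ∈ Packing.R p → z ∈ Packing.X′ p ∖ (c ∷ []) ⊎ z ∈ x ∷ c ∷ Packing.R p
      move {z} (inj₂ z∈) = inj₂ (there (there z∈))
      move {z} (inj₁ z∈) with z Fin.≟ c
      ... | yes refl = inj₂ (there (here refl))
      ... | no  z≢c  = inj₁ (∈-∖⁺ (c ∷ []) z∈ λ { (here eq) → z≢c eq })
      shuffle : ∀ a f → a + (suc f + suc f) ≤ suc (suc a + (f + f))
      shuffle a f = ≤-reflexive (eq a f)
        where
        eq : ∀ a f → a + (suc f + suc f) ≡ suc (suc a + (f + f))
        eq = solve-∀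

    open Packing (packing X) public

    X′-unique : Unique X′
    X′-unique = AllPairs.map (λ { {c} p refl → let x , e = n-neighbour c in p x e e }) packed

    -- Otherwise trade `X` for `A`, `F` and one neighbour of each vertex of `X′`. Dominating `R` by
    -- `F` saves as many vertices as `F` has, which pays for `A`, and `A` provides all mates. The
    -- new set lies inside N[A], against the choice of `D`.
    F<A : length F < length A
    F<A with length F <? length A
    ... | yes lt = lt
    ... | no  ≮ = ⊥-elim (n≮0 (≤-trans A-nonempty (≤-trans (≮⇒≥ ≮) (≤-trans F≤X (≤-trans (D-fewest L-SD L-length) (≤-reflexive no-C))))))
      where
      chosen : Fin n → Fin n
      chosen c = proj₁ (n-neighbour c)
      L : List (Fin n)
      L = A ++ (Y ++ (F ++ map chosen X′))
      F≤X : length F ≤ length X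
      F≤X = ≤-trans (m≤m+n (length F) (length F)) (≤-trans (m≤n+m _ (length X′)) sizes)
      inside : ∀ {v} → v ∈ L → Dominates G A v
      inside {v} v∈ with ∈-++⁻ A v∈
      ... | inj₁ v∈A = lose v∈A (inj₁ refl)
      ... | inj₂ v∈₁ with ∈-++⁻ Y v∈₁
      ... | inj₁ v∈Y = decidable-stable (dominates? G A v) (proj₂ (∈-filter⁻ (¬? ∘ inC?) {xs = D} v∈Y))
      ... | inj₂ v∈₂ with ∈-++⁻ F v∈₂
      ... | inj₁ v∈F = let x , x∈ , e = F-next v∈F in next-C (proj₂ (X⊆D x∈)) e
      ... | inj₂ v∈₃ with ∈-map⁻ chosen v∈₃
      ... | c , c∈ , refl = next-C (proj₂ (X⊆D (X′⊆ c∈))) (proj₂ (n-neighbour c))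
      no-C : count-C L ≡ 0
      no-C = cong length (List.filter-none inC? (All.tabulate λ v∈ ¬d → ¬d (inside v∈)))
      dominated : ∀ v → Dominates G L v
      dominated v with dominates? G A v
      ... | yes d = Any.++⁺ˡ d
      ... | no ¬d with find (D-dominates v)
      ... | d , d∈ , inj₂ e = lose (∈-++⁺ʳ A (∈-++⁺ˡ (∈-filter⁺ (¬? ∘ inC?) d∈ λ c → A-outside ¬d c e))) (inj₂ e)
      ... | d , d∈ , inj₁ refl with cover (∈-filter⁺ inC? d∈ ¬d)
      ... | inj₁ p = lose (∈-++⁺ʳ A (∈-++⁺ʳ Y (∈-++⁺ʳ F (∈-map⁺ chosen p)))) (inj₂ (proj₂ (n-neighbour v)))
      ... | inj₂ p = Any.++⁺ʳ A (Any.++⁺ʳ Y (Any.++⁺ˡ (Any.map inj₂ (F-dom p))))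
      L-SD : SD G L
      L-SD = dominated , All.tabulate mated
        where
        mated : ∀ {v} → v ∈ L → Mate G L v
        mated v∈ with find (inside v∈)
        ... | a , a∈ , inj₂ e    = lose (∈-++⁺ˡ a∈) (adj⇒≢ G (adj-sym G e) , inj₁ e)
        ... | a , a∈ , inj₁ refl = let a′ , a′∈ , e = A-neighbour a∈ in lose (∈-++⁺ˡ a′∈) (adj⇒≢ G (adj-sym G e) , inj₁ e)
      L-length : length L ≤ γ
      L-length = begin
        length L                                            ≡⟨ trans (List.length-++ A) (cong (length A +_) (trans (List.length-++ Y) (cong (length Y +_) (trans (List.length-++ F) (cong (length F +_) (List.length-map chosen X′)))))) ⟩
        length A + (length Y + (length F + length X′))      ≤⟨ +-monoˡ-≤ _ (≮⇒≥ ≮) ⟩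
        length F + (length Y + (length F + length X′))      ≡⟨ shuffle (length F) (length Y) (length X′) ⟩
        (length X′ + (length F + length F)) + length Y      ≤⟨ +-monoˡ-≤ _ sizes ⟩
        length X + length Y                                 ≡⟨ length-filter-split inC? D ⟨
        length D                                            ≤⟨ D-length ⟩
        γ                                                   ∎
        where
        open ≤-Reasoning
        shuffle : ∀ f y x → f + (y + (f + x)) ≡ (x + (f + f)) + y
        shuffle = solve-∀

    R-size-≤ : length R ≤ 2 * b
    R-size-≤ = begin
      length R            ≡⟨ R-size ⟩
      length F + length F ≤⟨ +-mono-≤ F≤b F≤b ⟩
      b + b               ≡⟨ cong (b +_) (+-identityʳ b) ⟨
      2 * b               ∎
      where
      open ≤-Reasoning
      F≤b : length F ≤ b
      F≤b = ≤-trans (<⇒≤ F<A) A-size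

    -- Removing vertices of `D` outside `W` leaves every vertex with property `Q` a mate, so a small
    -- `W` makes most of `D` removable.
    record Witnesses (Q : Fin n → Set) (b : ℕ) : Set where
      field
        W     : List (Fin n)
        W⊆D   : ∀ {w} → w ∈ W → w ∈ D
        W-size  : length W ≤ b
        mates : ∀ {v} → v ∈ D → Q v → Mate G W v

    open Witnesses

    join-witnesses : ∀ {Q Q′ b b′} → Witnesses Q b → Witnesses Q′ b′ → Witnesses (λ v → Q v ⊎ Q′ v) (b + b′)
    join-witnesses w w′ = record
      { W = W w ++ W w′
      ; W⊆D = λ p → [ W⊆D w , W⊆D w′ ]′ (∈-++⁻ (W w) p)
      ; W-size = ≤-trans (≤-reflexive (List.length-++ (W w))) (+-mono-≤ (W-size w) (W-size w′))
      ; mates = λ { v∈ (inj₁ q) → Any.++⁺ˡ (mates w v∈ q) ; v∈ (inj₂ q) → Any.++⁺ʳ (W w) (mates w′ v∈ q) } }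

    witnesses-resp : ∀ {Q Q′ b b′} → (∀ {v} → v ∈ D → Q′ v → Q v) → b ≤ b′ → Witnesses Q b → Witnesses Q′ b′
    witnesses-resp f b≤b′ w = record
      { W = W w ; W⊆D = W⊆D w ; W-size = ≤-trans (W-size w) b≤b′ ; mates = λ v∈ q → mates w v∈ (f v∈ q) }

    witness-vertex : ∀ {v} → v ∈ D → Witnesses (_≡ v) 1
    witness-vertex v∈ = let w , w∈ , p = find (All.lookup (proj₂ D-SD) v∈) in record
      { W = w ∷ [] ; W⊆D = λ { (here refl) → w∈ } ; W-size = ≤-refl ; mates = λ { _ refl → here p } }

    witness-list : ∀ L → (∀ {v} → v ∈ L → v ∈ D) → Witnesses (_∈ L) (length L)
    witness-list []      _   = record { W = [] ; W⊆D = λ () ; W-size = z≤n ; mates = λ _ () }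
    witness-list (v ∷ L) sub = witnesses-resp (λ { _ (here eq) → inj₁ eq ; _ (there p) → inj₂ p }) ≤-refl
      (join-witnesses (witness-vertex (sub (here refl))) (witness-list L (sub ∘ there)))

    -- Any two vertices of `D` in N[a] are within distance two, so two of them serve all the others
    -- and each other. If there is only one, its own mate is taken.
    witness-around : ∀ a → Witnesses (λ v → Touch G v a) 2
    witness-around a with filter (λ v → touch? G v a) D in eq | Unique.filter⁺ (λ v → touch? G v a) D-unique
    ... | [] | _ = record { W = [] ; W⊆D = λ () ; W-size = z≤n
                          ; mates = λ v∈ t → case subst (_ ∈_) eq (∈-filter⁺ (λ v → touch? G v a) v∈ t) of λ () }
    ... | v ∷ [] | _ = witnesses-resp only (n≤1+n 1) (witness-vertex (proj₁ (∈-filter⁻ (λ v → touch? G v a) (subst (v ∈_) (sym eq) (here refl)))))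
      where
      only : ∀ {w} → w ∈ D → Touch G w a → w ≡ v
      only w∈ t with subst (_ ∈_) eq (∈-filter⁺ (λ v → touch? G v a) w∈ t)
      ... | here w≡v = w≡v
    ... | p ∷ q ∷ _ | (p≢q ∷ _) ∷ _ = record { W = p ∷ q ∷ [] ; W⊆D = λ w∈ → proj₁ (member w∈) ; W-size = ≤-refl ; mates = mated }
      where
      member : ∀ {w} → w ∈ p ∷ q ∷ [] → w ∈ D × Touch G w a
      member (here refl)         = ∈-filter⁻ (λ v → touch? G v a) (subst (p ∈_) (sym eq) (here refl))
      member (there (here refl)) = ∈-filter⁻ (λ v → touch? G v a) (subst (q ∈_) (sym eq) (there (here refl)))
      mated : ∀ {v} → v ∈ D → Touch G v a → Mate G (p ∷ q ∷ []) v
      mated {v} v∈ t with p Fin.≟ v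
      ... | no p≢v   = here (p≢v , touch-near G t (proj₂ (member (here refl))) p≢v)
      ... | yes refl = there (here (p≢q ∘ sym , touch-near G t (proj₂ (member (there (here refl)))) (p≢q ∘ sym)))

    witness-A : Witnesses (Dominates G A) (2 * b)
    witness-A = witnesses-resp (λ _ d → d) (*-monoʳ-≤ 2 A-size) (go A)
      where
      go : ∀ A → Witnesses (Dominates G A) (2 * length A)
      go []      = record { W = [] ; W⊆D = λ () ; W-size = z≤n ; mates = λ _ () }
      go (a ∷ A) = witnesses-resp (λ _ → Any.toSum) (≤-reflexive (sym (*-suc 2 (length A)))) (join-witnesses (witness-around a) (go A))

    private
      kept : Witnesses (λ v → Dominates G A v ⊎ v ∈ R) (2 * b + length R)
      kept = join-witnesses witness-A (witness-list R (proj₁ ∘ X⊆D ∘ R⊆))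

      S : List (Fin n)
      S = X′ ∖ W kept

      S⊆ : ∀ {c} → c ∈ S → c ∈ X′ × c ∉ W kept
      S⊆ = ∈-∖⁻ (W kept)

      S-C : ∀ {c} → c ∈ S → c ∈ D × InC c
      S-C = X⊆D ∘ X′⊆ ∘ proj₁ ∘ S⊆

      -- A vertex of `D` in N[A] or in `R` has a mate among the witnesses, which `S` avoids. A
      -- vertex of `X′` has no mate in `S` to lose: `X′` is independent and has no common
      -- neighbours.
      kept-mate : ∀ {S₀ v} → (∀ {c} → c ∈ S₀ → c ∈ S) → v ∈ D → Mate G (D ∖ S₀) v
      kept-mate {S₀} {v} sub v∈ with dominates? G A v
      ... | yes d = let w , w∈ , p = find (mates kept v∈ (inj₁ d)) in
                    lose (∈-∖⁺ S₀ (W⊆D kept w∈) λ w∈S₀ → proj₂ (S⊆ (sub w∈S₀)) w∈) p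
      ... | no ¬d with cover (∈-filter⁺ inC? v∈ ¬d)
      ... | inj₂ v∈R = let w , w∈ , p = find (mates kept v∈ (inj₂ v∈R)) in
                       lose (∈-∖⁺ S₀ (W⊆D kept w∈) λ w∈S₀ → proj₂ (S⊆ (sub w∈S₀)) w∈) p
      ... | inj₁ v∈X′ = let w , w∈ , w≢v , near = find (All.lookup (proj₂ D-SD) v∈) in
                        lose (∈-∖⁺ S₀ w∈ λ w∈S₀ → far w≢v near (sub w∈S₀)) (w≢v , near)
        where
        far : ∀ {w} → w ≢ v → Near G v w → w ∈ S → ⊥
        far w≢v (inj₁ e) w∈S = A-outside ¬d (proj₂ (S-C w∈S)) e
        far w≢v (inj₂ (x , e , f)) w∈S =
          AllPairs-lookup noCommon-sym packed v∈X′ (proj₁ (S⊆ w∈S)) (w≢v ∘ sym) x e (adj-sym G f)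

    Spoke : Fin n × Fin n → Set
    Spoke (c , z) = c ∈ S × Adj G c z

    Split : Fin n × Fin n → Fin n × Fin n → Set
    Split (c , z) (c′ , z′) = c ≢ c′ × ¬ Touch G z z′

    split-sym : ∀ {p q} → Split p q → Split q p
    split-sym (c≢ , ¬t) = c≢ ∘ sym , ¬t ∘ touch-sym G

    -- Replacing the c's by the z's keeps the size and lowers the number of vertices
    -- outside N[A], so some vertex is left undominated.
    exchange : ∀ P → 0 < length P → All Spoke P → Unique (map proj₁ P) →
               ∃[ u ] ∃[ p ] (p ∈ P × Adj G u (proj₁ p) × ¬ Dominates G (map proj₂ P) u)
    exchange P nonempty spokes unique with Fin.all? (dominates? G (D ∖ map proj₁ P ++ map proj₂ P))
    ... | yes dom = ⊥-elim (<⇒≱ fewer (D-fewest L-SD L-length))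
      where
      cs zs L : List (Fin n)
      cs = map proj₁ P
      zs = map proj₂ P
      L = D ∖ cs ++ zs
      cs⊆S : ∀ {c} → c ∈ cs → c ∈ S
      cs⊆S c∈ with ∈-map⁻ proj₁ c∈
      ... | p , p∈ , refl = proj₁ (All.lookup spokes p∈)
      zs-next : ∀ {z} → z ∈ zs → Dominates G A z
      zs-next z∈ with ∈-map⁻ proj₂ z∈
      ... | p , p∈ , refl = let c∈ , e = All.lookup spokes p∈ in next-C (proj₂ (S-C c∈)) e
      mated : ∀ {v} → v ∈ L → Mate G L v
      mated {v} v∈ with v ∈? D
      ... | yes v∈D = Any.++⁺ˡ (kept-mate cs⊆S v∈D)
      ... | no v∉D with ∈-++⁻ (D ∖ cs) v∈
      ... | inj₁ p = ⊥-elim (v∉D (proj₁ (∈-∖⁻ cs p)))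
      ... | inj₂ v∈zs with find (zs-next v∈zs)
      -- An inserted leaf touches some `a` in `A`. The dominator of `a` lies in N[A], hence not in
      -- `S`, so it is retained and serves as mate.
      ... | a , a∈ , t with find (D-dominates a)
      ... | d , d∈ , t′ = lose (∈-++⁺ˡ (∈-∖⁺ cs d∈ (λ d∈cs → proj₂ (S-C (cs⊆S d∈cs)) (lose a∈ (touch-sym G t′)))))
                            (d≢v , touch-near G t (touch-sym G t′) d≢v)
        where
        d≢v : d ≢ v
        d≢v refl = v∉D d∈
      L-SD : SD G L
      L-SD = dom , All.tabulate mated
      len : length cs ≡ length zs
      len = trans (List.length-map proj₁ P) (sym (List.length-map proj₂ P))
      cs+ : length cs + length (D ∖ cs) ≤ length D
      cs+ = length-∖ unique (proj₁ ∘ S-C ∘ cs⊆S)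
      L-length : length L ≤ γ
      L-length = ≤-trans (≤-reflexive (trans (List.length-++ (D ∖ cs)) (trans (+-comm _ (length zs)) (cong (_+ length (D ∖ cs)) (sym len)))))
                   (≤-trans cs+ D-length)
      count-L : count-C L ≤ length (X ∖ cs)
      count-L = ≤-trans
        (≤-reflexive (cong length (trans (List.filter-++ inC? (D ∖ cs) zs)
          (trans (cong (filter inC? (D ∖ cs) ++_) (List.filter-none inC? (All.tabulate λ z∈ c → c (zs-next z∈)))) (List.++-identityʳ _)))))
        (unique-length-≤ (Unique.filter⁺ inC? (∖-Unique cs D-unique)) λ x∈ →
          let x∈′ , c = ∈-filter⁻ inC? {xs = D ∖ cs} x∈
              x∈D , x∉ = ∈-∖⁻ cs x∈′ in ∈-∖⁺ cs (∈-filter⁺ inC? x∈D c) x∉)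
      fewer : count-C L < count-C D
      fewer = ≤-trans (+-mono-≤ (≤-trans nonempty (≤-reflexive (sym (List.length-map proj₁ P)))) count-L)
        (length-∖ unique λ c∈ → let c∈D , inC = S-C (cs⊆S c∈) in ∈-filter⁺ inC? c∈D inC)
    ... | no ¬dom = u , p , p∈ , u~c , λ d → ¬d (Any.++⁺ʳ (D ∖ map proj₁ P) d)
      where
      undominated = Fin.¬∀⟶∃¬ n _ (dominates? G (D ∖ map proj₁ P ++ map proj₂ P)) ¬dom
      u = proj₁ undominated
      ¬d = proj₂ undominated
      found : ∃[ p ] (p ∈ P × Adj G u (proj₁ p))
      found with find (D-dominates u)
      ... | d , d∈ , t with d ∈? map proj₁ P
      ... | no d∉ = ⊥-elim (¬d (lose (∈-++⁺ˡ (∈-∖⁺ (map proj₁ P) d∈ d∉)) t))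
      ... | yes d∈cs with ∈-map⁻ proj₁ d∈cs
      ... | p , p∈ , refl = p , p∈ , touch-adj G t λ { refl →
              ¬d (lose (∈-++⁺ʳ (D ∖ map proj₁ P) (∈-map⁺ proj₂ p∈)) (inj₂ (proj₂ (All.lookup spokes p∈)))) }
      p = proj₁ found
      p∈ = proj₁ (proj₂ found)
      u~c = proj₂ (proj₂ found)

    split⇒unique : ∀ {P} → AllPairs Split P → Unique (map proj₁ P)
    split⇒unique = AllPairs.map⁺ ∘ AllPairs.map proj₁

    undominated-snd : ∀ {P : List (Fin n × Fin n)} {u} → ¬ Dominates G (map proj₂ P) u → ∀ {p} → p ∈ P → ¬ Touch G u (proj₂ p)
    undominated-snd ¬d p∈ t = ¬d (lose (∈-map⁺ proj₂ p∈) t)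

    -- Two disjoint independent systems of spokes of size j give one of size j + 1.
    spokes : ∀ j L → Unique L → (∀ {c} → c ∈ L → c ∈ S) → 2 ^ j ≤ length L →
             ∃[ P ] (length P ≡ suc j × All Spoke P × AllPairs Split P × (∀ {p} → p ∈ P → proj₁ p ∈ L))
    spokes zero    []      _ _   ()
    spokes zero    (c ∷ L) _ sub _ = (c , proj₁ (n-neighbour c)) ∷ [] , refl , (sub (here refl) , proj₂ (n-neighbour c)) ∷ [] ,
      [] ∷ [] , λ { (here refl) → here refl }
    spokes (suc j) L u sub l
      with spokes j (take (2 ^ j) L) (Unique.take⁺ (2 ^ j) u) (sub ∘ ∈-take (2 ^ j)) (≤-reflexive (sym (length-take-≤ (≤-trans (m≤m+n (2 ^ j) _) l))))
         | spokes j (drop (2 ^ j) L) (Unique.drop⁺ (2 ^ j) u) (sub ∘ ∈-drop (2 ^ j))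
             (≤-trans (≤-trans (≤-reflexive (sym (trans (cong (_∸ 2 ^ j) (+-comm (2 ^ j) (2 ^ j + 0))) (trans (m+n∸n≡m (2 ^ j + 0) (2 ^ j)) (+-identityʳ (2 ^ j)))))) (∸-monoˡ-≤ (2 ^ j) l))
               (≤-reflexive (sym (List.length-drop (2 ^ j) L))))
    ... | P , lP , sP , aP , inP | Q , lQ , sQ , aQ , inQ
      with exchange (P ++ Q) (subst (0 <_) (sym (trans (List.length-++ P) (cong (_+ length Q) lP))) (s≤s z≤n)) (All.++⁺ sP sQ)
             (subst Unique (sym (List.map-++ proj₁ P Q)) (Unique.++⁺ (split⇒unique aP) (split⇒unique aQ) apart))
      where
      apart : ∀ {c} → ¬ (c ∈ map proj₁ P × c ∈ map proj₁ Q)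
      apart (c∈ , c∈′) with ∈-map⁻ proj₁ c∈ | ∈-map⁻ proj₁ c∈′
      ... | p , p∈ , refl | q , q∈ , eq = take-drop-disjoint (2 ^ j) u (inP p∈) (subst (_∈ _) (sym eq) (inQ q∈))
    ... | w , p , p∈ , e , ¬d with ∈-++⁻ P p∈
    -- The undominated `w` becomes a new leaf for the centre of `p`. It is nonadjacent to all leaves
    -- of the system that does not contain `p`, so the new spoke joins that one.
    ... | inj₁ p∈P = (proj₁ p , w) ∷ Q , cong suc lQ , (proj₁ (All.lookup sP p∈P) , adj-sym G e) ∷ sQ ,
            All.tabulate (λ q∈ → (λ eq → take-drop-disjoint (2 ^ j) u (inP p∈P) (subst (_∈ _) (sym eq) (inQ q∈))) ,
                                 undominated-snd {P ++ Q} ¬d (∈-++⁺ʳ P q∈)) ∷ aQ ,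
            λ { (here refl) → ∈-take (2 ^ j) (inP p∈P) ; (there q∈) → ∈-drop (2 ^ j) (inQ q∈) }
    ... | inj₂ p∈Q = (proj₁ p , w) ∷ P , cong suc lP , (proj₁ (All.lookup sQ p∈Q) , adj-sym G e) ∷ sP ,
            All.tabulate (λ q∈ → (λ eq → take-drop-disjoint (2 ^ j) u (inP q∈) (subst (_∈ _) eq (inQ p∈Q))) ,
                                 undominated-snd {P ++ Q} ¬d (∈-++⁺ˡ q∈)) ∷ aP ,
            λ { (here refl) → ∈-drop (2 ^ j) (inQ p∈Q) ; (there q∈) → ∈-take (2 ^ j) (inP q∈) }

    -- Otherwise there are k + 1 independent spokes. One more exchange yields a second neighbour `u`
    -- of some centre `c`, and `u`, `c` and the old leaf of `c` form an induced P₃ beside the k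
    -- other spokes; centres do not interfere, being independent and without common neighbours.
    S-small : length S < 2 ^ k
    S-small with length S <? 2 ^ k
    ... | yes lt = lt
    ... | no ≮ with spokes k S (∖-Unique (W kept) X′-unique) id (≮⇒≥ ≮)
    ... | P , lP , sP , aP , _ with exchange P (subst (0 <_) (sym lP) (s≤s z≤n)) sP (split⇒unique aP)
    ... | u , (c , z) , p∈ , e , ¬d with AllPairs-extract split-sym aP p∈
    ... | Q , lQ , aQ , cQ , Q⊆ = ⊥-elim (P₃-matching e cz (undominated-snd {P} ¬d p∈) Q
            (≤-reflexive (suc-injective (trans (sym lP) lQ))) (All.map proj₂ sQ , AllPairs-with apart sQ aQ) off)
      where
      sQ : All Spoke Q
      sQ = All.tabulate (All.lookup sP ∘ Q⊆)
      c∈S : c ∈ S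
      c∈S = proj₁ (All.lookup sP p∈)
      cz : Adj G c z
      cz = proj₂ (All.lookup sP p∈)
      centre-off : ∀ {c c′ z′} → c ∈ S → c′ ∈ S → c ≢ c′ → Adj G c′ z′ → ¬ Hits G c (c′ , z′)
      centre-off p q c≢ f (inj₁ t) = A-outside (proj₂ (S-C p)) (proj₂ (S-C q)) (touch-adj G t c≢)
      centre-off p q c≢ f (inj₂ (inj₁ refl)) = proj₂ (S-C p) (next-C (proj₂ (S-C q)) f)
      centre-off p q c≢ f (inj₂ (inj₂ e)) = AllPairs-lookup noCommon-sym packed (proj₁ (S⊆ p)) (proj₁ (S⊆ q)) c≢ _ e f
      leaf-off : ∀ {c z c′ z′} → c ∈ S → Adj G c z → c′ ∈ S → c ≢ c′ → ¬ Touch G z z′ → ¬ Hits G z (c′ , z′)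
      leaf-off p e q c≢ ¬t (inj₂ t) = ¬t t
      leaf-off p e q c≢ ¬t (inj₁ (inj₁ refl)) = proj₂ (S-C q) (next-C (proj₂ (S-C p)) e)
      leaf-off p e q c≢ ¬t (inj₁ (inj₂ f)) =
        AllPairs-lookup noCommon-sym packed (proj₁ (S⊆ p)) (proj₁ (S⊆ q)) c≢ _ e (adj-sym G f)
      apart : ∀ {p q} → Spoke p → Spoke q → Split p q → Apart G p q
      apart (p , e) (q , f) (c≢ , ¬t) = centre-off p q c≢ f , leaf-off p e q c≢ ¬t
      off : ∀ {e} → e ∈ Q → ¬ Hits G u e × ¬ Hits G c e × ¬ Hits G z e
      off q∈ = let q , f = All.lookup sQ q∈
                   c≢ , ¬t = All.lookup cQ q∈ in
        leaf-off c∈S (adj-sym G e) q c≢ (undominated-snd {P} ¬d (Q⊆ q∈)) , centre-off c∈S q c≢ f , leaf-off c∈S cz q c≢ ¬t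

    -- Of the 6b, at most 4b vertices of `X′` were set aside as witnesses (2b for N[A] and one for
    -- each vertex of `R`), and `R` has at most 2b vertices.
    X-small : length X ≤ 2 ^ k + 6 * b
    X-small = begin
      length X                                     ≤⟨ unique-length-≤ {ys = X′ ++ R} (Unique.filter⁺ inC? D-unique) (λ x∈ → [ ∈-++⁺ˡ , ∈-++⁺ʳ X′ ]′ (cover x∈)) ⟩
      length (X′ ++ R)                             ≡⟨ List.length-++ X′ ⟩
      length X′ + length R                         ≤⟨ +-monoˡ-≤ (length R) (length-∖-≥ (W kept) X′-unique) ⟩
      length (W kept) + length S + length R        ≤⟨ +-mono-≤ (+-mono-≤ (≤-trans (W-size kept) (+-monoʳ-≤ (2 * b) R-size-≤)) (<⇒≤ S-small)) R-size-≤ ⟩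
      2 * b + 2 * b + 2 ^ k + 2 * b                ≡⟨ shuffle b (2 ^ k) ⟩
      2 ^ k + 6 * b                                ∎
      where
      open ≤-Reasoning
      shuffle : ∀ b p → 2 * b + 2 * b + p + 2 * b ≡ p + 6 * b
      shuffle = solve-∀

    witnesses : Witnesses (λ _ → ⊤) (2 ^ k + 8 * b)
    witnesses = witnesses-resp (λ {v} v∈ _ → split v∈)
      (≤-trans (+-monoʳ-≤ (2 * b) X-small) (≤-reflexive (shuffle b (2 ^ k))))
      (join-witnesses witness-A (witness-list X (proj₁ ∘ X⊆D)))
      where
      split : ∀ {v} → v ∈ D → Dominates G A v ⊎ v ∈ X
      split {v} v∈ with dominates? G A v
      ... | yes d = inj₁ d
      ... | no ¬d = inj₂ (∈-filter⁺ inC? v∈ ¬d)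
      shuffle : ∀ b p → 2 * b + (p + 6 * b) ≡ p + 8 * b
      shuffle = solve-∀

    around : Fin n → List (Fin n)
    around a = filter (λ v → touch? G v a) D

    crowded : ∀ m → 2 ^ k + 6 * b + b * m < length D → ∃[ a ] (m < length (around a))
    crowded m large with Any.any? (λ a → m <? length (around a)) A
    ... | yes any = let a , _ , p = find any in a , p
    ... | no ¬any = ⊥-elim (<⇒≱ large (≤-trans (unique-length-≤ {ys = X ++ gather A} D-unique split)
            (≤-trans (≤-reflexive (List.length-++ X)) (+-mono-≤ X-small (≤-trans (gather-length A (All.map ≮⇒≥ (All.¬Any⇒All¬ A ¬any))) (*-monoˡ-≤ m A-size))))))
      where
      gather : List (Fin n) → List (Fin n)
      gather []      = []
      gather (a ∷ A) = around a ++ gather A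
      gather-length : ∀ A → All (λ a → length (around a) ≤ m) A → length (gather A) ≤ length A * m
      gather-length []      []       = z≤n
      gather-length (a ∷ A) (p ∷ ps) = ≤-trans (≤-reflexive (List.length-++ (around a))) (+-mono-≤ p (gather-length A ps))
      gather∈ : ∀ {v} A → v ∈ D → Dominates G A v → v ∈ gather A
      gather∈ (a ∷ A) v∈ (here t)  = ∈-++⁺ˡ (∈-filter⁺ (λ v → touch? G v a) v∈ t)
      gather∈ (a ∷ A) v∈ (there d) = ∈-++⁺ʳ (around a) (gather∈ A v∈ d)
      split : ∀ {v} → v ∈ D → v ∈ X ++ gather A
      split {v} v∈ with dominates? G A v
      ... | yes d = ∈-++⁺ʳ X (gather∈ A v∈ d)
      ... | no ¬d = ∈-++⁺ˡ (∈-filter⁺ inC? v∈ ¬d)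

-- Private neighbours and the cliques around a crowded vertex

need : ℕ → ℕ
need zero    = 0
need (suc j) = suc j + need j

module Spread {n} (G : Graph n) {k γ} (irr : Irreducible G k γ)
  {D} (D-SD : SD G D) (D-length : length D ≤ γ) (D-unique : Unique D)
  {W} (W⊆D : ∀ {w} → w ∈ W → w ∈ D) (W-mates : ∀ {v} → v ∈ D → Mate G W v)
  {a Y} (Y-unique : Unique Y) (Y-spec : ∀ {y} → y ∈ Y → y ∈ D × y ∉ W × Adj G y a) (Y-large : 2 < length Y)
  {r₁ r₂ L} (r₁∈Y : r₁ ∈ Y) (r₂∈Y : r₂ ∈ Y) (r₁≢r₂ : r₁ ≢ r₂)
  (L-unique : Unique L) (L⊆Y : ∀ {y} → y ∈ L → y ∈ Y) (r₁∉L : r₁ ∉ L) (r₂∉L : r₂ ∉ L)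
  (L-large : need (4 * k + 8) ≤ length L) where

  open Irreducible irr

  D-dominates : ∀ v → Dominates G D v
  D-dominates = proj₁ D-SD

  Y⊆D : ∀ {y} → y ∈ Y → y ∈ D
  Y⊆D = proj₁ ∘ Y-spec

  Y~a : ∀ {y} → y ∈ Y → Adj G y a
  Y~a = proj₂ ∘ proj₂ ∘ Y-spec

  -- With a third vertex of `Y`, at distance two from `y` through `a`, the edge would form a
  -- friendly triple.
  Y-isolated : ∀ {y d} → y ∈ Y → d ∈ D → ¬ Adj G y d
  Y-isolated {y} {d} y∈ d∈ e = let y′ , y′∈ , y′∉ = fresh (y ∷ d ∷ []) Y-unique Y-large in
    unfriendly D-SD D-length d∈ (Y⊆D y∈) (Y⊆D y′∈) (adj-sym G e)
      (λ eq → y′∉ (there (here eq))) (λ eq → y′∉ (here eq)) (inj₂ (a , Y~a y∈ , adj-sym G (Y~a y′∈)))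

  record Uncovered (S zs : List (Fin n)) : Set where
    field
      {u y}     : Fin n
      y∈S       : y ∈ S
      u~y       : Adj G u y
      u-off-a   : ¬ Touch G u a
      u-off-zs  : ∀ {z} → z ∈ zs → ¬ Touch G u z
      u-off-D   : ∀ {d} → d ∈ D → d ∉ S → ¬ Touch G u d

  -- If D \ S ∪ {a} ∪ zs dominated G, it would be a semitotal dominating set of
  -- size at most |D| containing the friendly triple r₁, a, r₂.
  uncovered : ∀ S zs → Unique S → (∀ {y} → y ∈ S → y ∈ L) → length zs < length S →
              (∀ {z} → z ∈ zs → ∃[ w ] (w ∈ D × w ∉ S × w ≢ z × Near G z w)) → Uncovered S zs
  uncovered S zs S-unique S⊆L short near with Fin.all? (dominates? G (a ∷ zs ++ (D ∖ S)))
  ... | yes dom = ⊥-elim (unfriendly (dom , All.tabulate mated) L*-length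
          (there (∈-++⁺ʳ zs (keep r₁∈Y r₁∉L))) (here refl) (there (∈-++⁺ʳ zs (keep r₂∈Y r₂∉L)))
          (Y~a r₁∈Y) (r₁≢r₂ ∘ sym) (adj⇒≢ G (Y~a r₂∈Y)) (inj₁ (adj-sym G (Y~a r₂∈Y))))
    where
    keep : ∀ {r} → r ∈ Y → r ∉ L → r ∈ D ∖ S
    keep r∈ r∉ = ∈-∖⁺ S (Y⊆D r∈) (r∉ ∘ S⊆L)
    L*-length : length (a ∷ zs ++ (D ∖ S)) ≤ γ
    L*-length = ≤-trans (≤-reflexive (cong suc (List.length-++ zs)))
      (≤-trans (+-monoˡ-≤ (length (D ∖ S)) short) (≤-trans (length-∖ S-unique (Y⊆D ∘ L⊆Y ∘ S⊆L)) D-length))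
    mated : ∀ {v} → v ∈ a ∷ zs ++ (D ∖ S) → Mate G (a ∷ zs ++ (D ∖ S)) v
    mated (here refl) = there (Any.++⁺ʳ zs (lose (keep r₁∈Y r₁∉L) (adj⇒≢ G (Y~a r₁∈Y) , inj₁ (adj-sym G (Y~a r₁∈Y)))))
    mated (there v∈) with ∈-++⁻ zs v∈
    ... | inj₁ v∈zs = let w , w∈ , w∉ , p = near v∈zs in there (Any.++⁺ʳ zs (lose (∈-∖⁺ S w∈ w∉) p))
    ... | inj₂ v∈D = let w , w∈ , p = find (W-mates (proj₁ (∈-∖⁻ S v∈D))) in
      there (Any.++⁺ʳ zs (lose (∈-∖⁺ S (W⊆D w∈) λ w∈S → proj₁ (proj₂ (Y-spec (L⊆Y (S⊆L w∈S)))) w∈) p))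
  ... | no ¬dom with Fin.¬∀⟶∃¬ n _ (dominates? G (a ∷ zs ++ (D ∖ S))) ¬dom
  ... | u , ¬d with find (D-dominates u)
  ... | d , d∈ , t = record
    { y∈S = d∈S ; u~y = touch-adj G t λ { refl → ¬d (here (inj₂ (Y~a (L⊆Y (S⊆L d∈S))))) }
    ; u-off-a = ¬d ∘ here
    ; u-off-zs = λ z∈ t → ¬d (there (Any.++⁺ˡ (lose z∈ t)))
    ; u-off-D = off-D }
    where
    off-D : ∀ {d} → d ∈ D → d ∉ S → ¬ Touch G u d
    off-D d∈ d∉ t = ¬d (there (Any.++⁺ʳ zs (lose (∈-∖⁺ S d∈ d∉) t)))
    d∈S : d ∈ S
    d∈S = decidable-stable (d ∈? S) λ d∉ → off-D d∈ d∉ t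

  -- Not yet privacy: the neighbours of `p` in `D` are only confined to a block of `L`. Different
  -- edges get disjoint blocks, which gives `Separate`, and (P₃ + kP₂)-freeness then leaves `y` as
  -- the only such neighbour.
  PrivateIn : List (Fin n) → Fin n × Fin n → Set
  PrivateIn L′ (y , p) = y ∈ L′ × Adj G y p × ¬ Touch G p a × (∀ d → d ∈ D → Adj G p d → d ∈ L′)

  Separate : Fin n × Fin n → Fin n × Fin n → Set
  Separate (y , p) (y′ , p′) = y ≢ y′ × ¬ Touch G p p′ × (∀ d → d ∈ D → Adj G p d → ¬ Adj G p′ d)

  separate-sym : ∀ {e e′} → Separate e e′ → Separate e′ e
  separate-sym (y≢ , ¬t , s) = y≢ ∘ sym , ¬t ∘ touch-sym G , λ d d∈ f e → s d d∈ e f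

  -- Removing a block of j + 1 vertices pays for `a` and the private neighbours of the j edges found
  -- in the rest. The vertex left undominated has all its neighbours in `D` inside the block and
  -- touches none of the earlier ones. Blocks of sizes 1 up to j add up to `need j`.
  private-edges : ∀ j L′ → Unique L′ → (∀ {y} → y ∈ L′ → y ∈ L) → need j ≤ length L′ →
                  ∃[ E ] (length E ≡ j × All (PrivateIn L′) E × AllPairs Separate E)
  private-edges zero    L′ _ _   _ = [] , refl , [] , []
  private-edges (suc j) L′ u sub l with private-edges j (drop (suc j) L′) (Unique.drop⁺ (suc j) u) (sub ∘ ∈-drop (suc j))
      (≤-trans (≤-trans (≤-reflexive (sym (m+n∸m≡n (suc j) (need j)))) (∸-monoˡ-≤ (suc j) l)) (≤-reflexive (sym (List.length-drop (suc j) L′))))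
  ... | E , lE , inE , sepE = (y , w) ∷ E , cong suc lE ,
      (∈-take (suc j) y∈S , adj-sym G u~y , u-off-a , λ d d∈ f → ∈-take (suc j) (inside d∈ f)) ∷
        All.map (λ (p , q , r , s) → ∈-drop (suc j) p , q , r , λ d d∈ f → ∈-drop (suc j) (s d d∈ f)) inE ,
      All.tabulate (λ { {y′ , p′} e∈ → let y′∈ , y′p′ , _ , s = All.lookup inE e∈ in
        (λ { refl → take-drop-disjoint (suc j) u y∈S y′∈ }) , u-off-zs (∈-map⁺ proj₂ e∈) ,
        λ d d∈ f g → take-drop-disjoint (suc j) u (inside d∈ f) (s d d∈ g) }) ∷ sepE
    where
    S : List (Fin n)
    S = take (suc j) L′
    lS : length S ≡ suc j
    lS = length-take-≤ {xs = L′} (≤-trans (m≤m+n (suc j) (need j)) l)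
    un : Uncovered S (map proj₂ E)
    un = uncovered S (map proj₂ E) (Unique.take⁺ (suc j) u) (sub ∘ ∈-take (suc j))
      (≤-reflexive (trans (cong suc (trans (List.length-map proj₂ E) lE)) (sym lS)))
      λ z∈ → case ∈-map⁻ proj₂ z∈ of λ { ((y , p) , e∈ , refl) → let y∈ , yp , _ = All.lookup inE e∈ in
        y , Y⊆D (L⊆Y (sub (∈-drop (suc j) y∈))) , (λ y∈S → take-drop-disjoint (suc j) u y∈S y∈) , adj⇒≢ G yp , inj₁ (adj-sym G yp) }
    open Uncovered un renaming (u to w)
    inside : ∀ {d} → d ∈ D → Adj G w d → d ∈ S
    inside {d} d∈ f = decidable-stable (d ∈? S) λ d∉ → u-off-D d∈ d∉ (inj₂ f)

  -- 4k + 8 = (2k + 2) + (2k + 6): a high vertex can be nonadjacent to 2k + 2 of the `y`, and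
  -- `reach` asks for one more adjacent `y` than the 2k + 5 that may be forbidden. The other
  -- estimates are met as well.
  e-size : ℕ
  e-size = 4 * k + 8

  abstract
    built : ∃[ E ] (length E ≡ e-size × All (PrivateIn L) E × AllPairs Separate E)
    built = private-edges e-size L L-unique id L-large

  E : List (Fin n × Fin n)
  E = proj₁ built

  E-length : length E ≡ e-size
  E-length = proj₁ (proj₂ built)

  E∈ : ∀ {y p} → (y , p) ∈ E → y ∈ L × Adj G y p × ¬ Touch G p a
  E∈ e∈ = let y∈ , yp , off , _ = All.lookup (proj₁ (proj₂ (proj₂ built))) e∈ in y∈ , yp , off

  E⊆D : ∀ {y p} → (y , p) ∈ E → y ∈ D
  E⊆D e∈ = Y⊆D (L⊆Y (proj₁ (E∈ e∈)))

  E-isolated : ∀ {y p d} → (y , p) ∈ E → d ∈ D → ¬ Adj G y d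
  E-isolated e∈ = Y-isolated (L⊆Y (proj₁ (E∈ e∈)))

  p∉D : ∀ {y p} → (y , p) ∈ E → p ∉ D
  p∉D e∈ p∈ = E-isolated e∈ p∈ (proj₁ (proj₂ (E∈ e∈)))

  separate⇒apart : ∀ {e e′} → e ∈ E → e′ ∈ E → Separate e e′ → Apart G e e′
  separate⇒apart {y , p} {y′ , p′} e∈ e∈′ (y≢ , ¬t , s) = y-off , p-off
    where
    y-off : ¬ Hits G y (y′ , p′)
    y-off (inj₁ t) = E-isolated e∈ (E⊆D e∈′) (touch-adj G t y≢)
    y-off (inj₂ (inj₁ refl)) = p∉D e∈′ (E⊆D e∈)
    y-off (inj₂ (inj₂ f)) = s _ (E⊆D e∈) (adj-sym G (proj₁ (proj₂ (E∈ e∈)))) (adj-sym G f)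
    p-off : ¬ Hits G p (y′ , p′)
    p-off (inj₁ (inj₁ refl)) = p∉D e∈ (E⊆D e∈′)
    p-off (inj₁ (inj₂ f)) = s _ (E⊆D e∈′) f (adj-sym G (proj₁ (proj₂ (E∈ e∈′))))
    p-off (inj₂ t) = ¬t t

  E-apart : AllPairs (Apart G) E
  E-apart = AllPairs-with separate⇒apart (All.tabulate id) (proj₂ (proj₂ (proj₂ built)))

  E-edges : All (Edge G) E
  E-edges = All.tabulate λ e∈ → proj₁ (proj₂ (E∈ e∈))

  apart-irrefl : ∀ {e} → ¬ Apart G e e
  apart-irrefl (p , _) = p (inj₁ (inj₁ refl))

  k≤4k : ∀ c → k + c ≤ 4 * k + c
  k≤4k c = +-monoˡ-≤ c (m≤m+n k _)

  -- Otherwise `y`, `p`, `d` form an induced P₃. By `Separate` and the isolation of the `y`, it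
  -- touches no other edge of `E`, and at least k of these remain.
  private-neighbour : ∀ {y p d} → (y , p) ∈ E → d ∈ D → Adj G p d → d ≡ y
  private-neighbour {y} {p} {d} e∈ d∈ f with d Fin.≟ y
  ... | yes d≡y = d≡y
  ... | no  d≢y with AllPairs-extract {R = λ e e′ → Separate e e′} separate-sym (proj₂ (proj₂ (proj₂ built))) e∈
  ... | M , lM , sepM , sep , M⊆ = ⊥-elim (P₃-matching yp f (E-isolated e∈ d∈ ∘ λ t → touch-adj G t (d≢y ∘ sym)) M
          (≤-pred (≤-trans (≤-trans (≤-reflexive (+-comm 1 k)) (≤-trans (+-monoʳ-≤ k (s≤s z≤n)) (k≤4k 8))) (≤-reflexive (trans (sym E-length) lM))))
          (All.tabulate (All.lookup E-edges ∘ M⊆) , AllPairs-with separate⇒apart (All.tabulate M⊆) sepM) off)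
    where
    yp : Adj G y p
    yp = proj₁ (proj₂ (E∈ e∈))
    off : ∀ {e} → e ∈ M → ¬ Hits G y e × ¬ Hits G p e × ¬ Hits G d e
    off {y′ , p′} m∈ = let s = All.lookup sep m∈
                           y-off , p-off = separate⇒apart e∈ (M⊆ m∈) s in y-off , p-off , d-off p-off s
      where
      d-off : ¬ Hits G p (y′ , p′) → Separate (y , p) (y′ , p′) → ¬ Hits G d (y′ , p′)
      d-off p-off _ (inj₁ (inj₁ refl)) = p-off (inj₁ (inj₂ f))
      d-off _ _ (inj₁ (inj₂ g)) = E-isolated (M⊆ m∈) d∈ (adj-sym G g)
      d-off _ _ (inj₂ (inj₁ refl)) = p∉D (M⊆ m∈) d∈
      d-off _ (_ , _ , s) (inj₂ (inj₂ g)) = s _ d∈ f (adj-sym G g)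

  -- High vertices touch two of the edges in E; the low ones induce disjoint cliques.
  record High (v : Fin n) : Set where
    constructor mkHigh
    field two-hits : 2 ≤ length (filter (hits? G v) E)

  Low : Fin n → Set
  Low v = ¬ High v

  abstract
    high? : ∀ v → Dec (High v)
    high? v = Dec.map′ mkHigh High.two-hits (2 ≤? length (filter (hits? G v) E))

    low? : ∀ v → Dec (Low v)
    low? v = ¬? (high? v)

  record Fork (v : Fin n) : Set where
    field
      {e₁ e₂} : Fin n × Fin n
      e₁∈     : e₁ ∈ E
      e₂∈     : e₂ ∈ E
      apart   : Apart G e₁ e₂
      hits₁   : Hits G v e₁
      hits₂   : Hits G v e₂

  fork : ∀ {v} → High v → Fork v
  fork {v} (mkHigh two) with filter (hits? G v) E in eq | AllPairs.filter⁺ (hits? G v) E-apart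
  fork {v} (mkHigh (s≤s (s≤s _))) | e₁ ∷ e₂ ∷ _ | (apart ∷ _) ∷ _ =
    let p , h = ∈-filter⁻ (hits? G v) (subst (e₁ ∈_) (sym eq) (here refl))
        q , h′ = ∈-filter⁻ (hits? G v) (subst (e₂ ∈_) (sym eq) (there (here refl))) in
    record { e₁∈ = p ; e₂∈ = q ; apart = apart ; hits₁ = h ; hits₂ = h′ }

  _≟ₑ_ : (e e′ : Fin n × Fin n) → Dec (e ≡ e′)
  _≟ₑ_ = Product.≡-dec Fin._≟_ Fin._≟_

  end-low : ∀ {v e} → e ∈ E → End G v e → Low v
  end-low {v} {e} e∈ end high = apart-irrefl {e} (subst (Apart G e) e₂≡e (subst (λ f → Apart G f e₂) e₁≡e apart))
    where
    open Fork (fork high)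
    unique-hit : ∀ {e′} → e′ ∈ E → Hits G v e′ → e′ ≡ e
    unique-hit {e′} e′∈ h = decidable-stable (e′ ≟ₑ e) λ ≢ →
      end-apart G {e = e} {e′ = e′} end (AllPairs-lookup (λ {x} {y} → apart-sym G {x} {y}) E-apart e∈ e′∈ (≢ ∘ sym)) h
    e₁≡e = unique-hit e₁∈ hits₁
    e₂≡e = unique-hit e₂∈ hits₂

  -- An induced P₃ with centre `v` and low ends: each end interferes with only one low clique, so it
  -- excludes few matching edges.
  record Cherry (v : Fin n) : Set where
    field
      {q₁ q₂ e₁ e₂} : _
      e₁∈  : e₁ ∈ E
      e₂∈  : e₂ ∈ E
      end₁ : End G q₁ e₁
      end₂ : End G q₂ e₂
      vq₁  : Adj G v q₁
      vq₂  : Adj G v q₂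
      q₁q₂ : ¬ Touch G q₁ q₂

    q₁-low : Low q₁
    q₁-low = end-low e₁∈ end₁

    q₂-low : Low q₂
    q₂-low = end-low e₂∈ end₂

  hit-end : ∀ {v e} → Hits G v e → ∃[ q ] (End G q e × Touch G v q)
  hit-end (inj₁ t) = _ , inj₁ refl , t
  hit-end (inj₂ t) = _ , inj₂ refl , t

  cherry : ∀ {v} → High v → Cherry v
  cherry {v} high = let q₁ , end₁ , t₁ = hit-end hits₁
                        q₂ , end₂ , t₂ = hit-end hits₂ in record
    { e₁∈ = e₁∈ ; e₂∈ = e₂∈ ; end₁ = end₁ ; end₂ = end₂
    ; vq₁ = touch-adj G t₁ λ eq → end-low e₁∈ (subst (λ q → End G q e₁) (sym eq) end₁) high
    ; vq₂ = touch-adj G t₂ λ eq → end-low e₂∈ (subst (λ q → End G q e₂) (sym eq) end₂) high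
    ; q₁q₂ = λ t → end-apart G {e = e₁} {e′ = e₂} end₁ apart (end-hits G end₂ t) }
    where open Fork (fork high)

  missing : Fin n → List (Fin n × Fin n) → List (Fin n × Fin n)
  missing v = filter (¬? ∘ hits? G v)

  length-missing : ∀ v M → length (filter (hits? G v) M) ≤ 1 → length M ≤ suc (length (missing v M))
  length-missing v M l = ≤-trans (≤-reflexive (length-filter-split (hits? G v) M)) (+-monoˡ-≤ _ l)

  -- An induced P₃ of low vertices touches at most three edges of `E` and leaves k of them, a
  -- forbidden subgraph.
  low-trans : ∀ {x y z} → Low x → Low y → Low z → Touch G x y → Touch G y z → Touch G x z
  low-trans _ _ _ (inj₁ refl) t = t
  low-trans _ _ _ t (inj₁ refl) = t
  low-trans {x} {y} {z} lx ly lz (inj₂ e) (inj₂ f) = decidable-stable (touch? G x z) λ ¬t →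
    P₃-matching e f ¬t M long (All.tabulate (All.lookup E-edges ∘ proj₁ ∘ M∈) , AllPairs.filter⁺ _ (AllPairs.filter⁺ _ (AllPairs.filter⁺ _ E-apart)))
      (proj₂ ∘ M∈)
    where
    M : List (Fin n × Fin n)
    M = missing x (missing y (missing z E))
    M∈ : ∀ {e} → e ∈ M → e ∈ E × ¬ Hits G x e × ¬ Hits G y e × ¬ Hits G z e
    M∈ e∈ = let p , hx = ∈-filter⁻ (¬? ∘ hits? G x) {xs = missing y (missing z E)} e∈
                q , hy = ∈-filter⁻ (¬? ∘ hits? G y) {xs = missing z E} p
                r , hz = ∈-filter⁻ (¬? ∘ hits? G z) {xs = E} q in r , hx , hy , hz
    one : ∀ {v} → Low v → length (filter (hits? G v) E) ≤ 1
    one low = ≤-pred (≰⇒> (low ∘ mkHigh))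
    long : k ≤ length M
    long = ≤-pred (≤-pred (≤-pred (≤-trans (≤-trans (≤-reflexive (+-comm 3 k)) (≤-trans (+-monoʳ-≤ k (m≤m+n 3 5)) (k≤4k 8)))
      (≤-trans (≤-reflexive (sym E-length)) (≤-trans (length-missing z E (one lz)) (s≤s
        (≤-trans (length-missing y (missing z E) (≤-trans (length-filter-mono (hits? G y) (¬? ∘ hits? G z) E) (one ly))) (s≤s
          (length-missing x (missing y (missing z E)) (≤-trans (length-filter-mono (hits? G x) (¬? ∘ hits? G y) (missing z E)) (≤-trans (length-filter-mono (hits? G x) (¬? ∘ hits? G z) E) (one lx)))))))))))) 

  D-low : ∀ {d} → d ∈ D → Low d
  D-low {d} d∈ high = apart-≢ (trans (sym (is-y e₁∈ hits₁)) (is-y e₂∈ hits₂))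
    where
    open Fork (fork high)
    is-y : ∀ {y p} → (y , p) ∈ E → Hits G d (y , p) → d ≡ y
    is-y e∈ (inj₁ (inj₁ d≡y)) = d≡y
    is-y e∈ (inj₁ (inj₂ f)) = ⊥-elim (E-isolated e∈ d∈ (adj-sym G f))
    is-y e∈ (inj₂ (inj₁ refl)) = ⊥-elim (p∉D e∈ d∈)
    is-y e∈ (inj₂ (inj₂ f)) = private-neighbour e∈ d∈ (adj-sym G f)
    apart-≢ : proj₁ e₁ ≢ proj₁ e₂
    apart-≢ eq = proj₁ apart (inj₁ (inj₁ eq))

  -- The low clique of `d` contains an edge untouched by `t`, that is, one that can be matched
  -- beside a P₃ centred at `t`.
  record Missed (t d : Fin n) : Set where
    constructor missed
    field missed-edge : ∃[ x ] ∃[ x′ ] (Low x × Low x′ × Touch G x d × Touch G x′ d × Adj G x x′ × ¬ Touch G t x × ¬ Touch G t x′)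

  abstract
    missed? : ∀ t d → Dec (Missed t d)
    missed? t d = Dec.map′ missed Missed.missed-edge (Fin.any? λ x → Fin.any? λ x′ → low? x ×-dec low? x′ ×-dec
      touch? G x d ×-dec touch? G x′ d ×-dec adj? G x x′ ×-dec ¬? (touch? G t x) ×-dec ¬? (touch? G t x′))

  -- Of k + 2 missed edges in different cliques, each low end of a cherry at `t` touches at most
  -- one. The k others complete a forbidden subgraph.
  few-missed : ∀ {t} ds → High t → All Low ds → AllPairs (λ d d′ → ¬ Touch G d d′) ds → All (Missed t) ds → length ds ≤ suc k
  few-missed {t} ds high lows aparts misses with length ds ≤? suc k
  ... | yes l = l
  ... | no ≰ = ⊥-elim (P₃-matching (adj-sym G vq₁) vq₂ q₁q₂ M long
          (All.tabulate (λ e∈ → proj₁ (proj₂ (proj₂ (K-edge (proj₁ (M∈ e∈)))))) , AllPairs.filter⁺ _ (AllPairs.filter⁺ _ K-apart))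
          λ e∈ → let p , h₁ , h₂ = M∈ e∈ in h₁ , t-off (K-edge p) , h₂)
    where
    open Cherry (cherry high)
    Good-edge : Fin n × Fin n → Set
    Good-edge (x , x′) = Low x × Low x′ × Adj G x x′ × ¬ Touch G t x × ¬ Touch G t x′
    t-off : ∀ {e} → Good-edge e → ¬ Hits G t e
    t-off (_ , _ , _ , p , q) = [ p , q ]′
    edges : ∀ {ds} → All Low ds → AllPairs (λ d d′ → ¬ Touch G d d′) ds → All (Missed t) ds →
            ∃[ K ] (length K ≡ length ds × All Good-edge K × All (λ e → ∃[ d ] (d ∈ ds × Touch G (proj₁ e) d)) K ×
                    AllPairs (λ e e′ → ¬ Touch G (proj₁ e) (proj₁ e′)) K)
    edges [] [] [] = [] , refl , [] , [] , []
    edges {d ∷ ds} (l ∷ ls) (ap ∷ aps) (missed (x , x′ , lx , lx′ , xd , x′d , e , p , q) ∷ ms) with edges ls aps ms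
    ... | K , len , good , touches , sep = (x , x′) ∷ K , cong suc len , (lx , lx′ , e , p , q) ∷ good ,
        (d , here refl , xd) ∷ All.map (λ (d′ , d′∈ , t) → d′ , there d′∈ , t) touches ,
        All.zipWith (λ ((lz , _) , (d′ , d′∈ , zd′)) xz → All.lookup ap d′∈
          (low-trans l lx (All.lookup ls d′∈) (touch-sym G xd) (low-trans lx lz (All.lookup ls d′∈) xz zd′))) (good , touches) ∷ sep
    K = proj₁ (edges lows aparts misses)
    K-length = proj₁ (proj₂ (edges lows aparts misses))
    K-good = proj₁ (proj₂ (proj₂ (edges lows aparts misses)))
    K-sep = proj₂ (proj₂ (proj₂ (proj₂ (edges lows aparts misses))))
    K-edge : ∀ {e} → e ∈ K → Good-edge e
    K-edge = All.lookup K-good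
    same-clique : ∀ {v e} → Low v → Good-edge e → Hits G v e → Touch G v (proj₁ e)
    same-clique lv _ (inj₁ t) = t
    same-clique lv (lx , lx′ , e , _) (inj₂ t) = low-trans lv lx′ lx t (inj₂ (adj-sym G e))
    K-apart : AllPairs (Apart G) K
    K-apart = AllPairs-with (λ { {x , x′} {z , z′} gx gz ¬t →
      (λ h → ¬t (same-clique (proj₁ gx) gz h)) ,
      (λ h → ¬t (low-trans (proj₁ gx) (proj₁ (proj₂ gx)) (proj₁ gz) (inj₂ (proj₁ (proj₂ (proj₂ gx)))) (same-clique (proj₁ (proj₂ gx)) gz h))) })
      K-good K-sep
    one-hit : ∀ {q} → Low q → length (filter (hits? G q) K) ≤ 1
    one-hit lq = filter-≤1 (hits? G _) (AllPairs-with (λ gx gz ¬t h h′ →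
      ¬t (low-trans (proj₁ gx) lq (proj₁ gz) (touch-sym G (same-clique lq gx h)) (same-clique lq gz h′))) K-good K-sep)
    M : List (Fin n × Fin n)
    M = missing q₁ (missing q₂ K)
    M∈ : ∀ {e} → e ∈ M → e ∈ K × ¬ Hits G q₁ e × ¬ Hits G q₂ e
    M∈ e∈ = let p , h = ∈-filter⁻ (¬? ∘ hits? G q₁) {xs = missing q₂ K} e∈
                r , h′ = ∈-filter⁻ (¬? ∘ hits? G q₂) {xs = K} p in r , h , h′
    long : k ≤ length M
    long = ≤-pred (≤-pred (≤-trans (≰⇒> ≰) (≤-trans (≤-reflexive (sym K-length)) (≤-trans (length-missing q₂ K (one-hit q₂-low))
      (s≤s (length-missing q₁ (missing q₂ K) (≤-trans (length-filter-mono (hits? G q₁) (¬? ∘ hits? G q₂) K) (one-hit q₁-low))))))))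

  ys-apart : ∀ {M} → AllPairs (Apart G) M → AllPairs (λ y y′ → ¬ Touch G y y′) (map proj₁ M)
  ys-apart = AllPairs.map⁺ ∘ AllPairs.map (λ { (p , _) t → p (inj₁ t) })

  ys-unique : ∀ {M} → AllPairs (Apart G) M → Unique (map proj₁ M)
  ys-unique = AllPairs.map (λ ¬t eq → ¬t (inj₁ eq)) ∘ ys-apart

  ys-low : ∀ {M} → (∀ {e} → e ∈ M → e ∈ E) → All Low (map proj₁ M)
  ys-low sub = All.map⁺ (All.tabulate λ e∈ → end-low (sub e∈) (inj₁ refl))

  abstract
    few-off : ∀ {t} → High t → length (missing t E) ≤ suc k
    few-off {t} high = ≤-trans (≤-reflexive (sym (List.length-map proj₁ (missing t E))))
      (few-missed _ high (ys-low (proj₁ ∘ ∈-filter⁻ (¬? ∘ hits? G t) {xs = E})) (ys-apart (AllPairs.filter⁺ (¬? ∘ hits? G t) E-apart))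
        (All.map⁺ (All.tabulate λ e∈ → let e∈E , off = ∈-filter⁻ (¬? ∘ hits? G t) {xs = E} e∈ in
          missed (_ , _ , end-low e∈E (inj₁ refl) , end-low e∈E (inj₂ refl) , inj₁ refl , inj₂ (adj-sym G (All.lookup E-edges e∈E)) ,
            All.lookup E-edges e∈E , off ∘ inj₁ , off ∘ inj₂))))

  linear : ∀ a a′ c c′ → a ≤ a′ → c ≤ c′ → a * k + c ≤ a′ * k + c′
  linear a a′ c c′ p q = +-mono-≤ (*-monoˡ-≤ k p) q

  away-from : ∀ ys → length ys ≤ k + 2 → let rest = filter (λ e → ¬? (proj₁ e ∈? ys)) E in k + 2 ≤ length rest
  away-from ys l = +-cancelˡ-≤ (k + 2) _ _ (begin
    (k + 2) + (k + 2)                                                 ≡⟨ shuffle k ⟩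
    2 * k + 4                                                         ≤⟨ linear 2 4 4 8 (m≤m+n 2 2) (m≤m+n 4 4) ⟩
    e-size                                                            ≡⟨ E-length ⟨
    length E                                                          ≡⟨ length-filter-split in? E ⟩
    length (filter in? E) + length (filter (¬? ∘ in?) E)              ≤⟨ +-monoˡ-≤ _ inside ⟩
    (k + 2) + length (filter (¬? ∘ in?) E)                            ∎)
    where
    open ≤-Reasoning
    shuffle : ∀ k → (k + 2) + (k + 2) ≡ 2 * k + 4
    shuffle = solve-∀
    in? : ∀ e → Dec (proj₁ e ∈ ys)
    in? e = proj₁ e ∈? ys
    inside : length (filter in? E) ≤ k + 2
    inside = ≤-trans (≤-reflexive (sym (List.length-map proj₁ (filter in? E))))
      (≤-trans (unique-length-≤ {ys = ys} (ys-unique (AllPairs.filter⁺ in? E-apart))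
        λ y∈ → case ∈-map⁻ proj₁ y∈ of λ { (e , e∈ , refl) → proj₂ (∈-filter⁻ in? {xs = E} e∈) }) l)

  -- Otherwise S can be exchanged against a, t and k of the private neighbours.
  missed-among : ∀ {t} S → High t → AllPairs (Apart G) S → (∀ {e} → e ∈ S → e ∈ E × ¬ Adj G t (proj₁ e)) →
                 length S ≡ k + 2 → ∃[ e ] (e ∈ S × Missed t (proj₁ e))
  missed-among {t} S high apartS S⊆ lS = conclude (∈-map⁻ proj₁ y∈S)
    where
    ys = map proj₁ S
    lys : length ys ≡ k + 2
    lys = trans (List.length-map proj₁ S) lS
    rest = filter (λ e → ¬? (proj₁ e ∈? ys)) E
    rest∈ : ∀ {e} → e ∈ rest → e ∈ E × proj₁ e ∉ ys
    rest∈ = ∈-filter⁻ (λ e → ¬? (proj₁ e ∈? ys)) {xs = E}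
    M = take k rest
    lrest : k + 2 ≤ length rest
    lrest = away-from ys (≤-reflexive lys)
    lM : length M ≡ k
    lM = length-take-≤ {xs = rest} (≤-trans (m≤m+n k 2) lrest)
    hit : ∃[ e ] (e ∈ rest × Hits G t e)
    hit with Any.any? (hits? G t) rest
    ... | yes any = find any
    -- At least k + 2 edges remain, while `t` leaves at most k + 1 edges of `E` untouched.
    ... | no ¬any = ⊥-elim (<⇒≱ (≤-trans (≤-reflexive (+-comm 2 k)) lrest)
            (≤-trans (≤-reflexive (cong length (sym (List.filter-all (¬? ∘ hits? G t) (All.¬Any⇒All¬ rest ¬any)))))
              (≤-trans (length-filter-mono (¬? ∘ hits? G t) (λ e → ¬? (proj₁ e ∈? ys)) E) (few-off high))))
    near : ∀ {z} → z ∈ t ∷ map proj₂ M → ∃[ w ] (w ∈ D × w ∉ ys × w ≢ z × Near G z w)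
    near (here refl) with hit
    ... | (y , p) , e∈ , h = let e∈E , y∉ = rest∈ e∈ in y , E⊆D e∈E , y∉ , (λ eq → D-low (E⊆D e∈E) (subst High (sym eq) high)) , close e∈E h
      where
      close : ∀ {y p} → (y , p) ∈ E → Hits G t (y , p) → Near G t y
      close e∈ (inj₁ t) = inj₁ (touch-adj G t λ { refl → end-low e∈ (inj₁ refl) high })
      close e∈ (inj₂ t) = inj₂ (_ , touch-adj G t (λ { refl → end-low e∈ (inj₂ refl) high }) , adj-sym G (All.lookup E-edges e∈))
    near (there z∈) with ∈-map⁻ proj₂ z∈
    ... | (y , p) , e∈ , refl = let e∈E , y∉ = rest∈ (∈-take k e∈)
                                    yp = All.lookup E-edges e∈E in y , E⊆D e∈E , y∉ , adj⇒≢ G yp , inj₁ (adj-sym G yp)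
    un : Uncovered ys (t ∷ map proj₂ M)
    un = uncovered ys _ (ys-unique apartS) (λ y∈ → case ∈-map⁻ proj₁ y∈ of λ { (e , e∈ , refl) → proj₁ (E∈ (proj₁ (S⊆ e∈))) })
      (≤-reflexive (trans (cong (2 +_) (trans (List.length-map proj₂ M) lM)) (trans (+-comm 2 k) (sym lys)))) near
    open Uncovered un
    u-off-M : ∀ {e} → e ∈ M → ¬ Hits G u e
    u-off-M e∈ (inj₁ t) = let e∈E , y∉ = rest∈ (∈-take k e∈) in u-off-D (E⊆D e∈E) y∉ t
    u-off-M e∈ (inj₂ t) = u-off-zs (there (∈-map⁺ proj₂ e∈)) t
    u-low : Low u
    -- The k edges of `M` are untouched by `u`, so a cherry at a high `u` together with `M` would be
    -- forbidden: its ends belong to edges of `E` that `u` touches and hence not to `M`.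
    u-low high-u = P₃-matching (adj-sym G vq₁) vq₂ q₁q₂ M (≤-reflexive (sym lM))
      (All.tabulate (λ e∈ → All.lookup E-edges (M∈E e∈)) , AllPairs.take⁺ k (AllPairs.filter⁺ (λ e → ¬? (proj₁ e ∈? ys)) E-apart))
      λ e∈ → end-off e₁∈ end₁ vq₁ e∈ , u-off-M e∈ , end-off e₂∈ end₂ vq₂ e∈
      where
      open Cherry (cherry high-u)
      M∈E : ∀ {e} → e ∈ M → e ∈ E
      M∈E e∈ = proj₁ (rest∈ (∈-take k e∈))
      end-off : ∀ {q e m} → e ∈ E → End G q e → Adj G u q → m ∈ M → ¬ Hits G q m
      end-off {e = e} {m} e∈ end uq m∈ = end-apart G {e = e} {e′ = m} end
        (AllPairs-lookup (λ {x} {y} → apart-sym G {x} {y}) E-apart e∈ (M∈E m∈) λ { refl → u-off-M m∈ (end-hits G end (inj₂ uq)) })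
    conclude : ∃[ e ] (e ∈ S × y ≡ proj₁ e) → ∃[ e ] (e ∈ S × Missed t (proj₁ e))
    conclude (e , e∈ , y≡) = e , e∈ , missed (u , proj₁ e , u-low , y-low , inj₂ u~y′ , inj₁ refl , u~y′ ,
      u-off-zs (here refl) ∘ touch-sym G ,
      λ touch → proj₂ (S⊆ e∈) (touch-adj G touch λ eq → y-low (subst High eq high)))
      where
      y-low : Low (proj₁ e)
      y-low = end-low (proj₁ (S⊆ e∈)) (inj₁ refl)
      u~y′ : Adj G u (proj₁ e)
      u~y′ = subst (Adj G u) y≡ u~y

  -- Among the nonadjacent `y` at most k + 1 are missed by `t`, and any k + 2 contain a missed one
  -- by `missed-among`, so at most k + 1 are not missed.
  few-nonadjacent : ∀ {t} → High t → length (filter (λ e → ¬? (adj? G t (proj₁ e))) E) ≤ 2 * k + 2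
  few-nonadjacent {t} high with length (filter (λ e → ¬? (adj? G t (proj₁ e))) E) ≤? 2 * k + 2
  ... | yes l = l
  ... | no ≰ = ⊥-elim (let e , e∈ , m = missed-among S high (AllPairs.take⁺ (k + 2) (AllPairs.filter⁺ (¬? ∘ P?) (AllPairs.filter⁺ far? E-apart)))
                             (λ e∈ → B∈ (proj₁ (C∈ (∈-take (k + 2) e∈)))) (length-take-≤ {xs = C} C-large)
                       in proj₂ (C∈ (∈-take (k + 2) e∈)) m)
    where
    far? : ∀ e → Dec (¬ Adj G t (proj₁ e))
    far? e = ¬? (adj? G t (proj₁ e))
    P? : ∀ e → Dec (Missed t (proj₁ e))
    P? e = missed? t (proj₁ e)
    B C S : List (Fin n × Fin n)
    B = filter far? E
    C = filter (¬? ∘ P?) B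
    S = take (k + 2) C
    B∈ : ∀ {e} → e ∈ B → e ∈ E × ¬ Adj G t (proj₁ e)
    B∈ = ∈-filter⁻ far? {xs = E}
    C∈ : ∀ {e} → e ∈ C → e ∈ B × ¬ Missed t (proj₁ e)
    C∈ = ∈-filter⁻ (¬? ∘ P?) {xs = B}
    few : length (filter P? B) ≤ suc k
    few = ≤-trans (≤-reflexive (sym (List.length-map proj₁ (filter P? B))))
      (few-missed _ high (ys-low (proj₁ ∘ B∈ ∘ proj₁ ∘ ∈-filter⁻ P? {xs = B}))
        (ys-apart (AllPairs.filter⁺ P? (AllPairs.filter⁺ far? E-apart)))
        (All.map⁺ (All.tabulate λ e∈ → proj₂ (∈-filter⁻ P? {xs = B} e∈))))
    C-large : k + 2 ≤ length C
    C-large = +-cancelˡ-≤ (suc k) _ _ (≤-trans (≤-reflexive (shuffle k)) (≤-trans (≰⇒> ≰)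
      (≤-trans (≤-reflexive (length-filter-split P? B)) (+-monoˡ-≤ (length C) few))))
      where
      shuffle : ∀ k → suc k + (k + 2) ≡ suc (2 * k + 2)
      shuffle = solve-∀

  reach : ∀ {t} → High t → ∀ Ls → length Ls ≤ 2 * k + 5 → ∃[ y ] (y ∈ D × y ∉ Ls × Adj G t y)
  reach {t} high Ls l = found (fresh Ls (ys-unique (AllPairs.filter⁺ near? E-apart)) large)
    where
    near? : ∀ e → Dec (Adj G t (proj₁ e))
    near? e = adj? G t (proj₁ e)
    large : length Ls < length (map proj₁ (filter near? E))
    large = +-cancelʳ-≤ (2 * k + 2) _ _ (begin
      suc (length Ls) + (2 * k + 2)                                ≤⟨ +-monoˡ-≤ (2 * k + 2) (s≤s l) ⟩
      suc (2 * k + 5) + (2 * k + 2)                                ≡⟨ shuffle k ⟩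
      e-size                                                       ≡⟨ E-length ⟨
      length E                                                     ≡⟨ length-filter-split near? E ⟩
      length (filter near? E) + length (filter (¬? ∘ near?) E)     ≤⟨ +-mono-≤ (≤-reflexive (sym (List.length-map proj₁ (filter near? E)))) (few-nonadjacent high) ⟩
      length (map proj₁ (filter near? E)) + (2 * k + 2)            ∎)
      where
      open ≤-Reasoning
      shuffle : ∀ k → suc (2 * k + 5) + (2 * k + 2) ≡ 4 * k + 8
      shuffle = solve-∀
    found : ∃[ y ] (y ∈ map proj₁ (filter near? E) × y ∉ Ls) → ∃[ y ] (y ∈ D × y ∉ Ls × Adj G t y)
    found (y , y∈ , y∉) =
      let e , e∈ , y≡ = ∈-map⁻ proj₁ y∈
          e∈E , ty = ∈-filter⁻ near? {xs = E} e∈ in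
      y , subst (_∈ D) (sym y≡) (E⊆D e∈E) , y∉ , subst (Adj G t) (sym y≡) ty

  a-high : High a
  a-high = mkHigh (subst (λ M → 2 ≤ length M) (sym (List.filter-all (hits? G a) (All.tabulate λ e∈ → inj₁ (inj₂ (adj-sym G (Y~a (L⊆Y (proj₁ (E∈ e∈)))))))))
    (≤-trans (m≤n+m 2 (4 * k + 6)) (≤-reflexive (trans (+-assoc (4 * k) 6 2) (sym E-length)))))

  high≢low : ∀ {t x} → High t → Low x → t ≢ x
  high≢low high low eq = low (subst High eq high)

  -- One vertex of D in each clique

  HasHigh : Fin n → Set
  HasHigh v = ∃[ t ] (High t × Adj G v t)

  abstract
    hasHigh? : ∀ v → Dec (HasHigh v)
    hasHigh? v = Fin.any? λ t → high? t ×-dec adj? G v t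

  abstract
    -- Along a walk to the high vertex `a`, all vertices before the first high one lie in the clique
    -- of the start.
    clique-exit : ∀ {x} → Low x → ∃[ x′ ] (Low x′ × Touch G x x′ × HasHigh x′)
    clique-exit {x} low = go (proj₂ (conn x a)) low
      where
      go : ∀ {ℓ x} → Walk G ℓ x a → Low x → ∃[ x′ ] (Low x′ × Touch G x x′ × HasHigh x′)
      go here low = ⊥-elim (low a-high)
      go {x = x} (step {v = v} e rest) low with high? v
      ... | yes high = x , low , inj₁ refl , v , high , e
      ... | no low-v = let x′ , low′ , t , h = go rest low-v in x′ , low′ , low-trans low low-v low′ (inj₂ e) t , h

  abstract
    hasHigh-near : ∀ {v} → HasHigh v → ∀ Ls → length Ls ≤ 2 * k + 4 → ∃[ y ] (y ∈ D × y ∉ Ls × y ≢ v × Near G v y)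
    hasHigh-near {v} (t , high , e) Ls l =
      let y , y∈ , y∉ , ty = reach high (v ∷ Ls) (≤-trans (s≤s l) (≤-reflexive (sym (+-suc (2 * k) 4)))) in
      y , y∈ , y∉ ∘ there , y∉ ∘ here , inj₂ (t , e , ty)

  abstract
    D-no-adjacent-high : ∀ {v w} → v ∈ D → w ∈ D → Adj G v w → ¬ HasHigh v
    D-no-adjacent-high {v} {w} v∈ w∈ e h =
      let y , y∈ , y∉ , y≢v , near = hasHigh-near h (w ∷ []) (≤-trans (s≤s z≤n) (m≤n+m 4 (2 * k))) in
      unfriendly D-SD D-length w∈ v∈ y∈ (adj-sym G e) (y∉ ∘ here) y≢v near

  low-neighbour : ∀ {v x} → ¬ HasHigh v → Adj G v x → Low x
  low-neighbour ¬h e high = ¬h (_ , high , e)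

  -- Two adjacent vertices of D in one clique could be replaced by a single vertex of
  -- the clique that has a high neighbour.
  D-independent : ∀ {v w} → v ∈ D → w ∈ D → ¬ Adj G v w
  D-independent {v} {w} v∈ w∈ e with clique-exit (D-low v∈)
  ... | x , low-x , vx , h = <⇒≱ shorter (minimum (dominated , All.tabulate mated))
    where
    vw L′ : List (Fin n)
    vw = v ∷ w ∷ []
    L′ = x ∷ (D ∖ vw)
    ¬hv : ¬ HasHigh v
    ¬hv = D-no-adjacent-high v∈ w∈ e
    ¬hw : ¬ HasHigh w
    ¬hw = D-no-adjacent-high w∈ v∈ (adj-sym G e)
    shorter : length L′ < γ
    shorter = ≤-trans (length-∖ {S = vw} ((adj⇒≢ G e ∷ []) ∷ [] ∷ []) λ { (here refl) → v∈ ; (there (here refl)) → w∈ }) D-length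
    in-clique : ∀ {u d} → d ∈ vw → Low u → Touch G u d → Touch G u x
    in-clique (here refl) low t = low-trans low (D-low v∈) low-x t vx
    in-clique (there (here refl)) low t = low-trans low (D-low w∈) low-x t (low-trans (D-low w∈) (D-low v∈) low-x (inj₂ (adj-sym G e)) vx)
    touching-low : ∀ {u d} → d ∈ vw → Touch G u d → Low u
    touching-low (here refl) (inj₁ refl) = D-low v∈
    touching-low (there (here refl)) (inj₁ refl) = D-low w∈
    touching-low (here refl) (inj₂ f) = low-neighbour ¬hv (adj-sym G f)
    touching-low (there (here refl)) (inj₂ f) = low-neighbour ¬hw (adj-sym G f)
    dominated : ∀ u → Dominates G L′ u
    dominated u with find (D-dominates u)
    ... | d , d∈ , t with d ∈? vw
    ... | no d∉  = there (lose (∈-∖⁺ vw d∈ d∉) t)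
    ... | yes d∈vw = here (in-clique d∈vw (touching-low d∈vw t) t)
    x-mate : Mate G L′ x
    x-mate = let y , y∈ , y∉ , p = hasHigh-near h vw (≤-trans (m≤m+n 2 2) (m≤n+m 4 (2 * k))) in there (lose (∈-∖⁺ vw y∈ y∉) p)
    mated : ∀ {m} → m ∈ L′ → Mate G L′ m
    mated (here refl) = x-mate
    mated {m} (there m∈) with find (All.lookup (proj₂ D-SD) (proj₁ (∈-∖⁻ vw {D} m∈)))
    ... | d , d∈ , d≢m , near with d ∈? vw
    ... | no d∉ = there (lose (∈-∖⁺ vw d∈ d∉) (d≢m , near))
    ... | yes d∈vw with m Fin.≟ x
    ... | yes refl = x-mate
    ... | no m≢x = here (m≢x ∘ sym , inj₁ (touch-adj G (in-clique d∈vw low-m (touches near)) m≢x))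
      where
      low-m : Low m
      low-m = D-low (proj₁ (∈-∖⁻ vw {D} m∈))
      low-d : Low d
      low-d = D-low d∈
      touches : Near G m d → Touch G m d
      touches (inj₁ f) = inj₂ f
      touches (inj₂ (z , f , g)) = low-trans low-m (touching-low d∈vw (inj₂ g)) low-d (inj₂ f) (inj₂ g)

  D-apart : ∀ {d d′} → d ∈ D → d′ ∈ D → d ≢ d′ → ¬ Touch G d d′
  D-apart d∈ d′∈ d≢ t = D-independent d∈ d′∈ (touch-adj G t d≢)

  abstract
    -- Without a high neighbour, the path from `d` to its mate has only low vertices and stays in
    -- one clique, where `d` is the only vertex of `D`.
    D-hasHigh : ∀ {d} → d ∈ D → HasHigh d
    D-hasHigh {d} d∈ = decidable-stable (hasHigh? d) λ ¬h → contra ¬h (find (All.lookup (proj₂ D-SD) d∈))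
      where
      contra : ¬ HasHigh d → ∃[ w ] (w ∈ D × w ≢ d × Near G d w) → ⊥
      contra ¬h (w , w∈ , w≢d , inj₁ e) = D-independent d∈ w∈ e
      contra ¬h (w , w∈ , w≢d , inj₂ (x , e , f)) = D-apart d∈ w∈ (w≢d ∘ sym)
        (low-trans (D-low d∈) (low-neighbour ¬h e) (D-low w∈) (inj₂ e) (inj₂ f))

  abstract
    representative : ∀ {r} → Low r → ∃[ d ] (d ∈ D × Touch G r d)
    representative {r} low = find (D-dominates r)

  -- Exchanging `S` for `zs` would give a semitotal dominating set of size at most γ with a friendly
  -- triple: the high member of `zs` between two neighbours in `D`. The bound on `S` lets `reach`
  -- find retained neighbours of every high vertex; these dominate the high vertices and provide all
  -- mates.
  no-cheaper : ∀ S zs → Unique S → (∀ {d} → d ∈ S → d ∈ D) → length S ≤ 2 * k + 3 → length zs ≤ length S →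
               (∀ {z} → z ∈ zs → High z ⊎ z ∈ D) → Any High zs →
               ¬ (∀ {d u} → d ∈ S → Low u → Touch G u d → Dominates G zs u)
  no-cheaper S zs S-unique S⊆D lS lzs kinds anyHigh covers =
    let t , t∈ , high = find anyHigh
        y₁ , y₁∈ , y₁∉ , ty₁ = reach high S (≤-trans lS4 (+-monoʳ-≤ (2 * k) (n≤1+n 4)))
        y₂ , y₂∈ , y₂∉ , ty₂ = reach high (y₁ ∷ S) (≤-trans (s≤s lS4) (≤-reflexive (sym (+-suc (2 * k) 4))))
    in unfriendly (dominated , All.tabulate mated) L*-length
         (∈-++⁺ʳ zs (∈-∖⁺ S y₁∈ y₁∉)) (∈-++⁺ˡ t∈) (∈-++⁺ʳ zs (∈-∖⁺ S y₂∈ (y₂∉ ∘ there)))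
         (adj-sym G ty₁) (y₂∉ ∘ here) (adj⇒≢ G (adj-sym G ty₂)) (inj₁ ty₂)
    where
    L* : List (Fin n)
    L* = zs ++ (D ∖ S)
    L*-length : length L* ≤ γ
    L*-length = ≤-trans (≤-reflexive (List.length-++ zs)) (≤-trans (+-monoˡ-≤ _ lzs) (≤-trans (length-∖ S-unique S⊆D) D-length))
    lS4 : length S ≤ 2 * k + 4
    lS4 = ≤-trans lS (+-monoʳ-≤ (2 * k) (n≤1+n 3))
    high-near : ∀ {v} → High v → ∃[ y ] (y ∈ D × y ∉ S × y ≢ v × Near G v y)
    high-near {v} h = let y , y∈ , y∉ , vy = reach h S (≤-trans lS4 (+-monoʳ-≤ (2 * k) (n≤1+n 4))) in
      y , y∈ , y∉ , adj⇒≢ G (adj-sym G vy) , inj₁ vy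
    mate : ∀ {v} → ∃[ y ] (y ∈ D × y ∉ S × y ≢ v × Near G v y) → Mate G L* v
    mate (y , y∈ , y∉ , p) = lose (∈-++⁺ʳ zs (∈-∖⁺ S y∈ y∉)) p
    mated : ∀ {v} → v ∈ L* → Mate G L* v
    mated v∈ with ∈-++⁻ zs v∈
    ... | inj₂ v∈D = mate (hasHigh-near (D-hasHigh (proj₁ (∈-∖⁻ S v∈D))) S lS4)
    ... | inj₁ v∈zs with kinds v∈zs
    ... | inj₁ h  = mate (high-near h)
    ... | inj₂ v∈D = mate (hasHigh-near (D-hasHigh v∈D) S lS4)
    dominated : ∀ u → Dominates G L* u
    dominated u with high? u
    ... | yes h = let y , y∈ , y∉ , uy = reach h S (≤-trans lS4 (+-monoʳ-≤ (2 * k) (n≤1+n 4))) in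
                  lose (∈-++⁺ʳ zs (∈-∖⁺ S y∈ y∉)) (inj₂ uy)
    ... | no low with representative low
    ... | d , d∈ , touch with d ∈? S
    ... | yes d∈S = Any.++⁺ˡ (covers d∈S low touch)
    ... | no  d∉S = lose (∈-++⁺ʳ zs (∈-∖⁺ S d∈ d∉S)) touch

  D-aparts : AllPairs (λ d d′ → ¬ Touch G d d′) D
  D-aparts = AllPairs-with (λ d∈ d′∈ → D-apart d∈ d′∈) (All.tabulate id) D-unique

  abstract
    few-missed-D : ∀ {t M} → High t → Unique M → (∀ {d} → d ∈ M → d ∈ D) → length (filter (missed? t) M) ≤ suc k
    few-missed-D {t} {M} high u sub = few-missed (filter (missed? t) M) high (All.tabulate (D-low ∘ in-D))
      (AllPairs-with (λ d∈ d′∈ → D-apart d∈ d′∈) (All.tabulate in-D) (Unique.filter⁺ (missed? t) u))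
      (All.tabulate λ d∈ → proj₂ (∈-filter⁻ (missed? t) {xs = M} d∈))
      where
      in-D : ∀ {d} → d ∈ filter (missed? t) M → d ∈ D
      in-D d∈ = sub (proj₁ (∈-filter⁻ (missed? t) {xs = M} d∈))

  -- All neighbours of such an `m` are low, so they lie in its clique and `m` is simplicial: this is
  -- the first-order trace of the clique of `d`.
  Unexited : Fin n → Set
  Unexited d = ∃[ m ] (Low m × Touch G m d × ¬ HasHigh m)

  abstract
    unexited? : ∀ d → Dec (Unexited d)
    unexited? d = Fin.any? λ m → low? m ×-dec touch? G m d ×-dec ¬? (hasHigh? m)

  abstract
    -- If `t` touched the whole clique, `d` could be exchanged for `t`.
    untouched : ∀ {t d} → High t → d ∈ D → ∃[ p ] (Low p × Touch G p d × ¬ Touch G p t)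
    untouched {t} {d} high d∈ = decidable-stable (Fin.any? λ p → low? p ×-dec touch? G p d ×-dec ¬? (touch? G p t)) λ none →
      no-cheaper (d ∷ []) (t ∷ []) ([] ∷ []) (λ { (here refl) → d∈ }) (≤-trans (s≤s z≤n) (m≤n+m 3 (2 * k))) ≤-refl
        (λ { (here refl) → inj₁ high }) (here high)
        λ { {u = u} (here refl) low touch → here (decidable-stable (touch? G u t) λ ¬t → none (u , low , touch , ¬t)) }

  -- d, the only vertex p in the clique of d that a does not touch, and a high neighbour t of p.
  record Guarded (τ : Fin n × Fin n × Fin n) : Set where
    field
      d∈    : proj₁ τ ∈ D
      p-low : Low (proj₁ (proj₂ τ))
      pd    : Touch G (proj₁ (proj₂ τ)) (proj₁ τ)
      only  : ∀ {u} → Low u → Touch G u (proj₁ τ) → Touch G u a ⊎ u ≡ proj₁ (proj₂ τ)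
      high  : High (proj₂ (proj₂ τ))
      pt    : Adj G (proj₁ (proj₂ τ)) (proj₂ (proj₂ τ))

  -- Some vertex of the clique is untouched by `a`, and two of them would span a missed edge. That
  -- vertex has a high neighbour because `d` is not `Unexited`.
  guard : ∀ {d} → d ∈ D → ¬ Missed a d → ¬ Unexited d → ∃[ p ] ∃[ t ] Guarded (d , p , t)
  guard {d} d∈ ¬missed ¬un =
    let p , low , pd , ¬pa = untouched a-high d∈
        t , high , pt = decidable-stable (hasHigh? p) λ ¬h → ¬un (p , low , pd , ¬h)
    in p , t , record { d∈ = d∈ ; p-low = low ; pd = pd ; only = only low pd ¬pa ; high = high ; pt = pt }
    where
    only : ∀ {p u} → Low p → Touch G p d → ¬ Touch G p a → Low u → Touch G u d → Touch G u a ⊎ u ≡ p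
    only {p} {u} low pd ¬pa low-u ud with touch? G u a | u Fin.≟ p
    ... | yes ua | _ = inj₁ ua
    ... | no _ | yes u≡p = inj₂ u≡p
    ... | no ¬ua | no u≢p = ⊥-elim (¬missed (missed (u , p , low-u , low , ud , pd ,
      touch-adj G (low-trans low-u (D-low d∈) low ud (touch-sym G pd)) u≢p , ¬ua ∘ touch-sym G , ¬pa ∘ touch-sym G)))

  abstract
    -- In the two cliques `a` touches everything but `p` and `p′`. If `t′` touched both, the two
    -- vertices of `D` could be exchanged for `a` and `t′`.
    one-guard : ∀ {d p t d′ p′ t′} → Guarded (d , p , t) → Guarded (d′ , p′ , t′) → d ≢ d′ → ¬ Touch G p t′
    one-guard {d} {p} {t} {d′} {p′} {t′} g g′ d≢ pt′ = no-cheaper (d ∷ d′ ∷ []) (a ∷ t′ ∷ []) ((d≢ ∷ []) ∷ [] ∷ [])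
      (λ { (here refl) → Guarded.d∈ g ; (there (here refl)) → Guarded.d∈ g′ }) (≤-trans (m≤m+n 2 1) (m≤n+m 3 (2 * k))) ≤-refl
      (λ { (here refl) → inj₁ a-high ; (there (here refl)) → inj₁ (Guarded.high g′) }) (here a-high)
      λ { (here refl) low touch → covered g pt′ low touch ; (there (here refl)) low touch → covered g′ (inj₂ (Guarded.pt g′)) low touch }
      where
      covered : ∀ {d p t u} → Guarded (d , p , t) → Touch G p t′ → Low u → Touch G u d → Dominates G (a ∷ t′ ∷ []) u
      covered g pt′ low touch with Guarded.only g low touch
      ... | inj₁ ua   = here ua
      ... | inj₂ refl = there (here pt′)

  Distinct : (τ τ′ : Fin n × Fin n × Fin n) → Set
  Distinct τ τ′ = proj₁ τ ≢ proj₁ τ′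

  Escapes : List (Fin n × Fin n × Fin n) → Fin n × Fin n × Fin n → Set
  Escapes Ts τ = ∃[ u ] (Low u × Touch G u (proj₁ τ) × ¬ Dominates G (map (proj₂ ∘ proj₂) Ts) u)

  escape : ∀ Ts → 0 < length Ts → length Ts ≤ 2 * k + 3 → All Guarded Ts → AllPairs Distinct Ts → Any (Escapes Ts) Ts
  escape Ts nonempty small gs distinct = decidable-stable (Any.any? escapes? Ts) λ none →
    no-cheaper (map proj₁ Ts) (map (proj₂ ∘ proj₂) Ts) (AllPairs.map⁺ distinct)
      (λ d∈ → case ∈-map⁻ proj₁ d∈ of λ { (τ , τ∈ , refl) → Guarded.d∈ (All.lookup gs τ∈) })
      (≤-trans (≤-reflexive (List.length-map proj₁ Ts)) small)
      (≤-reflexive (trans (List.length-map (proj₂ ∘ proj₂) Ts) (sym (List.length-map proj₁ Ts))))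
      (λ z∈ → case ∈-map⁻ (proj₂ ∘ proj₂) z∈ of λ { (τ , τ∈ , refl) → inj₁ (Guarded.high (All.lookup gs τ∈)) })
      (Any.map⁺ (first nonempty gs))
      λ {_} {u} d∈ low touch → case ∈-map⁻ proj₁ d∈ of λ { (τ , τ∈ , refl) →
        decidable-stable (dominates? G (map (proj₂ ∘ proj₂) Ts) u) λ ¬dom → none (lose τ∈ (u , low , touch , ¬dom)) }
    where
    escapes? : ∀ τ → Dec (Escapes Ts τ)
    escapes? τ = Fin.any? λ u → low? u ×-dec touch? G u (proj₁ τ) ×-dec ¬? (dominates? G (map (proj₂ ∘ proj₂) Ts) u)
    first : ∀ {Ts} → 0 < length Ts → All Guarded Ts → Any (High ∘ proj₂ ∘ proj₂) Ts
    first _ (g ∷ _) = here (Guarded.high g)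

  record Misses (l : ℕ) (Ts : List (Fin n × Fin n × Fin n)) : Set where
    field
      τ      : Fin n × Fin n × Fin n
      τ∈     : τ ∈ Ts
      ds     : List (Fin n)
      len    : length ds ≡ l
      unique : Unique ds
      ds⊆    : ∀ {d} → d ∈ ds → d ∈ map proj₁ Ts
      misses : All (Missed (proj₂ (proj₂ τ))) ds

  -- The escaping vertex `u` and the guarded vertex `p` of the same clique form an edge that no
  -- other guard touches: `u` because it escapes, `p` by `one-guard`.
  misses-extend : ∀ {l Ts Us σ} → All Guarded Ts → σ ∈ Ts → Escapes Ts σ → (∀ {τ} → τ ∈ Us → τ ∈ Ts) →
                  All (Distinct σ) Us → Misses l Us → Misses (suc l) Ts
  misses-extend {l} {Ts} {Us} {σ} gs σ∈ (u , low , ud , ¬dom) Us⊆ d≢ m = record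
    { τ = τ ; τ∈ = Us⊆ τ∈ ; ds = proj₁ σ ∷ ds ; len = cong suc len
    ; unique = All.tabulate new ∷ unique
    ; ds⊆ = λ { (here refl) → ∈-map⁺ proj₁ σ∈ ; (there d∈) → wider (∈-map⁻ proj₁ (ds⊆ d∈)) }
    ; misses = missed (u , _ , low , p-low , ud , pd , touch-adj G (low-trans low (D-low d∈) p-low ud (touch-sym G pd)) u≢p ,
        (λ touch → ¬dom (lose (∈-map⁺ (proj₂ ∘ proj₂) (Us⊆ τ∈)) (touch-sym G touch))) ,
        (λ touch → one-guard (All.lookup gs σ∈) (All.lookup gs (Us⊆ τ∈)) (All.lookup d≢ τ∈) (touch-sym G touch))) ∷ misses }
    where
    open Misses m
    open Guarded (All.lookup gs σ∈) using (d∈; p-low; pd; pt)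
    u≢p : u ≢ proj₁ (proj₂ σ)
    u≢p eq = ¬dom (lose (∈-map⁺ (proj₂ ∘ proj₂) σ∈) (inj₂ (subst (λ w → Adj G w _) (sym eq) pt)))
    wider : ∀ {d} → ∃[ τ ] (τ ∈ Us × d ≡ proj₁ τ) → d ∈ map proj₁ Ts
    wider (τ , τ∈ , refl) = ∈-map⁺ proj₁ (Us⊆ τ∈)
    new : ∀ {d} → d ∈ ds → proj₁ σ ≢ d
    new d∈ eq = let τ , τ∈ , d≡ = ∈-map⁻ proj₁ (ds⊆ d∈) in All.lookup d≢ τ∈ (trans eq d≡)

  -- Exchanging the d's against the t's must fail at the clique of some d, which is then
  -- missed by all the other t's; removing that d and repeating, one t misses many cliques.
  guards-miss : ∀ l Ts → length Ts ≡ suc l → l ≤ k + 2 → All Guarded Ts → AllPairs Distinct Ts → Misses l Ts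
  guards-miss zero    (τ ∷ _) _ _ _ _ =
    record { τ = τ ; τ∈ = here refl ; ds = [] ; len = refl ; unique = [] ; ds⊆ = λ () ; misses = [] }
  guards-miss (suc l) Ts len l≤ gs distinct =
    let σ , σ∈ , esc = find (escape Ts (subst (0 <_) (sym len) (s≤s z≤n)) small gs distinct)
        Us , lUs , distinct′ , d≢ , Us⊆ = AllPairs-extract {R = Distinct} (λ p → p ∘ sym) distinct σ∈
    in misses-extend gs σ∈ esc Us⊆ d≢ (guards-miss l Us (suc-injective (trans (sym lUs) len)) (≤-trans (n≤1+n l) l≤)
         (All.tabulate (All.lookup gs ∘ Us⊆)) distinct′)
    where
    small : length Ts ≤ 2 * k + 3
    small = ≤-trans (≤-reflexive len) (≤-trans (s≤s l≤) (≤-trans (≤-reflexive (sym (+-suc k 2))) (+-monoˡ-≤ 3 (m≤m+n k (k + 0)))))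

  guards : ∀ {M} → All (_∈ D) M → All (λ d → ¬ Missed a d × ¬ Unexited d) M → Unique M →
           ∃[ Ts ] (length Ts ≡ length M × map proj₁ Ts ≡ M × All Guarded Ts)
  guards [] [] [] = [] , refl , refl , []
  guards (d∈ ∷ ds) ((p , q) ∷ ps) (_ ∷ us) = let x , t , g = guard d∈ p q
                                                 Ts , l , eq , gs = guards ds ps us in
    (_ , x , t) ∷ Ts , cong suc l , cong (_ ∷_) eq , g ∷ gs

  exceptional : List (Fin n)
  exceptional = filter (¬? ∘ unexited?) D

  exceptional∈ : ∀ {d} → d ∈ exceptional → d ∈ D × ¬ Unexited d
  exceptional∈ = ∈-filter⁻ (¬? ∘ unexited?) {xs = D}

  exceptional-unique : Unique exceptional
  exceptional-unique = Unique.filter⁺ (¬? ∘ unexited?) D-unique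

  -- 2k + 4 exceptional vertices would split into at most k + 1 missed by `a` and at least k + 3
  -- guarded ones. Among k + 3 guards some `t` misses k + 2 cliques, one more than `few-missed`
  -- allows.
  exceptional-small : length exceptional ≤ 2 * k + 3
  exceptional-small with length exceptional ≤? 2 * k + 3
  ... | yes l = l
  ... | no ≰ = ⊥-elim contradictory
    where
    B M : List (Fin n)
    B = filter (¬? ∘ missed? a) exceptional
    M = take (k + 3) B
    B∈ : ∀ {d} → d ∈ B → d ∈ exceptional × ¬ Missed a d
    B∈ = ∈-filter⁻ (¬? ∘ missed? a) {xs = exceptional}
    B-large : k + 3 ≤ length B
    B-large = +-cancelˡ-≤ (suc k) _ _ (≤-trans (≤-reflexive (shuffle k)) (≤-trans (≰⇒> ≰)
      (≤-trans (≤-reflexive (length-filter-split (missed? a) exceptional))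
        (+-monoˡ-≤ (length B) (few-missed-D a-high exceptional-unique (proj₁ ∘ exceptional∈))))))
      where
      shuffle : ∀ k → suc k + (k + 3) ≡ suc (2 * k + 3)
      shuffle = solve-∀
    M-unique : Unique M
    M-unique = Unique.take⁺ (k + 3) (Unique.filter⁺ (¬? ∘ missed? a) exceptional-unique)
    M⊆D : ∀ {d} → d ∈ M → d ∈ D
    M⊆D = proj₁ ∘ exceptional∈ ∘ proj₁ ∘ B∈ ∘ ∈-take (k + 3)
    contradictory : ⊥
    contradictory =
      let Ts , lTs , eq , gs = guards {M} (All.tabulate M⊆D)
            (All.tabulate λ d∈ → let p , q = B∈ (∈-take (k + 3) d∈) in q , proj₂ (exceptional∈ p)) M-unique
      in bound eq gs (guards-miss (k + 2) Ts (trans lTs (trans (length-take-≤ {xs = B} B-large) (+-suc k 2))) ≤-refl gs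
                       (AllPairs.map⁻ (subst Unique (sym eq) M-unique)))
      where
      bound : ∀ {Ts} → map proj₁ Ts ≡ M → All Guarded Ts → Misses (k + 2) Ts → ⊥
      bound eq gs m = <⇒≱ (≤-reflexive (trans (+-comm 2 k) (sym len)))
        (few-missed ds (Guarded.high (All.lookup gs τ∈)) (All.tabulate (D-low ∘ in-D))
          (AllPairs-with (λ d∈ d′∈ → D-apart d∈ d′∈) (All.tabulate in-D) unique) misses)
        where
        open Misses m
        in-D : ∀ {d} → d ∈ ds → d ∈ D
        in-D d∈ = M⊆D (subst (_ ∈_) eq (ds⊆ d∈))

  -- From low and high vertices to the first-order obstruction

  simplicial⇒low : ∀ {m} → Simplicial G m → Low m
  simplicial⇒low simp high = let open Cherry (cherry high) in q₁q₂ (simp _ _ vq₁ vq₂)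

  -- A high neighbour `t` of a simplicial `m` would touch the whole clique of `m`, against
  -- `untouched`.
  simplicial⇒unexited : ∀ {m} → Simplicial G m → ¬ HasHigh m
  simplicial⇒unexited {m} simp (t , high , mt) =
    let d , d∈ , md = representative (simplicial⇒low simp)
        p , low , pd , ¬pt = untouched high d∈ in
    ¬pt (touches (low-trans low (D-low d∈) (simplicial⇒low simp) pd (touch-sym G md)))
    where
    touches : ∀ {p} → Touch G p m → Touch G p t
    touches (inj₁ refl) = inj₂ mt
    touches (inj₂ e)    = simp _ _ (adj-sym G e) mt

  unexited⇒simplicial : ∀ {m} → Low m → ¬ HasHigh m → Simplicial G m
  unexited⇒simplicial low ¬h x y e f =
    low-trans (low-neighbour ¬h e) low (low-neighbour ¬h f) (inj₂ (adj-sym G e)) (inj₂ f)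

  good⇒low : ∀ {v} → Good G v → Low v
  good⇒low (m , simp , inj₁ refl) = simplicial⇒low simp
  good⇒low (m , simp , inj₂ e)    = low-neighbour (simplicial⇒unexited simp) (adj-sym G e)

  good-touch : ∀ {v g} → Low v → Good G g → Touch G v g → Good G v
  good-touch low good@(m , simp , t) touch = m , simp , low-trans low (good⇒low good) (simplicial⇒low simp) touch t

  linked⇒high : ∀ {v} → Linked G v → High v
  linked⇒high {v} (¬good , g , good , e) = decidable-stable (high? v) λ low → ¬good (good-touch low good (inj₂ e))

  unexited⇒good : ∀ {d} → Unexited d → Good G d
  unexited⇒good (m , low , t , ¬h) = m , unexited⇒simplicial low ¬h , touch-sym G t

  good⇒unexited : ∀ {d} → Good G d → Unexited d
  good⇒unexited (m , simp , t) = m , simplicial⇒low simp , touch-sym G t , simplicial⇒unexited simp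

  high⇒linked : ∀ {t} → High t → Linked G t
  high⇒linked high =
    let y , y∈ , y∉ , ty = reach high exceptional (≤-trans exceptional-small (+-monoʳ-≤ (2 * k) (m≤m+n 3 2)))
    in (λ good → good⇒low good high) , y ,
       unexited⇒good (decidable-stable (unexited? y) λ ¬un → y∉ (∈-filter⁺ (¬? ∘ unexited?) y∈ ¬un)) , ty

  bad⇒low : ∀ {v} → Bad G v → Low v
  bad⇒low (_ , ¬next) high = ¬next (proj₂ (high⇒linked high))

  exceptional-bad : ∀ {d} → d ∈ exceptional → Bad G d
  exceptional-bad {d} d∈ = let d∈D , ¬un = exceptional∈ d∈ in
    ¬un ∘ good⇒unexited , λ (g , good , e) → ¬un (good⇒unexited (good-touch (D-low d∈D) good (inj₂ e)))

  bad-clique : ∀ {v d} → Bad G v → d ∈ D → Touch G v d → d ∈ exceptional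
  bad-clique bad d∈ t = ∈-filter⁺ (¬? ∘ unexited?) d∈ λ un → proj₁ bad (good-touch (bad⇒low bad) (unexited⇒good un) t)

  exceptional-clique : ∀ {v d} → Low v → d ∈ exceptional → Touch G v d → Bad G v
  exceptional-clique {v} {d} low d∈ t = ¬good , λ (g , good , e) → ¬good (good-touch low good (inj₂ e))
    where
    ¬good : ¬ Good G v
    ¬good good = let d∈D , ¬un = exceptional∈ d∈ in ¬un (good⇒unexited (good-touch (D-low d∈D) good (touch-sym G t)))

  -- Of the at least 4k + 8 vertices of `D`, at most 2k + 3 are exceptional and at most k + 1 others
  -- are missed by `t`, so two are left. In their cliques a neighbour of the simplicial vertex not
  -- adjacent to `t` would give a missed edge.
  spread : ∀ {t} → High t → ∃[ m ] ∃[ m′ ] (Simplicial G m × Simplicial G m′ × ¬ Touch G m m′ × CompleteTo G t m × CompleteTo G t m′)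
  spread {t} high =
    let d , d′ , d∈C , d′∈C , d≢d′ = two-elements (Unique.filter⁺ (¬? ∘ missed? t) (Unique.filter⁺ unexited? D-unique)) C-large
        d∈ , (m , low , md , ¬h) , ¬miss = member d∈C
        d′∈ , (m′ , low′ , m′d′ , ¬h′) , ¬miss′ = member d′∈C
    in m , m′ , unexited⇒simplicial low ¬h , unexited⇒simplicial low′ ¬h′ ,
       (λ t → D-apart d∈ d′∈ d≢d′ (low-trans (D-low d∈) low (D-low d′∈) (touch-sym G md) (low-trans low low′ (D-low d′∈) t m′d′))) ,
       complete d∈ low md ¬h ¬miss , complete d′∈ low′ m′d′ ¬h′ ¬miss′
    where
    B C : List (Fin n)
    B = filter unexited? D
    C = filter (¬? ∘ missed? t) B
    D-large : 4 * k + 8 ≤ length D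
    D-large = ≤-trans (≤-reflexive (trans (sym E-length) (sym (List.length-map proj₁ E))))
      (unique-length-≤ (ys-unique E-apart) λ y∈ → case ∈-map⁻ proj₁ y∈ of λ { (e , e∈ , refl) → E⊆D e∈ })
    C-large : 2 ≤ length C
    C-large = +-cancelˡ-≤ (suc k + (2 * k + 3)) _ _ (begin
      suc k + (2 * k + 3) + 2                                  ≡⟨ shuffle k ⟩
      3 * k + 6                                                ≤⟨ linear 3 4 6 8 (n≤1+n 3) (m≤m+n 6 2) ⟩
      4 * k + 8                                                ≤⟨ D-large ⟩
      length D                                                 ≡⟨ length-filter-split unexited? D ⟩
      length B + length exceptional                            ≤⟨ +-mono-≤ B≤ exceptional-small ⟩
      suc k + length C + (2 * k + 3)                           ≡⟨ shuffle′ (suc k) (length C) (2 * k + 3) ⟩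
      suc k + (2 * k + 3) + length C                           ∎)
      where
      open ≤-Reasoning
      shuffle : ∀ k → suc k + (2 * k + 3) + 2 ≡ 3 * k + 6
      shuffle = solve-∀
      shuffle′ : ∀ a b c → a + b + c ≡ a + c + b
      shuffle′ = solve-∀
      B≤ : length B ≤ suc k + length C
      B≤ = ≤-trans (≤-reflexive (length-filter-split (missed? t) B))
        (+-monoˡ-≤ (length C) (few-missed-D high (Unique.filter⁺ unexited? D-unique) (proj₁ ∘ ∈-filter⁻ unexited? {xs = D})))
    member : ∀ {c} → c ∈ C → c ∈ D × Unexited c × ¬ Missed t c
    member c∈ = let p , ¬m = ∈-filter⁻ (¬? ∘ missed? t) {xs = B} c∈
                    q , un = ∈-filter⁻ unexited? {xs = D} p in q , un , ¬m
    complete : ∀ {d m} → d ∈ D → Low m → Touch G m d → ¬ HasHigh m → ¬ Missed t d → CompleteTo G t m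
    complete d∈ low md ¬h ¬miss x mx = touch-adj G (decidable-stable (touch? G t x) λ ¬t → ¬miss
      (missed (x , _ , low-x , low , low-trans low-x low (D-low d∈) (inj₂ (adj-sym G mx)) md , md , adj-sym G mx , ¬t ,
        λ touch → ¬h (t , high , adj-sym G (touch-adj G touch (high≢low high low)))))) (high≢low high low-x)
      where
      low-x = low-neighbour ¬h mx

  obstruction : Obstruction G exceptional
  obstruction = record
    { good-cliques = good-cliques
    ; bad-cliques = λ x y z bx by bz e f → low-trans (bad⇒low bx) (bad⇒low by) (bad⇒low bz) (inj₂ e) (inj₂ f)
    ; es-apart = AllPairs.filter⁺ (¬? ∘ unexited?) D-aparts
    ; es-bad = All.tabulate exceptional-bad
    ; es-cover = λ v bad → let d , d∈ , t = representative (bad⇒low bad) in lose (bad-clique bad d∈ t) t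
    ; good-linked = good-linked
    ; es-linked = All.tabulate λ d∈ → let t , high , e = D-hasHigh (proj₁ (exceptional∈ d∈)) in t , high⇒linked high , e
    ; linked-spread = λ t linked → spread (linked⇒high linked)
    ; es-optimal = es-optimal }
    where
    good-cliques : ∀ m m′ → Simplicial G m → Simplicial G m′ → Touch G m m′ ⊎ Far G m m′
    good-cliques m m′ s s′ with touch? G m m′
    ... | yes t = inj₁ t
    ... | no ¬t = inj₂ λ x y xm ym′ xy → let low-x = good⇒low (m , s , xm)
                                             low-y = good⇒low (m′ , s′ , ym′) in
      ¬t (low-trans (simplicial⇒low s) low-x (simplicial⇒low s′) (touch-sym G xm) (low-trans low-x low-y (simplicial⇒low s′) xy ym′))
    good-linked : ∀ m → Simplicial G m → ∃[ y ] ∃[ t ] (Adj G m y × Linked G t × Adj G y t)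
    good-linked m s = let x , _ , mx , t , high , e = clique-exit (simplicial⇒low s) in
      x , t , touch-adj G mx (λ eq → simplicial⇒unexited s (t , high , subst (λ v → Adj G v t) (sym eq) e)) , high⇒linked high , e
    es-optimal : ¬ (∃[ xs ] (length xs ≤ length exceptional × Any (Linked G) xs × (∀ v → Bad G v → Dominates G xs v)))
    es-optimal (xs , l , linked , covers) = no-cheaper exceptional (map σ xs) exceptional-unique (proj₁ ∘ exceptional∈)
      exceptional-small (≤-trans (≤-reflexive (List.length-map σ xs)) l)
      (λ z∈ → case ∈-map⁻ σ z∈ of λ { (x , _ , refl) → σ-kind x })
      (Any.map⁺ (Any.map (λ linked → σ-high (linked⇒high linked)) linked))
      λ d∈ low t → let x , x∈ , ux = find (covers _ (exceptional-clique low d∈ t)) in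
        lose (∈-map⁺ σ x∈) (σ-touch x low ux)
      where
      -- `no-cheaper` admits only high vertices and vertices of `D`. A low member of `xs` is
      -- therefore replaced by the vertex of `D` in its clique, which touches the same low vertices.
      σ : Fin n → Fin n
      σ x with high? x
      ... | yes _  = x
      ... | no low = proj₁ (representative low)
      σ-kind : ∀ x → High (σ x) ⊎ σ x ∈ D
      σ-kind x with high? x
      ... | yes high = inj₁ high
      ... | no low   = inj₂ (proj₁ (proj₂ (representative low)))
      σ-high : ∀ {x} → High x → High (σ x)
      σ-high {x} high with high? x
      ... | yes _  = high
      ... | no low = ⊥-elim (low high)
      σ-touch : ∀ x {u} → Low u → Touch G u x → Touch G u (σ x)
      σ-touch x low-u t with high? x
      ... | yes _  = t
      ... | no low = let _ , d∈ , xd = representative low in low-trans low-u low (D-low d∈) t xd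

-- Constants and the decision procedure

anchor-bound witness-bound crowd-bound threshold : ℕ → ℕ
anchor-bound k  = 3 + 2 * k
witness-bound k = 2 ^ k + 8 * anchor-bound k
-- After `a` and the witnesses are discarded, two neighbours of `a` are kept in `D` as ends of the
-- friendly triple, and the others supply the blocks for the private neighbours.
crowd-bound k   = witness-bound k + (3 + need (4 * k + 8))
threshold k     = 2 ^ k + 6 * anchor-bound k + anchor-bound k * crowd-bound k

HasEdge : ∀ {n} → Graph n → Set
HasEdge G = ∃[ u ] ∃[ v ] Adj G u v

module _ {n} (G : Graph n) (conn : Connected G) where

  neighbour : HasEdge G → ∀ v → ∃[ w ] Adj G v w
  neighbour (u , u′ , e) v with conn v u
  ... | _ , here     = u′ , e
  ... | _ , step f _ = _ , f

  all-SD : HasEdge G → SD G (allFin n)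
  all-SD edge = (λ v → lose (∈-allFin v) (inj₁ refl)) ,
    All.tabulate λ {v} _ → let w , e = neighbour edge v in lose (∈-allFin w) (adj⇒≢ G (adj-sym G e) , inj₁ e)

  obstructed : ∀ {k γ} → HasEdge G → Irreducible G k γ → SD≤ G γ → threshold k < γ → ¬ ¬ Obstructed G (2 * k + 3)
  obstructed {k} {γ} edge irr (L , l , sd) large none =
    anchor G conn (proj₂ (proj₂ edge)) k (Irreducible.free irr) λ anc →
    let open Outside G irr anc (neighbour edge) in
    optimal sd l λ (D , opt) →
    let open Optimal opt
        a , crowd = crowded opt (crowd-bound k) (<-≤-trans large (Irreducible.minimum irr D-SD))
    in at opt a crowd
    where
    at : ∀ {anc} {D} → (opt : Outside.Optimal G irr anc (neighbour edge) D) → ∀ a →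
         crowd-bound k < length (Outside.around G irr anc (neighbour edge) opt a) → ⊥
    at {anc} {D} opt a crowd with around opt a ∖ (a ∷ W) in eq | Y-large | ∖-Unique (a ∷ W) (Unique.filter⁺ (λ v → touch? G v a) D-unique)
      where
      open Outside G irr anc (neighbour edge)
      open Optimal opt
      open Witnesses (witnesses opt)
      Y-large : 3 + need (4 * k + 8) ≤ length (around opt a ∖ (a ∷ W))
      Y-large = +-cancelˡ-≤ (suc (witness-bound k)) _ _ (≤-trans crowd
        (≤-trans (length-∖-≥ (a ∷ W) (Unique.filter⁺ (λ v → touch? G v a) D-unique)) (+-monoˡ-≤ _ (s≤s W-size))))
    ... | r₁ ∷ r₂ ∷ L | s≤s (s≤s l) | u@((r₁≢r₂ ∷ r₁∉) ∷ r₂∉ ∷ L-unique) =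
      none (exceptional , exceptional-small , obstruction)
      where
      open Outside G irr anc (neighbour edge)
      open Optimal opt
      open Witnesses (witnesses opt)
      Y-spec : ∀ {y} → y ∈ r₁ ∷ r₂ ∷ L → y ∈ D × y ∉ W × Adj G y a
      Y-spec y∈ = let y∈′ , y∉ = ∈-∖⁻ (a ∷ W) (subst (_ ∈_) (sym eq) y∈)
                      y∈D , t = ∈-filter⁻ (λ v → touch? G v a) {xs = D} y∈′ in
        y∈D , y∉ ∘ there , touch-adj G t (y∉ ∘ here)
      open Spread G irr D-SD D-length D-unique W⊆D (λ v∈ → mates v∈ tt) u Y-spec (s≤s (s≤s (≤-trans (s≤s z≤n) l)))
        (here refl) (there (here refl)) r₁≢r₂ L-unique (λ y∈ → there (there y∈))
        (λ r∈ → All.lookup r₁∉ r∈ refl) (λ r∈ → All.lookup r₂∉ r∈ refl) (≤-trans (n≤1+n _) l)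
        using (exceptional; exceptional-small; obstruction)

-- The second alternative is for γ beyond the threshold. `HasEdge` is there because of the
-- one-vertex graph, which has no semitotal dominating set of any size and is not obstructed either.
Decision : ℕ → Pred 0
Decision k G _ = (∃[ s ] (s < suc (threshold k) × MergedSD≤ G s × ¬ SD≤ G s)) ⊎
                 (¬ SD≤ G (threshold k) × HasEdge G × ¬ Obstructed G (2 * k + 3))

def-decision : ∀ k → PolyDef (Decision k)
def-decision k = def-⊎
  (def-∃< (λ s → def-× (def-mergedSD≤ s) (def-¬ (def-SD≤ s))) (suc (threshold k)))
  (def-× (def-¬ (def-SD≤ (threshold k))) (def-× (def-∃ (def-∃ (def-adj (suc zero) zero))) (def-¬ (def-obstructed (2 * k + 3)))))

decision-correct : ∀ k {n} (G : Graph n) → Connected G × Free (P₃+ k P₂) G → OneEdgeContraction G ⇔ Decision k G []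
decision-correct k {n} G (conn , free) = mk⇔ to from
  where
  to : OneEdgeContraction G → Decision k G []
  to one with oneEdge⇒merged G one
  ... | m , s , sd , merged@(u , v , e , _) , ¬sd , _ with s ≤? threshold k
  ... | yes s≤ = inj₁ (s , s≤s s≤ , merged , ¬sd)
  ... | no  s≰ = inj₂ ((λ sd′ → ¬sd (SD≤-mono G (<⇒≤ (≰⇒> s≰)) sd′)) , (u , v , e) ,
                       λ (es , _ , obstruction) → Soundness.not-reducible G obstruction one)
  from : Decision k G [] → OneEdgeContraction G
  from (inj₁ (s , _ , merged@(u , v , e , _) , ¬sd)) =
    merged⇒oneEdge G (allFin n , ≤-refl , all-SD G conn (u , v , e)) merged ¬sd
  from (inj₂ (¬sd , edge , ¬obs)) with least-SD≤ G _ (allFin n , ≤-refl , all-SD G conn edge)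
  -- Either some contraction reaches γ - 1, which is the reduction sought, or `G` is irreducible and
  -- the structure theory provides an obstruction.
  ... | γ , _ , sd , least with PolyDef.decide (def-mergedSD≤ (pred γ)) G []
  ... | yes merged = merged⇒oneEdge G sd merged λ sd′ → <⇒≱ (pred< γ (≤-trans (s≤s z≤n) large)) (least sd′)
    where
    large : threshold k < γ
    large = ≰⇒> λ γ≤ → ¬sd (SD≤-mono G γ≤ sd)
    pred< : ∀ m → 0 < m → pred m < m
    pred< (suc m) _ = ≤-refl
  ... | no ¬merged = ⊥-elim (obstructed G conn edge (irreducible G {k} (free ∘ P₃+⇒induced G) conn least ¬merged) sd
                              (≰⇒> λ γ≤ → ¬sd (SD≤-mono G γ≤ sd)) ¬obs)

theorem16 : (k : ℕ) → PolyTimeSolvableOn OneEdgeContraction (λ G → Connected G × Free (P₃+ k P₂) G)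
theorem16 k = polyTimeSolvable (def-decision k) (decision-correct k)
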